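{- For infinitely many values of $k$, there is a graph $G'=(V(G'),E(G'))$ and a set $K\subseteq V(G')$ of size $k$ for which any flow-sparsifier that is a convex combination of $0$-extension graphs has quality at least $\Omega(\sqrt{\log k})$.
   Context: Graphs are undirected and carry edge capacities $c:E\to\mathbb{R}_{\ge0}$; the vertices in the given set $K$ are called terminals. A $K$-flow is a multicommodity flow all of whose sources and sinks lie in $K$. It is feasible if the total flow on each edge is at most its capacity, and has congestion $\rho$ if the total flow on each edge is at most $\rho$ times its capacity. A flow-sparsifier for a capacitated graph $(G,c)$ and terminals $K$ with quality $\rho\ge1$ is a capacitated graph $(H,c_H)$ on vertex set $K$ such that (a) any feasible $K$-flow in $G$ can be feasibly routed in $H$, and (b) any feasible $K$-flow in $H$ can be routed in $G$ with congestion at most $\rho$; saying that the quality is at least $\rho_0$ means that (b) fails for every $\rho<\rho_0$. For a graph $G=(V,E)$ with capacities $c$ and a map $f:V\to K$ with $f(x)=x$ for all $x\in K$, the associated $0$-extension graph is the capacitated graph on $K$ in which distinct $s,t\in K$ have capacity equal to the sum of $c(e)$ over all edges $e=(u,v)\in E$ with $\{f(u),f(v)\}=\{s,t\}$. A convex combination $\sum_i\lambda_iH_i$ (with $\lambda_i\ge0$, $\sum_i\lambda_i=1$) of such graphs is the capacitated graph on $K$ with capacity function $\sum_i\lambda_ic_{H_i}$. The $\Omega(\cdot)$ hides an absolute positive constant independent of $k$. -}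

module Defs where

open import Algebra.Bundles.Raw using (RawMonoid)
import Algebra.Definitions.RawMonoid as RawMonoidDefs
open import Data.Bool.Base using (Bool; true; false; if_then_else_; _∧_)
open import Data.Fin.Base using (Fin)
import Data.Fin.Properties as Fin
open import Data.Nat.Base as ℕ using (ℕ; zero; suc; ⌊_/2⌋)
import Data.Nat.Properties as ℕ
import Data.Nat.Induction as ℕ
open import Data.Nat.Logarithm
  using (⌊log₂_⌋; ⌊log₂⌋-mono-≤; ⌊log₂⌊n/2⌋⌋≡⌊log₂n⌋∸1; ⌊log₂[2^n]⌋≡n)
import Data.Nat.Solver as ℕ-Solver
import Data.Integer.Base as ℤ
import Data.Integer.Properties as ℤ
open import Data.Product.Base using (Σ; ∃; _×_; _,_; proj₁; proj₂)
open import Data.Rational.Base as ℚ using (ℚ; 0ℚ; 1ℚ; ½)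
import Data.Rational.Properties as ℚ
import Data.Rational.Unnormalised.Base as ℚᵘ
import Data.Rational.Unnormalised.Properties as ℚᵘ
import Data.Rational.Solver as ℚ-Solver
open import Data.Sum.Base using (inj₁; inj₂)
open import Function.Base using (id)
open import Function.Bundles using (_↣_; module Injection)
open import Relation.Binary.PropositionalEquality
  using (_≡_; _≢_; refl; sym; trans; cong; cong₂; subst; subst₂)
open import Relation.Nullary
  using (¬_; Dec; does; yes; no; contradiction; _×-dec_; _⊎-dec_)

-- A real number is a Cauchy sequence of rationals; equality of reals is _≈_.

record ℝ : Set where
  constructor mkℝ
  field
    seq    : ℕ → ℚ
    cauchy : ∀ ε → 0ℚ ℚ.< ε → ∃ λ N → ∀ m n → N ℕ.≤ m → N ℕ.≤ n →
             ℚ.∣ seq m ℚ.- seq n ∣ ℚ.≤ ε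

open ℝ public

infix 4 _≈_ _≤_ _<_

record _≈_ (x y : ℝ) : Set where
  constructor mk≈
  field
    ≈-close : ∀ ε → 0ℚ ℚ.< ε → ∃ λ N → ∀ n → N ℕ.≤ n → ℚ.∣ seq x n ℚ.- seq y n ∣ ℚ.≤ ε

record _≤_ (x y : ℝ) : Set where
  constructor mk≤
  field
    ≤-close : ∀ ε → 0ℚ ℚ.< ε → ∃ λ N → ∀ n → N ℕ.≤ n → seq x n ℚ.≤ seq y n ℚ.+ ε

record _<_ (x y : ℝ) : Set where
  constructor mk<
  field
    <-gap : ∃ λ ε → 0ℚ ℚ.< ε × ∃ λ N → ∀ n → N ℕ.≤ n → seq x n ℚ.+ ε ℚ.≤ seq y n

open _≈_ public
open _≤_ public
open _<_ public

fromℚ : ℚ → ℝ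
fromℚ q = mkℝ (λ _ → q) λ ε 0<ε → 0 , λ _ _ _ _ →
  subst (ℚ._≤ ε) (sym (cong ℚ.∣_∣ (ℚ.+-inverseʳ q))) (ℚ.<⇒≤ 0<ε)

0ℝ 1ℝ : ℝ
0ℝ = fromℚ 0ℚ
1ℝ = fromℚ 1ℚ

half>0 : ∀ {ε} → 0ℚ ℚ.< ε → 0ℚ ℚ.< ½ ℚ.* ε
half>0 {ε} 0<ε = subst (ℚ._< ½ ℚ.* ε) (ℚ.*-zeroʳ ½) (ℚ.*-monoʳ-<-pos ½ 0<ε)

half+half : ∀ ε → ½ ℚ.* ε ℚ.+ ½ ℚ.* ε ≡ ε
half+half ε = trans (sym (ℚ.*-distribʳ-+ ε ½ ½)) (ℚ.*-identityˡ ε)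

nonNeg* : ∀ {a b c d} → 0ℚ ℚ.≤ c → 0ℚ ℚ.≤ b → a ℚ.≤ b → c ℚ.≤ d → a ℚ.* c ℚ.≤ b ℚ.* d
nonNeg* {a} {b} {c} {d} 0≤c 0≤b a≤b c≤d = ℚ.≤-trans
  (ℚ.*-monoʳ-≤-nonNeg c {{ℚ.nonNegative 0≤c}} a≤b)
  (ℚ.*-monoˡ-≤-nonNeg b {{ℚ.nonNegative 0≤b}} c≤d)

bounded : ∀ x → ∃ λ B → 0ℚ ℚ.< B × ∃ λ N → ∀ n → N ℕ.≤ n → ℚ.∣ seq x n ∣ ℚ.≤ B
bounded x with cauchy x 1ℚ (ℚ.positive⁻¹ 1ℚ)
... | N , close = 1ℚ ℚ.+ ℚ.∣ seq x N ∣ , 0<B , N , λ n N≤n → begin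
    ℚ.∣ seq x n ∣                                     ≡⟨ cong ℚ.∣_∣ (split (seq x n) (seq x N)) ⟩
    ℚ.∣ (seq x n ℚ.- seq x N) ℚ.+ seq x N ∣           ≤⟨ ℚ.∣p+q∣≤∣p∣+∣q∣ (seq x n ℚ.- seq x N) (seq x N) ⟩
    ℚ.∣ seq x n ℚ.- seq x N ∣ ℚ.+ ℚ.∣ seq x N ∣       ≤⟨ ℚ.+-monoˡ-≤ ℚ.∣ seq x N ∣ (close n N N≤n ℕ.≤-refl) ⟩
    1ℚ ℚ.+ ℚ.∣ seq x N ∣                              ∎
  where
  open ℚ.≤-Reasoning
  open ℚ-Solver.+-*-Solver
  split : ∀ a b → a ≡ (a ℚ.- b) ℚ.+ b
  split = solve 2 (λ a b → a := (a :+ :- b) :+ b) refl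
  0<B : 0ℚ ℚ.< 1ℚ ℚ.+ ℚ.∣ seq x N ∣
  0<B = ℚ.+-mono-<-≤ (ℚ.positive⁻¹ 1ℚ) (ℚ.0≤∣p∣ (seq x N))

infixl 6 _+_
infixl 7 _*_

abstract
  +-cauchy : ∀ x y ε → 0ℚ ℚ.< ε → ∃ λ N → ∀ m n → N ℕ.≤ m → N ℕ.≤ n →
           ℚ.∣ (seq x m ℚ.+ seq y m) ℚ.- (seq x n ℚ.+ seq y n) ∣ ℚ.≤ ε
  +-cauchy x y ε 0<ε =
    let M , px = cauchy x (½ ℚ.* ε) (half>0 0<ε)
        N , py = cauchy y (½ ℚ.* ε) (half>0 0<ε)
    in M ℕ.⊔ N , λ m n p q → begin
    ℚ.∣ (seq x m ℚ.+ seq y m) ℚ.- (seq x n ℚ.+ seq y n) ∣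
      ≡⟨ cong ℚ.∣_∣ (regroup (seq x m) (seq y m) (seq x n) (seq y n)) ⟩
    ℚ.∣ (seq x m ℚ.- seq x n) ℚ.+ (seq y m ℚ.- seq y n) ∣
      ≤⟨ ℚ.∣p+q∣≤∣p∣+∣q∣ (seq x m ℚ.- seq x n) (seq y m ℚ.- seq y n) ⟩
    ℚ.∣ seq x m ℚ.- seq x n ∣ ℚ.+ ℚ.∣ seq y m ℚ.- seq y n ∣
      ≤⟨ ℚ.+-mono-≤ (px m n (ℕ.m⊔n≤o⇒m≤o M N p) (ℕ.m⊔n≤o⇒m≤o M N q))
                    (py m n (ℕ.m⊔n≤o⇒n≤o M N p) (ℕ.m⊔n≤o⇒n≤o M N q)) ⟩
    ½ ℚ.* ε ℚ.+ ½ ℚ.* ε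
      ≡⟨ half+half ε ⟩
    ε ∎
    where
    open ℚ.≤-Reasoning
    open ℚ-Solver.+-*-Solver
    regroup : ∀ a b c d → (a ℚ.+ b) ℚ.- (c ℚ.+ d) ≡ (a ℚ.- c) ℚ.+ (b ℚ.- d)
    regroup = solve 4 (λ a b c d → (a :+ b) :+ :- (c :+ d) := (a :+ :- c) :+ (b :+ :- d)) refl

_+_ : ℝ → ℝ → ℝ
x + y = mkℝ (λ n → seq x n ℚ.+ seq y n) (+-cauchy x y)

abstract
  *-cauchy : ∀ x y ε → 0ℚ ℚ.< ε → ∃ λ N → ∀ m n → N ℕ.≤ m → N ℕ.≤ n →
           ℚ.∣ seq x m ℚ.* seq y m ℚ.- seq x n ℚ.* seq y n ∣ ℚ.≤ ε
  *-cauchy x y ε 0<ε =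
    let A , 0<A , N₁ , bx = bounded x
        B , 0<B , N₂ , by = bounded y
        α , 0<α , Aα      = scale A 0<A (½ ℚ.* ε) (half>0 0<ε)
        β , 0<β , Bβ      = scale B 0<B (½ ℚ.* ε) (half>0 0<ε)
        N₃ , cy           = cauchy y α 0<α
        N₄ , cx           = cauchy x β 0<β
    in (N₁ ℕ.⊔ N₂) ℕ.⊔ (N₃ ℕ.⊔ N₄) , λ m n p q →
    let p₁ = ℕ.m⊔n≤o⇒m≤o N₁ N₂ (ℕ.m⊔n≤o⇒m≤o (N₁ ℕ.⊔ N₂) (N₃ ℕ.⊔ N₄) p)
        q₂ = ℕ.m⊔n≤o⇒n≤o N₁ N₂ (ℕ.m⊔n≤o⇒m≤o (N₁ ℕ.⊔ N₂) (N₃ ℕ.⊔ N₄) q)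
        p′ = ℕ.m⊔n≤o⇒n≤o (N₁ ℕ.⊔ N₂) (N₃ ℕ.⊔ N₄) p
        q′ = ℕ.m⊔n≤o⇒n≤o (N₁ ℕ.⊔ N₂) (N₃ ℕ.⊔ N₄) q
        dy = seq y m ℚ.- seq y n
        dx = seq x m ℚ.- seq x n
    in begin
    ℚ.∣ seq x m ℚ.* seq y m ℚ.- seq x n ℚ.* seq y n ∣
      ≡⟨ cong ℚ.∣_∣ (regroup (seq x m) (seq y m) (seq x n) (seq y n)) ⟩
    ℚ.∣ seq x m ℚ.* dy ℚ.+ dx ℚ.* seq y n ∣
      ≤⟨ ℚ.∣p+q∣≤∣p∣+∣q∣ (seq x m ℚ.* dy) (dx ℚ.* seq y n) ⟩
    ℚ.∣ seq x m ℚ.* dy ∣ ℚ.+ ℚ.∣ dx ℚ.* seq y n ∣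
      ≡⟨ cong₂ ℚ._+_ (ℚ.∣p*q∣≡∣p∣*∣q∣ (seq x m) dy)
           (trans (ℚ.∣p*q∣≡∣p∣*∣q∣ dx (seq y n)) (ℚ.*-comm ℚ.∣ dx ∣ ℚ.∣ seq y n ∣)) ⟩
    ℚ.∣ seq x m ∣ ℚ.* ℚ.∣ dy ∣ ℚ.+ ℚ.∣ seq y n ∣ ℚ.* ℚ.∣ dx ∣
      ≤⟨ ℚ.+-mono-≤
           (nonNeg* (ℚ.0≤∣p∣ dy) (ℚ.<⇒≤ 0<A) (bx m p₁)
              (cy m n (ℕ.m⊔n≤o⇒m≤o N₃ N₄ p′) (ℕ.m⊔n≤o⇒m≤o N₃ N₄ q′)))
           (nonNeg* (ℚ.0≤∣p∣ dx) (ℚ.<⇒≤ 0<B) (by n q₂)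
              (cx m n (ℕ.m⊔n≤o⇒n≤o N₃ N₄ p′) (ℕ.m⊔n≤o⇒n≤o N₃ N₄ q′))) ⟩
    A ℚ.* α ℚ.+ B ℚ.* β
      ≡⟨ cong₂ ℚ._+_ Aα Bβ ⟩
    ½ ℚ.* ε ℚ.+ ½ ℚ.* ε
      ≡⟨ half+half ε ⟩
    ε ∎
    where
    open ℚ.≤-Reasoning
    telescope : ∀ a b c → (a ℚ.- b) ℚ.+ (b ℚ.- c) ≡ a ℚ.- c
    telescope a b c = trans (ℚ.+-assoc a (ℚ.- b) (b ℚ.- c)) (cong (a ℚ.+_)
      (trans (sym (ℚ.+-assoc (ℚ.- b) b (ℚ.- c)))
        (trans (cong (ℚ._- c) (ℚ.+-inverseˡ b)) (ℚ.+-identityˡ (ℚ.- c)))))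
    regroup : ∀ a b c d → a ℚ.* b ℚ.- c ℚ.* d ≡ a ℚ.* (b ℚ.- d) ℚ.+ (a ℚ.- c) ℚ.* d
    regroup a b c d = sym (trans
      (cong₂ ℚ._+_
        (trans (ℚ.*-distribˡ-+ a b (ℚ.- d)) (cong (a ℚ.* b ℚ.+_) (sym (ℚ.neg-distribʳ-* a d))))
        (trans (ℚ.*-distribʳ-+ d a (ℚ.- c)) (cong (a ℚ.* d ℚ.+_) (sym (ℚ.neg-distribˡ-* c d)))))
      (telescope (a ℚ.* b) (a ℚ.* d) (c ℚ.* d)))
    scale : ∀ B → 0ℚ ℚ.< B → ∀ ε → 0ℚ ℚ.< ε → ∃ λ δ → 0ℚ ℚ.< δ × B ℚ.* δ ≡ ε
    scale B 0<B ε 0<ε = (ℚ.1/ B) ℚ.* ε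
      , subst (ℚ._< (ℚ.1/ B) ℚ.* ε) (ℚ.*-zeroʳ (ℚ.1/ B)) (ℚ.*-monoʳ-<-pos (ℚ.1/ B) {{ℚ.1/pos⇒pos B}} 0<ε)
      , trans (sym (ℚ.*-assoc B (ℚ.1/ B) ε))
          (trans (cong (ℚ._* ε) (ℚ.*-inverseʳ B)) (ℚ.*-identityˡ ε))
      where instance
        B-pos : ℚ.Positive B
        B-pos = ℚ.positive 0<B
        B-nonZero : ℚ.NonZero B
        B-nonZero = ℚ.pos⇒nonZero B

_*_ : ℝ → ℝ → ℝ
x * y = mkℝ (λ n → seq x n ℚ.* seq y n) (*-cauchy x y)

⌊√_⌋ : ℕ → ℕ
⌊√ zero ⌋  = 0
⌊√ suc n ⌋ with suc ⌊√ n ⌋ ℕ.* suc ⌊√ n ⌋ ℕ.≤? suc n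
... | yes _ = suc ⌊√ n ⌋
... | no  _ = ⌊√ n ⌋

isqrt-spec : ∀ n → ⌊√ n ⌋ ℕ.* ⌊√ n ⌋ ℕ.≤ n × n ℕ.< suc ⌊√ n ⌋ ℕ.* suc ⌊√ n ⌋
isqrt-spec zero = ℕ.z≤n , ℕ.s≤s ℕ.z≤n
isqrt-spec (suc n) with suc ⌊√ n ⌋ ℕ.* suc ⌊√ n ⌋ ℕ.≤? suc n | isqrt-spec n
... | yes p | _ , up = p , ℕ.≤-<-trans up
        (ℕ.*-mono-< (ℕ.n<1+n (suc ⌊√ n ⌋)) (ℕ.n<1+n (suc ⌊√ n ⌋)))
... | no ¬p | lo , _ = ℕ.m≤n⇒m≤1+n lo , ℕ.≰⇒> ¬p

2*⌊n/2⌋≤n : ∀ n → 2 ℕ.* ⌊ n /2⌋ ℕ.≤ n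
2*⌊n/2⌋≤n zero          = ℕ.z≤n
2*⌊n/2⌋≤n (suc zero)    = ℕ.z≤n
2*⌊n/2⌋≤n (suc (suc n)) = subst (ℕ._≤ suc (suc n))
  (sym (cong suc (ℕ.+-suc ⌊ n /2⌋ (⌊ n /2⌋ ℕ.+ 0))))
  (ℕ.s≤s (ℕ.s≤s (2*⌊n/2⌋≤n n)))

log-lower : ∀ n → 1 ℕ.≤ n → 2 ℕ.^ ⌊log₂ n ⌋ ℕ.≤ n
log-lower = ℕ.<-rec (λ n → 1 ℕ.≤ n → 2 ℕ.^ ⌊log₂ n ⌋ ℕ.≤ n) step
  where
  step : ∀ n → (∀ {m} → m ℕ.< n → 1 ℕ.≤ m → 2 ℕ.^ ⌊log₂ m ⌋ ℕ.≤ m) →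
         1 ℕ.≤ n → 2 ℕ.^ ⌊log₂ n ⌋ ℕ.≤ n
  step (suc zero) _ _ = ℕ.≤-refl
  step n@(suc (suc n′)) rec _ = subst (λ e → 2 ℕ.^ e ℕ.≤ n) suc-log
    (ℕ.≤-trans (ℕ.*-monoʳ-≤ 2 (rec (ℕ.⌊n/2⌋<n (suc n′)) (ℕ.s≤s ℕ.z≤n))) (2*⌊n/2⌋≤n n))
    where
    suc-log : suc ⌊log₂ ⌊ n /2⌋ ⌋ ≡ ⌊log₂ n ⌋
    suc-log = trans (cong suc (⌊log₂⌊n/2⌋⌋≡⌊log₂n⌋∸1 n))
      (ℕ.m+[n∸m]≡n (⌊log₂⌋-mono-≤ {2} {n} (ℕ.s≤s (ℕ.s≤s ℕ.z≤n))))

log-upper : ∀ n → n ℕ.< 2 ℕ.^ suc ⌊log₂ n ⌋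
log-upper n with 2 ℕ.^ suc ⌊log₂ n ⌋ ℕ.≤? n
... | no ¬p = ℕ.≰⇒> ¬p
... | yes p = contradiction
  (subst (ℕ._≤ ⌊log₂ n ⌋) (⌊log₂[2^n]⌋≡n (suc ⌊log₂ n ⌋)) (⌊log₂⌋-mono-≤ p))
  (ℕ.<-irrefl refl)

-- Equal to ⌊N √(log₂ k)⌋, since ⌊log₂ (k ^ N²)⌋ = ⌊N² log₂ k⌋ and ⌊√ ⌊x⌋⌋ = ⌊√ x⌋.
⌊_√log₂_⌋ : ℕ → ℕ → ℕ
⌊ N √log₂ k ⌋ = ⌊√ ⌊log₂ (k ℕ.^ (N ℕ.* N)) ⌋ ⌋

*-swap² : ∀ a b → (a ℕ.* b) ℕ.* (a ℕ.* b) ≡ (a ℕ.* a) ℕ.* (b ℕ.* b)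
*-swap² = solve 2 (λ a b → (a :* b) :* (a :* b) := (a :* a) :* (b :* b)) refl
  where open ℕ-Solver.+-*-Solver

cancel-² : ∀ a b → a ℕ.* a ℕ.< b ℕ.* b → a ℕ.< b
cancel-² a b p with a ℕ.<? b
... | yes q = q
... | no ¬q = contradiction p (ℕ.≤⇒≯ (ℕ.*-mono-≤ (ℕ.≮⇒≥ ¬q) (ℕ.≮⇒≥ ¬q)))

cancel-^ : ∀ a b → 2 ℕ.^ a ℕ.< 2 ℕ.^ b → a ℕ.< b
cancel-^ a b p with a ℕ.<? b
... | yes q = q
... | no ¬q = contradiction p (ℕ.≤⇒≯ (ℕ.^-monoʳ-≤ 2 (ℕ.≮⇒≥ ¬q)))

module Approx (k : ℕ) .{{_ : ℕ.NonZero k}} where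
  open ℕ.≤-Reasoning

  approx-lower : ∀ m → 2 ℕ.^ (⌊ m √log₂ k ⌋ ℕ.* ⌊ m √log₂ k ⌋) ℕ.≤ k ℕ.^ (m ℕ.* m)
  approx-lower m = ℕ.≤-trans (ℕ.^-monoʳ-≤ 2 (proj₁ (isqrt-spec ⌊log₂ (k ℕ.^ (m ℕ.* m)) ⌋)))
    (log-lower (k ℕ.^ (m ℕ.* m)) (ℕ.m^n>0 k (m ℕ.* m)))

  approx-upper : ∀ m → k ℕ.^ (m ℕ.* m) ℕ.<
    2 ℕ.^ (suc ⌊ m √log₂ k ⌋ ℕ.* suc ⌊ m √log₂ k ⌋)
  approx-upper m = ℕ.<-≤-trans (log-upper (k ℕ.^ (m ℕ.* m)))
    (ℕ.^-monoʳ-≤ 2 (proj₂ (isqrt-spec ⌊log₂ (k ℕ.^ (m ℕ.* m)) ⌋)))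

  cross : ∀ m n .{{_ : ℕ.NonZero m}} → ⌊ m √log₂ k ⌋ ℕ.* n ℕ.< suc ⌊ n √log₂ k ⌋ ℕ.* m
  cross m n = cancel-² (a ℕ.* n) (b ℕ.* m) (cancel-^ _ _ (begin-strict
    2 ℕ.^ ((a ℕ.* n) ℕ.* (a ℕ.* n))  ≡⟨ cong (2 ℕ.^_) (*-swap² a n) ⟩
    2 ℕ.^ ((a ℕ.* a) ℕ.* (n ℕ.* n))  ≡⟨ ℕ.^-*-assoc 2 (a ℕ.* a) (n ℕ.* n) ⟨
    (2 ℕ.^ (a ℕ.* a)) ℕ.^ (n ℕ.* n)  ≤⟨ ℕ.^-monoˡ-≤ (n ℕ.* n) (approx-lower m) ⟩
    (k ℕ.^ (m ℕ.* m)) ℕ.^ (n ℕ.* n)  ≡⟨ ℕ.^-*-assoc k (m ℕ.* m) (n ℕ.* n) ⟩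
    k ℕ.^ ((m ℕ.* m) ℕ.* (n ℕ.* n))  ≡⟨ cong (k ℕ.^_) (ℕ.*-comm (m ℕ.* m) (n ℕ.* n)) ⟩
    k ℕ.^ ((n ℕ.* n) ℕ.* (m ℕ.* m))  ≡⟨ ℕ.^-*-assoc k (n ℕ.* n) (m ℕ.* m) ⟨
    (k ℕ.^ (n ℕ.* n)) ℕ.^ (m ℕ.* m)  <⟨ ℕ.^-monoˡ-< (m ℕ.* m) {{ℕ.m*n≢0 m m}} (approx-upper n) ⟩
    (2 ℕ.^ (b ℕ.* b)) ℕ.^ (m ℕ.* m)  ≡⟨ ℕ.^-*-assoc 2 (b ℕ.* b) (m ℕ.* m) ⟩
    2 ℕ.^ ((b ℕ.* b) ℕ.* (m ℕ.* m))  ≡⟨ cong (2 ℕ.^_) (*-swap² b m) ⟨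
    2 ℕ.^ ((b ℕ.* m) ℕ.* (b ℕ.* m))  ∎))
    where
    a = ⌊ m √log₂ k ⌋
    b = suc ⌊ n √log₂ k ⌋

/-mono-≤ : ∀ a b m n → a ℕ.* suc n ℕ.≤ b ℕ.* suc m →
           (ℤ.+ a) ℚ./ suc m ℚ.≤ (ℤ.+ b) ℚ./ suc n
/-mono-≤ a b m n p = ℚ.toℚᵘ-cancel-≤
  (ℚᵘ.≤-respˡ-≃ (ℚᵘ.≃-sym (ℚ.toℚᵘ-fromℚᵘ (ℚᵘ.mkℚᵘ (ℤ.+ a) m)))
    (ℚᵘ.≤-respʳ-≃ (ℚᵘ.≃-sym (ℚ.toℚᵘ-fromℚᵘ (ℚᵘ.mkℚᵘ (ℤ.+ b) n)))
      (ℚᵘ.*≤* (subst₂ ℤ._≤_ (ℤ.pos-* a (suc n)) (ℤ.pos-* b (suc m)) (ℤ.+≤+ p)))))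

suc-/ : ∀ a n → (ℤ.+ suc a) ℚ./ suc n ≡ (ℤ.+ 1) ℚ./ suc n ℚ.+ (ℤ.+ a) ℚ./ suc n
suc-/ a n = ℚ.toℚᵘ-injective (begin
  ℚ.toℚᵘ ((ℤ.+ suc a) ℚ./ suc n)
    ≈⟨ ℚ.toℚᵘ-fromℚᵘ (ℚᵘ.mkℚᵘ (ℤ.+ suc a) n) ⟩
  ℚᵘ.mkℚᵘ (ℤ.+ suc a) n
    ≈⟨ ℚᵘ.*≡* lemma ⟩
  ℚᵘ.mkℚᵘ (ℤ.+ 1) n ℚᵘ.+ ℚᵘ.mkℚᵘ (ℤ.+ a) n
    ≈⟨ ℚᵘ.+-cong (ℚ.toℚᵘ-fromℚᵘ (ℚᵘ.mkℚᵘ (ℤ.+ 1) n)) (ℚ.toℚᵘ-fromℚᵘ (ℚᵘ.mkℚᵘ (ℤ.+ a) n)) ⟨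
  ℚ.toℚᵘ ((ℤ.+ 1) ℚ./ suc n) ℚᵘ.+ ℚ.toℚᵘ ((ℤ.+ a) ℚ./ suc n)
    ≈⟨ ℚ.toℚᵘ-homo-+ ((ℤ.+ 1) ℚ./ suc n) ((ℤ.+ a) ℚ./ suc n) ⟨
  ℚ.toℚᵘ ((ℤ.+ 1) ℚ./ suc n ℚ.+ (ℤ.+ a) ℚ./ suc n) ∎)
  where
  open ℚᵘ.≃-Reasoning
  d = ℤ.+ suc n
  lemma : ℤ.+ suc a ℤ.* (d ℤ.* d) ≡ (ℤ.+ 1 ℤ.* d ℤ.+ ℤ.+ a ℤ.* d) ℤ.* d
  lemma = trans (sym (ℤ.*-assoc (ℤ.+ suc a) d d))
    (cong (ℤ._* d) (ℤ.*-distribʳ-+ d (ℤ.+ 1) (ℤ.+ a)))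

archimedean : ∀ ε → 0ℚ ℚ.< ε → ∃ λ N → ∀ n → N ℕ.≤ n → (ℤ.+ 1) ℚ./ suc n ℚ.≤ ε
archimedean ε@(ℚ.mkℚ (ℤ.+ suc p) d _) _ = d , λ n d≤n →
  subst ((ℤ.+ 1) ℚ./ suc n ℚ.≤_) (ℚ.↥p/↧p≡p ε) (/-mono-≤ 1 (suc p) n d
    (ℕ.*-mono-≤ (ℕ.s≤s (ℕ.z≤n {p})) (ℕ.s≤s d≤n)))
archimedean (ℚ.mkℚ (ℤ.+ zero) d _) 0<ε = contradiction (ℚ.drop-*<* 0<ε) λ { (ℤ.+<+ ()) }
archimedean (ℚ.mkℚ ℤ.-[1+ _ ] d _) 0<ε = contradiction (ℚ.drop-*<* 0<ε) λ ()

∣-∣-≤ : ∀ a b ε → a ℚ.≤ ε ℚ.+ b → b ℚ.≤ ε ℚ.+ a → ℚ.∣ a ℚ.- b ∣ ℚ.≤ ε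
∣-∣-≤ a b ε p q with ℚ.∣p∣≡p∨∣p∣≡-p (a ℚ.- b)
... | inj₁ e = subst₂ ℚ._≤_ (sym e) (cancel ε b) (ℚ.+-monoˡ-≤ (ℚ.- b) p)
  where
  open ℚ-Solver.+-*-Solver
  cancel : ∀ ε b → (ε ℚ.+ b) ℚ.- b ≡ ε
  cancel = solve 2 (λ ε b → (ε :+ b) :+ :- b := ε) refl
... | inj₂ e = subst₂ ℚ._≤_ (trans (flip a b) (sym e)) (cancel ε a) (ℚ.+-monoˡ-≤ (ℚ.- a) q)
  where
  open ℚ-Solver.+-*-Solver
  cancel : ∀ ε b → (ε ℚ.+ b) ℚ.- b ≡ ε
  cancel = solve 2 (λ ε b → (ε :+ b) :+ :- b := ε) refl
  flip : ∀ a b → b ℚ.- a ≡ ℚ.- (a ℚ.- b)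
  flip = solve 2 (λ a b → b :+ :- a := :- (a :+ :- b)) refl

√log₂-approx : ℕ → ℕ → ℚ
√log₂-approx k n = (ℤ.+ ⌊ suc n √log₂ k ⌋) ℚ./ suc n

abstract
  √log₂-cauchy : ∀ k .{{_ : ℕ.NonZero k}} ε → 0ℚ ℚ.< ε →
    ∃ λ N → ∀ m n → N ℕ.≤ m → N ℕ.≤ n → ℚ.∣ √log₂-approx k m ℚ.- √log₂-approx k n ∣ ℚ.≤ ε
  √log₂-cauchy k ε 0<ε = let N , small = archimedean ε 0<ε in N , λ m n N≤m N≤n →
    ∣-∣-≤ (s m) (s n) ε (close ε m n (small n N≤n)) (close ε n m (small m N≤m))
    where
    s : ℕ → ℚ
    s = √log₂-approx k
    close : ∀ ε m n → (ℤ.+ 1) ℚ./ suc n ℚ.≤ ε → s m ℚ.≤ ε ℚ.+ s n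
    close ε m n 1/n≤ε = begin
      s m                                     ≤⟨ /-mono-≤ ⌊ suc m √log₂ k ⌋ (suc ⌊ suc n √log₂ k ⌋) m n
                                                   (ℕ.<⇒≤ (Approx.cross k (suc m) (suc n))) ⟩
      (ℤ.+ suc ⌊ suc n √log₂ k ⌋) ℚ./ suc n   ≡⟨ suc-/ ⌊ suc n √log₂ k ⌋ n ⟩
      (ℤ.+ 1) ℚ./ suc n ℚ.+ s n               ≤⟨ ℚ.+-monoˡ-≤ (s n) 1/n≤ε ⟩
      ε ℚ.+ s n                               ∎
      where open ℚ.≤-Reasoning

-- √(log₂ k) as the limit of ⌊N √(log₂ k)⌋ / N; the value at k = 0
-- is a dummy.
√log₂ : ℕ → ℝ
√log₂ zero      = 0ℝ
√log₂ k@(suc _) = mkℝ (√log₂-approx k) (√log₂-cauchy k)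

+-0-rawMonoid : RawMonoid _ _
+-0-rawMonoid = record { Carrier = ℝ ; _≈_ = _≈_ ; _∙_ = _+_ ; ε = 0ℝ }

∑ : ∀ {n} → (Fin n → ℝ) → ℝ
∑ = RawMonoidDefs.sum +-0-rawMonoid

-- A finite simple graph. The capacity of an edge {u , v} is cap u v; cap is
-- extended by zero to the pairs that are not edges.
record CapGraph (n : ℕ) : Set where
  field
    edge        : Fin n → Fin n → Bool
    edge-sym    : ∀ u v → edge u v ≡ edge v u
    edge-irrefl : ∀ u → edge u u ≡ false
    cap         : Fin n → Fin n → ℝ
    cap-sym     : ∀ u v → cap u v ≈ cap v u
    cap-nonneg  : ∀ u v → 0ℝ ≤ cap u v
    cap-nonedge : ∀ u v → edge u v ≡ false → cap u v ≈ 0ℝ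

open CapGraph public

-- Sum over the edges {u , v}, each taken once, with u < v.
∑-edges : ∀ {n} → CapGraph n → (Fin n → Fin n → ℝ) → ℝ
∑-edges G g = ∑ λ u → ∑ λ v → if does (u Fin.<? v) ∧ edge G u v then g u v else 0ℝ

-- Multicommodity flow with one commodity for each ordered pair of terminals;
-- τ sends a terminal to its vertex. flow s t u v is the amount of commodity
-- (s , t) sent across {u , v} from u to v, and demand s t is the amount shipped.
-- Conservation counts the demand as entering at τ s and leaving at τ t, so a
-- commodity with s = t imposes no requirement.
record KFlow {n k : ℕ} (G : CapGraph n) (τ : Fin k → Fin n) : Set where
  field
    demand        : Fin k → Fin k → ℝ
    demand-nonneg : ∀ s t → 0ℝ ≤ demand s t
    flow          : Fin k → Fin k → Fin n → Fin n → ℝ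
    flow-nonneg   : ∀ s t u v → 0ℝ ≤ flow s t u v
    flow-nonedge  : ∀ s t u v → edge G u v ≡ false → flow s t u v ≈ 0ℝ
    conservation  : ∀ s t v →
      ∑ (λ u → flow s t v u) + (if does (v Fin.≟ τ t) then demand s t else 0ℝ) ≈
      ∑ (λ u → flow s t u v) + (if does (v Fin.≟ τ s) then demand s t else 0ℝ)

open KFlow public

load : ∀ {n k} {G : CapGraph n} {τ : Fin k → Fin n} → KFlow G τ → Fin n → Fin n → ℝ
load F u v = ∑ λ s → ∑ λ t → flow F s t u v + flow F s t v u

HasCongestion : ∀ {n k} {G : CapGraph n} {τ : Fin k → Fin n} → KFlow G τ → ℝ → Set
HasCongestion {G = G} F ρ = ∀ u v → edge G u v ≡ true → load F u v ≤ ρ * cap G u v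

Feasible : ∀ {n k} {G : CapGraph n} {τ : Fin k → Fin n} → KFlow G τ → Set
Feasible {G = G} F = ∀ u v → edge G u v ≡ true → load F u v ≤ cap G u v

SameDemands : ∀ {n m k} {G : CapGraph n} {H : CapGraph m}
              {σ : Fin k → Fin n} {τ : Fin k → Fin m} → KFlow G σ → KFlow H τ → Set
SameDemands F F′ = ∀ s t → demand F s t ≈ demand F′ s t

-- A terminal set K ⊆ V(G) of size k is an injection
-- Fin k ↣ Fin n, so that Fin k is the vertex set of the sparsifier.

module _ {n k : ℕ} (G : CapGraph n) (K : Fin k ↣ Fin n) (H : CapGraph k) where
  private
    τ : Fin k → Fin n
    τ = Injection.to K

  RoutableInSparsifier : Set
  RoutableInSparsifier = (F : KFlow G τ) → Feasible F →
    Σ (KFlow H id) λ F′ → SameDemands F F′ × Feasible F′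

  RoutableBack : ℝ → Set
  RoutableBack ρ = (F : KFlow H id) → Feasible F →
    Σ (KFlow G τ) λ F′ → SameDemands F F′ × HasCongestion F′ ρ

  IsFlowSparsifierOfQuality : ℝ → Set
  IsFlowSparsifierOfQuality ρ = 1ℝ ≤ ρ × RoutableInSparsifier × RoutableBack ρ

  IsFlowSparsifier : Set
  IsFlowSparsifier = ∃ IsFlowSparsifierOfQuality

  QualityAtLeast : ℝ → Set
  QualityAtLeast ρ₀ = ∀ ρ → ρ < ρ₀ → ¬ RoutableBack ρ

FixesTerminals : ∀ {n k} → Fin k ↣ Fin n → (Fin n → Fin k) → Set
FixesTerminals K f = ∀ i → f (Injection.to K i) ≡ i

-- {a , b} = {s , t} as sets
SamePair? : ∀ {k} (a b s t : Fin k) → Dec _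
SamePair? a b s t = (a Fin.≟ s ×-dec b Fin.≟ t) ⊎-dec (a Fin.≟ t ×-dec b Fin.≟ s)

-- Meaningful for s ≢ t only.
0-extension-cap : ∀ {n k} → CapGraph n → (Fin n → Fin k) → Fin k → Fin k → ℝ
0-extension-cap G f s t = ∑-edges G λ u v →
  if does (SamePair? (f u) (f v) s t) then cap G u v else 0ℝ

-- The edge set of H is constrained only through its capacities, which vanish
-- outside it.
record IsConvexCombinationOf0-Extensions {n k : ℕ}
       (G : CapGraph n) (K : Fin k ↣ Fin n) (H : CapGraph k) : Set where
  field
    count        : ℕ
    coeff        : Fin count → ℝ
    coeff-nonneg : ∀ i → 0ℝ ≤ coeff i
    coeff-sum    : ∑ coeff ≈ 1ℝ
    ext          : Fin count → Fin n → Fin k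
    ext-fixes    : ∀ i → FixesTerminals K (ext i)
    cap-combo    : ∀ s t → s ≢ t →
      cap H s t ≈ ∑ λ i → coeff i * 0-extension-cap G (ext i) s t

{-# OPTIONS --safe #-}
module Submission where

-- The gap instance is the one of the metric relaxation of 0-extension: an
-- expander, the core, with a terminal pendant at each of its vertices by an edge
-- of length ℓ ~ √log k. Routing the capacities of a sparsifier H back into G
-- with congestion ρ bounds ∑ c_H(s,t) d(s,t) by ρ ∑ c_G(e) d(e) for every metric
-- d, so it suffices that every 0-extension f costs Ω(ℓ) times more than G. If f
-- separates a constant fraction of all pairs, it cuts a constant fraction of the
-- core edges, and each cut edge is stretched from 1 to 2ℓ. Otherwise f maps both
-- points of many pairs to the same terminal; since most pairs are at distance
-- Ω(log k), the pendant edges are then stretched to Ω(log k) on average.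
--
-- Constant degree of the core is not needed, only expansion and logarithmic
-- distances. Both hold for the Cayley graph of 𝔽₂^m whose generators are the
-- columns of the generator matrix of a good binary code: the distance of the
-- code is the spectral gap, and balls are small because the group is abelian.

open import Algebra.Bundles using (CommutativeMonoid; CommutativeSemiring)
import Algebra.Properties.CommutativeMonoid.Sum as CommutativeMonoidSum
import Algebra.Properties.Semiring.Mult as SemiringMult
import Algebra.Properties.Semiring.Sum as SemiringSum
open import Algebra.Structures.Biased using (isCommutativeSemiringˡ)
open import Data.Bool.Base using (Bool; T; true; false; if_then_else_; not; _∧_; _xor_)
import Data.Bool.Properties as Bool
open import Data.Fin.Base using (Fin; toℕ; zero; suc; _↑ˡ_; _↑ʳ_; splitAt)
import Data.Fin.Properties as Fin
open import Data.Integer.Base as ℤ using (ℤ; 0ℤ; 1ℤ; -1ℤ)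
import Data.Integer.Properties as ℤ
import Data.Integer.Tactic.RingSolver as ℤ-Solver
open import Data.Nat.Base as ℕ using (ℕ; zero; suc)
open import Data.Nat.Logarithm using (⌊log₂_⌋; ⌊log₂⌋-mono-≤; ⌊log₂[2^n]⌋≡n)
import Data.Nat.Properties as ℕ
import Data.Nat.Tactic.RingSolver as ℕ-Solver
open import Data.Product.Base using (Σ; ∃; _×_; _,_; proj₁; proj₂)
open import Data.Rational.Base as ℚ using (ℚ; 0ℚ; 1ℚ; ½)
import Data.Rational.Properties as ℚ
import Data.Rational.Solver as ℚ-Solver
open import Data.Sum.Base using (_⊎_; inj₁; inj₂; [_,_]′)
open import Data.Vec.Base using (Vec; []; _∷_; replicate; zipWith)
import Data.Vec.Functional as Vector
import Data.Vec.Properties as Vec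
open import Function.Base using (_∘_; id)
open import Function.Bundles using (_↣_; module Injection; mk↣)
open import Relation.Binary.Bundles using (Preorder)
open import Relation.Binary.PropositionalEquality
  using (_≡_; _≢_; refl; sym; trans; cong; cong₂; subst; subst₂; module ≡-Reasoning)
import Relation.Binary.Reasoning.Preorder as PreorderReasoning
open import Relation.Binary.Structures using (IsEquivalence)
open import Relation.Nullary using (¬_; Dec; does; yes; no; contradiction; _×-dec_)
open import Relation.Nullary.Decidable using (dec-true; dec-false)

-- The cube 𝔽₂^m

-- The length `ℓ` balances two gains. Cutting core edges stretches them by a factor of order ℓ;
-- clustering stretches pendant edges from ℓ to order log k, a factor of order log k / ℓ. The two
-- agree when ℓ² is of order log k. Core and pendant edges must moreover have comparable total
-- volume in `G`, so a pendant edge gets capacity of order degree / ℓ. A connected Cayley graph of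
-- 𝔽₂^m has degree at least m = log₂ k, which makes that capacity of order ℓ here. The spectral gap
-- comes from the code because the characters of 𝔽₂^m diagonalise the Cayley graph: the Laplacian
-- eigenvalue of `y` is twice the number of generators `g` with `⟨ y , g ⟩` true, that is twice the
-- weight of the codeword of `y`. Balls are small because the order of generators is irrelevant and
-- repeated ones cancel: the points within distance r are sums over sets of at most r generators.
-- All facts about the graph are inequalities between natural numbers or integers; real numbers
-- enter only with flows, the capacities of `H`, and ρ.

Cube : ℕ → Set
Cube = Vec Bool

infixl 6 _⊕_
infix 4 _≟ᵛ_

_⊕_ : ∀ {m} → Cube m → Cube m → Cube m
_⊕_ = zipWith _xor_

𝟎 : ∀ {m} → Cube m
𝟎 = replicate _ false

_≟ᵛ_ : ∀ {m} (x y : Cube m) → Dec (x ≡ y)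
_≟ᵛ_ = Vec.≡-dec Bool._≟_

⟨_,_⟩ : ∀ {m} → Cube m → Cube m → Bool
⟨ [] , [] ⟩       = false
⟨ b ∷ x , c ∷ y ⟩ = (b ∧ c) xor ⟨ x , y ⟩

⊕-assoc : ∀ {m} (x y z : Cube m) → x ⊕ y ⊕ z ≡ x ⊕ (y ⊕ z)
⊕-assoc = Vec.zipWith-assoc Bool.xor-assoc

⊕-comm : ∀ {m} (x y : Cube m) → x ⊕ y ≡ y ⊕ x
⊕-comm = Vec.zipWith-comm Bool.xor-comm

⊕-identityˡ : ∀ {m} (x : Cube m) → 𝟎 ⊕ x ≡ x
⊕-identityˡ = Vec.zipWith-identityˡ (λ _ → refl)

⊕-identityʳ : ∀ {m} (x : Cube m) → x ⊕ 𝟎 ≡ x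
⊕-identityʳ = Vec.zipWith-identityʳ Bool.xor-identityʳ

⊕-self : ∀ {m} (x : Cube m) → x ⊕ x ≡ 𝟎
⊕-self []      = refl
⊕-self (b ∷ x) = cong₂ _∷_ (Bool.xor-same b) (⊕-self x)

⊕-cancelʳ : ∀ {m} (x g : Cube m) → x ⊕ g ⊕ g ≡ x
⊕-cancelʳ x g = trans (⊕-assoc x g g) (trans (cong (x ⊕_) (⊕-self g)) (⊕-identityʳ x))

⊕-cancelˡ : ∀ {m} (x g : Cube m) → x ⊕ (x ⊕ g) ≡ g
⊕-cancelˡ x g = trans (sym (⊕-assoc x x g)) (trans (cong (_⊕ g) (⊕-self x)) (⊕-identityˡ g))

-- Doubling is used instead of `2 ^ m` so that `Fin (size (suc m))` is `Fin (size m + size m)` by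
-- computation and `splitAt` applies directly.
size : ℕ → ℕ
size zero    = 1
size (suc m) = size m ℕ.+ size m

size≡2^ : ∀ m → size m ≡ 2 ℕ.^ m
size≡2^ zero    = refl
size≡2^ (suc m) = cong₂ ℕ._+_ (size≡2^ m) (trans (size≡2^ m) (sym (ℕ.+-identityʳ (2 ℕ.^ m))))

point : ∀ {m} → Fin (size m) → Cube m
point {zero}  _ = []
point {suc m} i = [ (λ j → false ∷ point j) , (λ j → true ∷ point j) ]′ (splitAt (size m) i)

index : ∀ {m} → Cube m → Fin (size m)
index []                  = zero
index {suc m} (false ∷ x) = index x ↑ˡ size m
index {suc m} (true ∷ x)  = size m ↑ʳ index x

point-↑ˡ : ∀ {m} (i : Fin (size m)) → point {suc m} (i ↑ˡ size m) ≡ false ∷ point i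
point-↑ˡ {m} i = cong [ (λ j → false ∷ point j) , (λ j → true ∷ point j) ]′
  (Fin.splitAt-↑ˡ (size m) i (size m))

point-↑ʳ : ∀ {m} (i : Fin (size m)) → point {suc m} (size m ↑ʳ i) ≡ true ∷ point i
point-↑ʳ {m} i = cong [ (λ j → false ∷ point j) , (λ j → true ∷ point j) ]′
  (Fin.splitAt-↑ʳ (size m) (size m) i)

point-index : ∀ {m} (x : Cube m) → point (index x) ≡ x
point-index []          = refl
point-index (false ∷ x) = trans (point-↑ˡ (index x)) (cong (false ∷_) (point-index x))
point-index (true ∷ x)  = trans (point-↑ʳ (index x)) (cong (true ∷_) (point-index x))

index-point : ∀ {m} (i : Fin (size m)) → index {m} (point i) ≡ i
index-point {zero}  zero = refl
index-point {suc m} i with splitAt (size m) i in eq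
... | inj₁ j = trans (cong (_↑ˡ size m) (index-point {m} j)) (Fin.splitAt⁻¹-↑ˡ eq)
... | inj₂ j = trans (cong (size m ↑ʳ_) (index-point {m} j)) (Fin.splitAt⁻¹-↑ʳ eq)

module CubeSum {c ℓ} (M : CommutativeMonoid c ℓ) where
  private module M = CommutativeMonoid M
  open M using (Carrier; _≈_; _∙_; ε)
  open CommutativeMonoidSum M

  sum-++ : ∀ a {b} (f : Fin (a ℕ.+ b) → Carrier) →
           sum f ≈ sum (f ∘ (_↑ˡ b)) ∙ sum (f ∘ (a ↑ʳ_))
  sum-++ zero    f = M.sym (M.identityˡ _)
  sum-++ (suc a) f = M.trans (M.∙-congˡ (sum-++ a (f ∘ suc))) (M.sym (M.assoc _ _ _))

  sum-select : ∀ {n} (i : Fin n) (f : Fin n → Carrier) →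
               sum (λ j → if does (i Fin.≟ j) then f j else ε) ≈ f i
  sum-select {suc n} zero    f = M.trans (M.∙-congˡ (sum-replicate-zero n)) (M.identityʳ _)
  sum-select {suc n} (suc i) f = M.trans (M.identityˡ _)
    (M.trans (M.reflexive (sum-cong-≗ same)) (sum-select i (f ∘ suc)))
    where
    same : ∀ j → (if does (suc i Fin.≟ suc j) then f (suc j) else ε) ≡
                 (if does (i Fin.≟ j) then f (suc j) else ε)
    same j with i Fin.≟ j
    ... | yes _ = refl
    ... | no  _ = refl

  sum-select′ : ∀ {n} (i : Fin n) (f : Fin n → Carrier) →
                sum (λ j → if does (j Fin.≟ i) then f j else ε) ≈ f i
  sum-select′ i f = M.trans (M.reflexive (sum-cong-≗ flipped)) (sum-select i f)
    where
    flipped : ∀ j → (if does (j Fin.≟ i) then f j else ε) ≡ (if does (i Fin.≟ j) then f j else ε)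
    flipped j with j Fin.≟ i | i Fin.≟ j
    ... | yes _ | yes _ = refl
    ... | no _  | no _  = refl
    ... | yes p | no ¬q = contradiction (sym p) ¬q
    ... | no ¬p | yes q = contradiction (sym q) ¬p

  sum-sum-select : ∀ {m n} (u : Fin m) (v : Fin n) (f : Fin m → Fin n → Carrier) →
    sum (λ s → sum (λ t → if does (s Fin.≟ u) ∧ does (t Fin.≟ v) then f s t else ε)) ≈ f u v
  sum-sum-select {n = n} u v f = M.trans (sum-cong-≋ inner) (sum-select′ u (λ s → f s v))
    where
    inner : ∀ s → sum (λ t → if does (s Fin.≟ u) ∧ does (t Fin.≟ v) then f s t else ε) ≈
                  (if does (s Fin.≟ u) then f s v else ε)
    inner s with does (s Fin.≟ u)
    ... | true  = sum-select′ v (f s)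
    ... | false = sum-replicate-zero n

  sum⁴-comm : ∀ {m n p q} (f : Fin m → Fin n → Fin p → Fin q → Carrier) →
    sum (λ a → sum (λ b → sum (λ c → sum (λ d → f a b c d)))) ≈
    sum (λ c → sum (λ d → sum (λ a → sum (λ b → f a b c d))))
  sum⁴-comm f =
    M.trans (sum-cong-≋ (λ a → ∑-comm (λ b c → sum (f a b c)))) (
    M.trans (∑-comm (λ a c → sum (λ b → sum (f a b c)))) (
    sum-cong-≋ (λ c →
      M.trans (sum-cong-≋ (λ a → ∑-comm (λ b d → f a b c d)))
              (∑-comm (λ a d → sum (λ b → f a b c d))))))

  -- Opaque, so that the summand can be recovered from a cube sum by unification.
  opaque
    cubeSum : ∀ {m} → (Cube m → Carrier) → Carrier
    cubeSum {m} f = sum (f ∘ point {m})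

  opaque
    unfolding cubeSum

    cubeSum-cong : ∀ {m} {f g : Cube m → Carrier} → (∀ x → f x ≈ g x) → cubeSum f ≈ cubeSum g
    cubeSum-cong {m} f≈g = sum-cong-≋ (f≈g ∘ point {m})

    cubeSum-[] : ∀ (f : Cube 0 → Carrier) → cubeSum f ≈ f []
    cubeSum-[] f = M.identityʳ _

    cubeSum-∷ : ∀ {m} (f : Cube (suc m) → Carrier) →
                cubeSum f ≈ cubeSum (f ∘ (false ∷_)) ∙ cubeSum (f ∘ (true ∷_))
    cubeSum-∷ {m} f = M.trans (sum-++ (size m) (f ∘ point))
      (M.reflexive (cong₂ _∙_ (sum-cong-≗ (cong f ∘ point-↑ˡ {m})) (sum-cong-≗ (cong f ∘ point-↑ʳ {m}))))

    cubeSum-∙ : ∀ {m} (f g : Cube m → Carrier) →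
                cubeSum (λ x → f x ∙ g x) ≈ cubeSum f ∙ cubeSum g
    cubeSum-∙ {m} f g = ∑-distrib-+ (f ∘ point {m}) (g ∘ point)

    cubeSum-sum-comm : ∀ {m n} (f : Cube m → Fin n → Carrier) →
                       cubeSum (λ x → sum (f x)) ≈ sum (λ i → cubeSum (λ x → f x i))
    cubeSum-sum-comm {m} f = ∑-comm (f ∘ point {m})

    cubeSum-comm : ∀ {m n} (f : Cube m → Cube n → Carrier) →
                   cubeSum (λ x → cubeSum (f x)) ≈ cubeSum (λ y → cubeSum (λ x → f x y))
    cubeSum-comm {m} {n} f = ∑-comm {size m} {size n} (λ i j → f (point {m} i) (point {n} j))

    cubeSum-point : ∀ {m} (f : Cube m → Carrier) → sum (f ∘ point {m}) ≈ cubeSum f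
    cubeSum-point f = M.refl

    cubeSum-select : ∀ {m} (x : Cube m) (f : Cube m → Carrier) →
                     cubeSum (λ y → if does (x ≟ᵛ y) then f y else ε) ≈ f x
    cubeSum-select {m} x f = M.trans (M.reflexive (sum-cong-≗ same))
      (M.trans (sum-select (index x) (f ∘ point)) (M.reflexive (cong f (point-index x))))
      where
      same : ∀ j → (if does (x ≟ᵛ point j) then f (point j) else ε) ≡
                   (if does (index x Fin.≟ j) then f (point j) else ε)
      same j with x ≟ᵛ point j | index x Fin.≟ j
      ... | yes _ | yes _ = refl
      ... | no  _ | no  _ = refl
      ... | yes p | no ¬q = contradiction (trans (cong index p) (index-point {m} j)) ¬q
      ... | no ¬p | yes q = contradiction (trans (sym (point-index x)) (cong point q)) ¬p

  -- Translation acts within the two halves of the cube, and in addition swaps them when the head of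
  -- `g` is `true`.
  cubeSum-translate : ∀ {m} (g : Cube m) (f : Cube m → Carrier) →
                      cubeSum (λ x → f (x ⊕ g)) ≈ cubeSum f
  cubeSum-translate []          f = cubeSum-cong λ { [] → M.refl }
  cubeSum-translate (false ∷ g) f = M.trans (cubeSum-∷ _) (M.trans
    (M.∙-cong (cubeSum-translate g (f ∘ (false ∷_))) (cubeSum-translate g (f ∘ (true ∷_))))
    (M.sym (cubeSum-∷ f)))
  cubeSum-translate (true ∷ g) f = M.trans (cubeSum-∷ _) (M.trans (M.comm _ _) (M.trans
    (M.∙-cong (cubeSum-translate g (f ∘ (false ∷_))) (cubeSum-translate g (f ∘ (true ∷_))))
    (M.sym (cubeSum-∷ f))))

module ℕ-Sum where
  open SemiringSum ℕ.+-*-semiring public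
  open CubeSum ℕ.+-0-commutativeMonoid public

  sum-mono-≤ : ∀ {n} {f g : Fin n → ℕ} → (∀ i → f i ℕ.≤ g i) → sum f ℕ.≤ sum g
  sum-mono-≤ {zero}  f≤g = ℕ.z≤n
  sum-mono-≤ {suc n} f≤g = ℕ.+-mono-≤ (f≤g zero) (sum-mono-≤ (f≤g ∘ suc))

  sum-const : ∀ n a → sum {n} (λ _ → a) ≡ n ℕ.* a
  sum-const zero    a = refl
  sum-const (suc n) a = cong (a ℕ.+_) (sum-const n a)

  opaque
    unfolding cubeSum

    cubeSum-mono-≤ : ∀ {m} {f g : Cube m → ℕ} → (∀ x → f x ℕ.≤ g x) → cubeSum f ℕ.≤ cubeSum g
    cubeSum-mono-≤ {m} f≤g = sum-mono-≤ (f≤g ∘ point {m})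

    cubeSum-const : ∀ m a → cubeSum {m} (λ _ → a) ≡ size m ℕ.* a
    cubeSum-const m = sum-const (size m)

    *-distribˡ-cubeSum : ∀ {m} a (f : Cube m → ℕ) → a ℕ.* cubeSum f ≡ cubeSum (λ x → a ℕ.* f x)
    *-distribˡ-cubeSum {m} a f = *-distribˡ-sum a (f ∘ point {m})

    *-distribʳ-cubeSum : ∀ {m} a (f : Cube m → ℕ) → cubeSum f ℕ.* a ≡ cubeSum (λ x → f x ℕ.* a)
    *-distribʳ-cubeSum {m} a f = *-distribʳ-sum a (f ∘ point {m})

module ℤ-Sum where
  open SemiringSum ℤ.+-*-semiring public
  open CubeSum ℤ.+-0-commutativeMonoid public

  pos-sum : ∀ {n} (f : Fin n → ℕ) → ℤ.+ ℕ-Sum.sum f ≡ sum (λ i → ℤ.+ f i)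
  pos-sum {zero}  f = refl
  pos-sum {suc n} f = trans (ℤ.pos-+ (f zero) _) (cong (λ a → ℤ.+ f zero ℤ.+ a) (pos-sum (f ∘ suc)))

  sum-mono-≤ : ∀ {n} {f g : Fin n → ℤ} → (∀ i → f i ℤ.≤ g i) → sum f ℤ.≤ sum g
  sum-mono-≤ {zero}  f≤g = ℤ.≤-refl
  sum-mono-≤ {suc n} f≤g = ℤ.+-mono-≤ (f≤g zero) (sum-mono-≤ (f≤g ∘ suc))

  opaque
    unfolding cubeSum ℕ-Sum.cubeSum

    cubeSum-mono-≤ : ∀ {m} {f g : Cube m → ℤ} → (∀ x → f x ℤ.≤ g x) → cubeSum f ℤ.≤ cubeSum g
    cubeSum-mono-≤ {m} f≤g = sum-mono-≤ (f≤g ∘ point {m})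

    *-distribˡ-cubeSum : ∀ {m} a (f : Cube m → ℤ) → a ℤ.* cubeSum f ≡ cubeSum (λ x → a ℤ.* f x)
    *-distribˡ-cubeSum {m} a f = *-distribˡ-sum a (f ∘ point {m})

    *-distribʳ-cubeSum : ∀ {m} a (f : Cube m → ℤ) → cubeSum f ℤ.* a ≡ cubeSum (λ x → f x ℤ.* a)
    *-distribʳ-cubeSum {m} a f = *-distribʳ-sum a (f ∘ point {m})

    pos-cubeSum : ∀ {m} (f : Cube m → ℕ) → ℤ.+ ℕ-Sum.cubeSum f ≡ cubeSum (λ x → ℤ.+ f x)
    pos-cubeSum {m} f = pos-sum (f ∘ point {m})

-- Binary codes

module Code where
  open import Data.Nat.Base using (_+_; _*_; _^_; _≤_; _<_)
  open ℕ-Sum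

  weight zeros : ∀ {m d} → (Fin d → Cube m) → Cube m → ℕ
  weight gs y = sum λ j → if ⟨ y , gs j ⟩ then 1 else 0
  zeros gs y = sum λ j → if ⟨ y , gs j ⟩ then 0 else 1

  weight+zeros : ∀ {m} d (gs : Fin d → Cube m) y → weight gs y + zeros gs y ≡ d
  weight+zeros d gs y = trans (sym (∑-distrib-+ {d} _ _)) (trans (sum-cong-≗ (one ∘ gs))
    (trans (sum-const d 1) (ℕ.*-identityʳ d)))
    where
    one : ∀ g → (if ⟨ y , g ⟩ then 1 else 0) + (if ⟨ y , g ⟩ then 0 else 1) ≡ 1
    one g with ⟨ y , g ⟩
    ... | true  = refl
    ... | false = refl

  -- Some coordinate of `y` is `true`; flipping it in `g` flips `⟨ y , g ⟩`, so both values are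
  -- taken on half of the cube. The factor 2 avoids dividing.
  cubeSum-⟨⟩ : ∀ {m} (φ : Bool → ℕ) (y : Cube m) → y ≢ 𝟎 →
               2 * cubeSum (λ g → φ ⟨ y , g ⟩) ≡ size m * (φ false + φ true)
  cubeSum-⟨⟩ φ []          y≢𝟎 = contradiction refl y≢𝟎
  cubeSum-⟨⟩ {suc m} φ (false ∷ y) y≢𝟎 = begin
    2 * cubeSum (λ g → φ ⟨ false ∷ y , g ⟩) ≡⟨ cong (2 *_) (cubeSum-∷ (λ g → φ ⟨ false ∷ y , g ⟩)) ⟩
    2 * (S + S)                             ≡⟨ ℕ.*-distribˡ-+ 2 S S ⟩
    2 * S + 2 * S                           ≡⟨ cong₂ _+_ ih ih ⟩
    size m * c + size m * c                 ≡⟨ ℕ.*-distribʳ-+ c (size m) (size m) ⟨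
    (size m + size m) * c                   ∎
    where
    open ≡-Reasoning
    S = cubeSum (λ g → φ ⟨ y , g ⟩)
    c = φ false + φ true
    ih = cubeSum-⟨⟩ φ y (y≢𝟎 ∘ cong (false ∷_))
  cubeSum-⟨⟩ {suc m} φ (true ∷ y) y≢𝟎 = begin
    2 * cubeSum (λ g → φ ⟨ true ∷ y , g ⟩)   ≡⟨ cong (2 *_) (cubeSum-∷ (λ g → φ ⟨ true ∷ y , g ⟩)) ⟩
    2 * (cubeSum (λ g → φ ⟨ y , g ⟩) + cubeSum (λ g → φ (not ⟨ y , g ⟩)))
      ≡⟨ cong (2 *_) (cubeSum-∙ _ _) ⟨
    2 * cubeSum (λ g → φ ⟨ y , g ⟩ + φ (not ⟨ y , g ⟩))
      ≡⟨ cong (2 *_) (cubeSum-cong (both ∘ ⟨ y ,_⟩)) ⟩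
    2 * cubeSum {m} (λ _ → c)                ≡⟨ cong (2 *_) (cubeSum-const m c) ⟩
    2 * (size m * c)                         ≡⟨ double (size m) c ⟩
    (size m + size m) * c                    ∎
    where
    open ≡-Reasoning
    c = φ false + φ true
    both : ∀ b → φ b + φ (not b) ≡ c
    both false = refl
    both true  = ℕ.+-comm (φ true) (φ false)
    double : ∀ s c → 2 * (s * c) ≡ (s + s) * c
    double = ℕ-Solver.solve-∀

  -- Bisection: if one half of the cube exceeds its share of the sum, the other half stays below its
  -- own.
  ∃-≤-average : ∀ {m} (φ : Cube m → ℕ) C → cubeSum φ ≤ size m * C → ∃ λ g → φ g ≤ C
  ∃-≤-average {zero} φ C p = [] , subst₂ _≤_ (cubeSum-[] φ) (ℕ.*-identityˡ C) p
  ∃-≤-average {suc m} φ C p with cubeSum (φ ∘ (false ∷_)) ℕ.≤? size m * C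
  ... | yes q = let g , r = ∃-≤-average (φ ∘ (false ∷_)) C q in false ∷ g , r
  ... | no ¬q = let g , r = ∃-≤-average (φ ∘ (true ∷_)) C q in true ∷ g , r
    where
    q : cubeSum (φ ∘ (true ∷_)) ≤ size m * C
    q = ℕ.+-cancelˡ-≤ (size m * C) _ _ (ℕ.≤-trans (ℕ.+-monoˡ-≤ _ (ℕ.<⇒≤ (ℕ.≰⇒> ¬q)))
      (subst₂ _≤_ (cubeSum-∷ φ) (ℕ.*-distribʳ-+ C (size m) (size m)) p))

  -- The generators are chosen one at a time by the method of conditional
  -- expectations, which at most doubles this exponential moment at each step.
  potential : ∀ {m d} → (Fin d → Cube m) → ℕ
  potential gs = cubeSum λ y → if does (𝟎 ≟ᵛ y) then 0 else 3 ^ zeros gs y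

  -- A uniformly random generator is orthogonal to a given `y ≢ 𝟎` with probability 1/2, so the new
  -- factor, 3 or 1, is 2 on average.
  potential-average : ∀ {m d} (gs : Fin d → Cube m) →
    cubeSum (λ g → potential (g Vector.∷ gs)) ≡ size m * (2 * potential gs)
  potential-average {m} gs = begin
    cubeSum (λ g → potential (g Vector.∷ gs))  ≡⟨ cubeSum-comm _ ⟩
    cubeSum (λ y → cubeSum (λ g → if does (𝟎 ≟ᵛ y) then 0 else 3 ^ zeros (g Vector.∷ gs) y))
      ≡⟨ cubeSum-cong term ⟩
    cubeSum (λ y → (size m * 2) * (if does (𝟎 ≟ᵛ y) then 0 else 3 ^ zeros gs y))
      ≡⟨ *-distribˡ-cubeSum (size m * 2) _ ⟨
    (size m * 2) * potential gs                ≡⟨ ℕ.*-assoc (size m) 2 (potential gs) ⟩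
    size m * (2 * potential gs)                ∎
    where
    open ≡-Reasoning
    term : ∀ y → cubeSum (λ g → if does (𝟎 ≟ᵛ y) then 0 else 3 ^ zeros (g Vector.∷ gs) y) ≡
                 (size m * 2) * (if does (𝟎 ≟ᵛ y) then 0 else 3 ^ zeros gs y)
    term y with 𝟎 ≟ᵛ y
    ... | yes _ = trans (cubeSum-const m 0) (trans (ℕ.*-zeroʳ (size m)) (sym (ℕ.*-zeroʳ (size m * 2))))
    ... | no 𝟎≢y = begin
      cubeSum (λ g → 3 ^ ((if ⟨ y , g ⟩ then 0 else 1) + zeros gs y))
        ≡⟨ cubeSum-cong (λ g → ℕ.^-distribˡ-+-* 3 (if ⟨ y , g ⟩ then 0 else 1) (zeros gs y)) ⟩
      cubeSum (λ g → 3 ^ (if ⟨ y , g ⟩ then 0 else 1) * 3 ^ zeros gs y)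
        ≡⟨ *-distribʳ-cubeSum (3 ^ zeros gs y) _ ⟨
      cubeSum (λ g → 3 ^ (if ⟨ y , g ⟩ then 0 else 1)) * 3 ^ zeros gs y
        ≡⟨ cong (_* 3 ^ zeros gs y) (ℕ.*-cancelˡ-≡ (cubeSum _) (size m * 2) 2
             (trans (cubeSum-⟨⟩ (λ b → 3 ^ (if b then 0 else 1)) y (𝟎≢y ∘ sym)) (four (size m)))) ⟩
      (size m * 2) * 3 ^ zeros gs y ∎
      where
      four : ∀ s → s * 4 ≡ 2 * (s * 2)
      four = ℕ-Solver.solve-∀

  greedy : ∀ m d → ∃ λ (gs : Fin d → Cube m) → potential gs ≤ 2 ^ d * size m
  greedy m zero = (λ ()) , ℕ.≤-trans (cubeSum-mono-≤ {m} ≤1)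
    (ℕ.≤-reflexive (trans (cubeSum-const m 1) (ℕ.*-comm (size m) 1)))
    where
    ≤1 : ∀ y → (if does (𝟎 ≟ᵛ y) then 0 else 1) ≤ 1
    ≤1 y with 𝟎 ≟ᵛ y
    ... | yes _ = ℕ.z≤n
    ... | no  _ = ℕ.≤-refl
  greedy m (suc d) =
    let gs , p = greedy m d
        g , q  = ∃-≤-average (λ g → potential (g Vector.∷ gs)) (2 * potential gs)
                   (ℕ.≤-reflexive (potential-average gs))
    in g Vector.∷ gs , ℕ.≤-trans q (ℕ.≤-trans (ℕ.*-monoʳ-≤ 2 p)
         (ℕ.≤-reflexive (sym (ℕ.*-assoc 2 (2 ^ d) (size m)))))

  term≤cubeSum : ∀ {m} (f : Cube m → ℕ) x → f x ≤ cubeSum f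
  term≤cubeSum f x = subst (_≤ cubeSum f) (cubeSum-select x f) (cubeSum-mono-≤ selected)
    where
    selected : ∀ y → (if does (x ≟ᵛ y) then f y else 0) ≤ f y
    selected y with does (x ≟ᵛ y)
    ... | true  = ℕ.≤-refl
    ... | false = ℕ.z≤n

  -- Rate 1/5 and relative distance 1/5 are possible since 2 ^ 6 < 3 ^ 4.
  good-code : ∀ m .{{_ : ℕ.NonZero m}} → ∃ λ (gs : Fin (5 * m) → Cube m) →
              ∀ y → y ≢ 𝟎 → m ≤ weight gs y
  good-code m with greedy m (5 * m)
  ... | gs , p = gs , heavy
    where
    open ℕ.≤-Reasoning
    heavy : ∀ y → y ≢ 𝟎 → m ≤ weight gs y
    heavy y y≢𝟎 = ℕ.+-cancelʳ-≤ (4 * m) m _ (begin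
      5 * m                        ≡⟨ weight+zeros (5 * m) gs y ⟨
      weight gs y + zeros gs y     ≤⟨ ℕ.+-monoʳ-≤ (weight gs y) few ⟩
      weight gs y + 4 * m          ∎)
      where
      3^zeros : (if does (𝟎 ≟ᵛ y) then 0 else 3 ^ zeros gs y) ≡ 3 ^ zeros gs y
      3^zeros with 𝟎 ≟ᵛ y
      ... | yes 𝟎≡y = contradiction (sym 𝟎≡y) y≢𝟎
      ... | no _    = refl
      small : 3 ^ zeros gs y < 3 ^ (4 * m)
      small = begin-strict
        3 ^ zeros gs y        ≡⟨ 3^zeros ⟨
        _                     ≤⟨ term≤cubeSum _ y ⟩
        potential gs          ≤⟨ p ⟩
        2 ^ (5 * m) * size m  ≡⟨ cong (2 ^ (5 * m) *_) (size≡2^ m) ⟩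
        2 ^ (5 * m) * 2 ^ m   ≡⟨ ℕ.^-distribˡ-+-* 2 (5 * m) m ⟨
        2 ^ (5 * m + m)       ≡⟨ cong (2 ^_) (ℕ.+-comm (5 * m) m) ⟩
        2 ^ (6 * m)           ≡⟨ ℕ.^-*-assoc 2 6 m ⟨
        64 ^ m                <⟨ ℕ.^-monoˡ-< m (ℕ.<ᵇ⇒< 64 81 _) ⟩
        81 ^ m                ≡⟨ ℕ.^-*-assoc 3 4 m ⟩
        3 ^ (4 * m)           ∎
      few : zeros gs y ≤ 4 * m
      few with zeros gs y ℕ.≤? 4 * m
      ... | yes q = q
      ... | no ¬q = contradiction (ℕ.^-monoʳ-≤ 3 (ℕ.<⇒≤ (ℕ.≰⇒> ¬q))) (ℕ.<⇒≱ small)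

-- The Walsh–Hadamard transform

module Hadamard where
  open import Data.Integer.Base using (_+_; _*_; _-_; -_; _≤_; +_)
  open ℤ-Sum

  sign : Bool → ℤ
  sign false = 1ℤ
  sign true  = -1ℤ

  -- This is the unnormalised sum of `sign ⟨ y , x ⟩ * f x` over all `x`, in the recursive form of
  -- the fast transform, which lets the facts below be proved one coordinate at a time.
  transform : ∀ {m} → (Cube m → ℤ) → Cube m → ℤ
  transform f []      = f []
  transform f (b ∷ y) = transform (f ∘ (false ∷_)) y + sign b * transform (f ∘ (true ∷_)) y

  transform-minus : ∀ {m} (f g : Cube m → ℤ) y →
                    transform (λ x → f x - g x) y ≡ transform f y - transform g y
  transform-minus f g []      = refl
  transform-minus f g (b ∷ y) = trans
    (cong₂ (λ p q → p + sign b * q) (transform-minus (f ∘ (false ∷_)) (g ∘ (false ∷_)) y)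
                                    (transform-minus (f ∘ (true ∷_)) (g ∘ (true ∷_)) y))
    (regroup (sign b) (transform (f ∘ (false ∷_)) y) (transform (g ∘ (false ∷_)) y)
                      (transform (f ∘ (true ∷_)) y) (transform (g ∘ (true ∷_)) y))
    where
    regroup : ∀ s p q r t → (p - q) + s * (r - t) ≡ (p + s * r) - (q + s * t)
    regroup = ℤ-Solver.solve-∀

  sign-not : ∀ b → sign (not b) ≡ - sign b
  sign-not false = refl
  sign-not true  = refl

  -- Characters are multiplicative. Coordinatewise, a `true` head of `g` swaps the two halves of
  -- `f`, which costs the sign of the head of `y`.
  transform-translate : ∀ {m} (g : Cube m) (f : Cube m → ℤ) y →
    transform (λ x → f (x ⊕ g)) y ≡ sign ⟨ y , g ⟩ * transform f y
  transform-translate []          f []      = sym (ℤ.*-identityˡ (f []))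
  transform-translate (false ∷ g) f (b ∷ y) = trans
    (cong₂ (λ p q → p + sign b * q) (transform-translate g (f ∘ (false ∷_)) y)
                                    (transform-translate g (f ∘ (true ∷_)) y))
    (trans (factor (sign ⟨ y , g ⟩) (sign b) _ _)
      (cong (λ c → sign (c xor ⟨ y , g ⟩) * transform f (b ∷ y)) (sym (Bool.∧-zeroʳ b))))
    where
    factor : ∀ c s p q → c * p + s * (c * q) ≡ c * (p + s * q)
    factor = ℤ-Solver.solve-∀
  transform-translate (true ∷ g) f (false ∷ y) = trans
    (cong₂ (λ p q → p + 1ℤ * q) (transform-translate g (f ∘ (true ∷_)) y)
                                (transform-translate g (f ∘ (false ∷_)) y))
    (swap (sign ⟨ y , g ⟩) _ _)
    where
    swap : ∀ c p q → c * p + 1ℤ * (c * q) ≡ c * (q + 1ℤ * p)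
    swap = ℤ-Solver.solve-∀
  transform-translate (true ∷ g) f (true ∷ y) = trans
    (cong₂ (λ p q → p + -1ℤ * q) (transform-translate g (f ∘ (true ∷_)) y)
                                 (transform-translate g (f ∘ (false ∷_)) y))
    (trans (swap (sign ⟨ y , g ⟩) _ _)
      (cong (_* transform f (true ∷ y)) (sym (sign-not ⟨ y , g ⟩))))
    where
    swap : ∀ c p q → c * p + -1ℤ * (c * q) ≡ (- c) * (q + -1ℤ * p)
    swap = ℤ-Solver.solve-∀

  transform-𝟎 : ∀ {m} (f : Cube m → ℤ) → transform f 𝟎 ≡ cubeSum f
  transform-𝟎 {zero}  f = sym (cubeSum-[] f)
  transform-𝟎 {suc m} f = trans
    (cong₂ _+_ (transform-𝟎 (f ∘ (false ∷_)))
      (trans (ℤ.*-identityˡ _) (transform-𝟎 (f ∘ (true ∷_)))))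
    (sym (cubeSum-∷ f))

  square : ℤ → ℤ
  square a = a * a

  -- Each coordinate contributes one parallelogram identity, and with it one factor 2 of `size m`.
  parseval : ∀ {m} (f : Cube m → ℤ) →
             cubeSum (λ y → square (transform f y)) ≡ + size m * cubeSum (λ x → square (f x))
  parseval {zero} f = trans (cubeSum-[] _) (trans (sym (cubeSum-[] (λ x → square (f x)))) (sym (ℤ.*-identityˡ _)))
  parseval {suc m} f = begin
    cubeSum (λ y → square (transform f y))
      ≡⟨ cubeSum-∷ _ ⟩
    cubeSum (λ y → square (A y + 1ℤ * B y)) + cubeSum (λ y → square (A y + -1ℤ * B y))
      ≡⟨ cubeSum-∙ _ _ ⟨
    cubeSum (λ y → square (A y + 1ℤ * B y) + square (A y + -1ℤ * B y))
      ≡⟨ cubeSum-cong (λ y → parallelogram (A y) (B y)) ⟩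
    cubeSum (λ y → (+ 2) * square (A y) + (+ 2) * square (B y))
      ≡⟨ cubeSum-∙ _ _ ⟩
    cubeSum (λ y → (+ 2) * square (A y)) + cubeSum (λ y → (+ 2) * square (B y))
      ≡⟨ cong₂ _+_ (*-distribˡ-cubeSum (+ 2) _) (*-distribˡ-cubeSum (+ 2) _) ⟨
    (+ 2) * cubeSum (λ y → square (A y)) + (+ 2) * cubeSum (λ y → square (B y))
      ≡⟨ cong₂ (λ p q → (+ 2) * p + (+ 2) * q) (parseval (f ∘ (false ∷_))) (parseval (f ∘ (true ∷_))) ⟩
    (+ 2) * (+ size m * a) + (+ 2) * (+ size m * b)
      ≡⟨ regroup (+ size m) a b ⟩
    (+ size m + + size m) * (a + b)
      ≡⟨ cong₂ _*_ (ℤ.pos-+ (size m) (size m)) (cubeSum-∷ (λ x → square (f x))) ⟨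
    + size (suc m) * cubeSum (λ x → square (f x)) ∎
    where
    open ≡-Reasoning
    A = transform (f ∘ (false ∷_))
    B = transform (f ∘ (true ∷_))
    a = cubeSum (λ x → square (f (false ∷ x)))
    b = cubeSum (λ x → square (f (true ∷ x)))
    parallelogram : ∀ p q → (p + 1ℤ * q) * (p + 1ℤ * q) + (p + -1ℤ * q) * (p + -1ℤ * q) ≡
                    (+ 2) * (p * p) + (+ 2) * (q * q)
    parallelogram = ℤ-Solver.solve-∀
    regroup : ∀ s p q → (+ 2) * (s * p) + (+ 2) * (s * q) ≡ (s + s) * (p + q)
    regroup = ℤ-Solver.solve-∀

  square-nonneg : ∀ a → 0ℤ ≤ square a
  square-nonneg (+ a)          = subst (0ℤ ≤_) (ℤ.pos-* a a) (ℤ.+≤+ ℕ.z≤n)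
  square-nonneg (ℤ.-[1+ a ])   = ℤ.+≤+ ℕ.z≤n

module Poincaré {m d : ℕ} (gs : Fin d → Cube m) (M : ℕ)
                (heavy : ∀ y → y ≢ 𝟎 → M ℕ.≤ Code.weight gs y) where
  open import Data.Integer.Base using (_+_; _*_; _-_; -_; _≤_; +_)
  open Hadamard
  open ℤ-Sum

  energy : (Cube m → ℤ) → ℤ
  energy f = sum λ j → cubeSum λ x → square (f x - f (x ⊕ gs j))

  -- The difference along `g` has transform `(1 - sign ⟨ y , g ⟩)` times that of `f`. The square of
  -- this factor is 4 or 0, so summing over the generators counts the weight of `y`.
  energy-transform : ∀ f → + size m * energy f ≡
    cubeSum (λ y → (+ 4) * + Code.weight gs y * square (transform f y))
  energy-transform f = begin
    + size m * energy f
      ≡⟨ *-distribˡ-sum (+ size m) (λ j → cubeSum (λ x → square (f x - f (x ⊕ gs j)))) ⟩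
    sum (λ j → + size m * cubeSum (λ x → square (f x - f (x ⊕ gs j))))
      ≡⟨ sum-cong-≗ {d} (λ j → parseval (λ x → f x - f (x ⊕ gs j))) ⟨
    sum (λ j → cubeSum (λ y → square (transform (λ x → f x - f (x ⊕ gs j)) y)))
      ≡⟨ cubeSum-sum-comm {m} {d} _ ⟨
    cubeSum (λ y → sum (λ j → square (transform (λ x → f x - f (x ⊕ gs j)) y)))
      ≡⟨ cubeSum-cong per-character ⟩
    cubeSum (λ y → (+ 4) * + Code.weight gs y * square (transform f y)) ∎
    where
    open ≡-Reasoning
    factor : ∀ s p → (p - s * p) * (p - s * p) ≡ ((1ℤ - s) * (1ℤ - s)) * (p * p)
    factor = ℤ-Solver.solve-∀
    four : ∀ b → (1ℤ - sign b) * (1ℤ - sign b) ≡ (+ 4) * + (if b then 1 else 0)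
    four true  = refl
    four false = refl
    per-character : ∀ y → sum (λ j → square (transform (λ x → f x - f (x ⊕ gs j)) y)) ≡
                    (+ 4) * + Code.weight gs y * square (transform f y)
    per-character y = begin
      sum (λ j → square (transform (λ x → f x - f (x ⊕ gs j)) y))
        ≡⟨ sum-cong-≗ {d} (λ j → cong square (trans (transform-minus f (λ x → f (x ⊕ gs j)) y)
             (cong (λ a → f̂ - a) (transform-translate (gs j) f y)))) ⟩
      sum (λ j → square (f̂ - sign ⟨ y , gs j ⟩ * f̂))
        ≡⟨ sum-cong-≗ {d} (λ j → trans (factor (sign ⟨ y , gs j ⟩) f̂)
             (cong (_* square f̂) (four ⟨ y , gs j ⟩))) ⟩
      sum (λ j → (+ 4) * + bit j * square f̂)
        ≡⟨ *-distribʳ-sum {d} (square f̂) (λ j → (+ 4) * + bit j) ⟨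
      sum (λ j → (+ 4) * + bit j) * square f̂
        ≡⟨ cong (_* square f̂) (*-distribˡ-sum {d} (+ 4) (λ j → + bit j)) ⟨
      (+ 4) * sum (λ j → + bit j) * square f̂
        ≡⟨ cong (λ a → (+ 4) * a * square f̂) (pos-sum bit) ⟨
      (+ 4) * + Code.weight gs y * square f̂ ∎
      where
      f̂ = transform f y
      bit : Fin d → ℕ
      bit j = if ⟨ y , gs j ⟩ then 1 else 0

  -- Every nonzero character has weight at least `M`. The zero character contributes nothing to the
  -- energy, so its term, the squared sum of `f`, is added on the right.
  poincaré : ∀ f → (+ 4) * + M * (+ size m * cubeSum (λ x → square (f x))) ≤
                   + size m * energy f + (+ 4) * + M * square (cubeSum f)
  poincaré f = begin
    (+ 4) * + M * (+ size m * cubeSum (λ x → square (f x)))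
      ≡⟨ cong ((+ 4) * + M *_) (parseval f) ⟨
    (+ 4) * + M * cubeSum (λ y → square (transform f y))
      ≡⟨ *-distribˡ-cubeSum ((+ 4) * + M) _ ⟩
    cubeSum (λ y → (+ 4) * + M * square (transform f y))
      ≤⟨ cubeSum-mono-≤ term ⟩
    cubeSum (λ y → (+ 4) * + Code.weight gs y * square (transform f y) + (if does (𝟎 ≟ᵛ y) then R y else 0ℤ))
      ≡⟨ cubeSum-∙ _ _ ⟩
    cubeSum (λ y → (+ 4) * + Code.weight gs y * square (transform f y)) + cubeSum (λ y → if does (𝟎 ≟ᵛ y) then R y else 0ℤ)
      ≡⟨ cong₂ _+_ (sym (energy-transform f))
           (trans (cubeSum-select 𝟎 R) (cong (λ a → (+ 4) * + M * square a) (transform-𝟎 f))) ⟩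
    + size m * energy f + (+ 4) * + M * square (cubeSum f) ∎
    where
    open ℤ.≤-Reasoning
    R : Cube m → ℤ
    R y = (+ 4) * + M * square (transform f y)
    4*-mono : ∀ {a b} c → 0ℤ ≤ c → a ℕ.≤ b → (+ 4) * + a * c ≤ (+ 4) * + b * c
    4*-mono c 0≤c a≤b = ℤ.*-monoʳ-≤-nonNeg c {{ℤ.nonNegative 0≤c}} (ℤ.*-monoˡ-≤-nonNeg (+ 4) (ℤ.+≤+ a≤b))
    term : ∀ y → R y ≤ (+ 4) * + Code.weight gs y * square (transform f y) + (if does (𝟎 ≟ᵛ y) then R y else 0ℤ)
    term y with 𝟎 ≟ᵛ y
    ... | yes _   = subst (_≤ (+ 4) * + Code.weight gs y * S + R y) (ℤ.+-identityˡ (R y))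
      (ℤ.+-monoˡ-≤ (R y) (4*-mono {0} {Code.weight gs y} S (square-nonneg (transform f y)) ℕ.z≤n))
      where S = square (transform f y)
    ... | no 𝟎≢y = subst (R y ≤_) (sym (ℤ.+-identityʳ _))
      (4*-mono (square (transform f y)) (square-nonneg (transform f y)) (heavy y (𝟎≢y ∘ sym)))

-- Cuts and equal pairs of a partition of the core

same diff : ∀ {k} → Fin k → Fin k → ℕ
same a b = if does (a Fin.≟ b) then 1 else 0
diff a b = if does (a Fin.≟ b) then 0 else 1

module Partition {m d k : ℕ} (gs : Fin d → Cube m) (f : Cube m → Fin k) where
  open ℕ-Sum

  -- A core edge is counted from both of its ends, in agreement with the sums over ordered pairs of
  -- vertices used later.
  cut : ℕ
  cut = sum λ j → cubeSum λ x → diff (f x) (f (x ⊕ gs j))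

  samePairs : ℕ
  samePairs = cubeSum λ x → cubeSum λ y → same (f x) (f y)

module PartitionPoincaré {m d k : ℕ} (gs : Fin d → Cube m) (M : ℕ)
       (heavy : ∀ y → y ≢ 𝟎 → M ℕ.≤ Code.weight gs y) (f : Cube m → Fin k) where
  open import Data.Integer.Base using (_+_; _*_; _-_; -_; _≤_; +_)
  open Hadamard using (square)
  open Poincaré gs M heavy
  open Partition gs f
  open ℤ-Sum

  private
    indicator : Fin k → Cube m → ℤ
    indicator t x = + same (f x) t

    N : ℤ
    N = + size m

  square-same : ∀ (a t : Fin k) → square (+ same a t) ≡ (if does (a Fin.≟ t) then 1ℤ else 0ℤ)
  square-same a t with does (a Fin.≟ t)
  ... | true  = refl
  ... | false = refl

  ∑-square-same : ∀ (a : Fin k) → sum (λ t → square (+ same a t)) ≡ 1ℤ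
  ∑-square-same a = trans (sum-cong-≗ (square-same a)) (sum-select a (λ _ → 1ℤ))

  ∑-same-same : ∀ (a b : Fin k) → sum (λ t → + same a t * + same b t) ≡ + same a b
  ∑-same-same a b = trans (sum-cong-≗ select) (sum-select b (λ t → + same a t))
    where
    select : ∀ t → + same a t * + same b t ≡ (if does (b Fin.≟ t) then + same a t else 0ℤ)
    select t with does (b Fin.≟ t)
    ... | true  = ℤ.*-identityʳ (+ same a t)
    ... | false = ℤ.*-zeroʳ (+ same a t)

  -- Passing from one class to another changes exactly two of the indicators.
  ∑-square-diff : ∀ (a b : Fin k) →
    sum (λ t → square (+ same a t - + same b t)) ≡ (+ 2) * + diff a b
  ∑-square-diff a b with a Fin.≟ b
  ... | yes refl = trans (sum-cong-≗ (λ t → cong square (ℤ.+-inverseʳ (+ same a t))))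
                         (sum-replicate-zero k)
  ... | no a≢b   = begin
    sum (λ t → square (+ same a t - + same b t))
      ≡⟨ sum-cong-≗ disjoint ⟩
    sum (λ t → square (+ same a t) + square (+ same b t))
      ≡⟨ ∑-distrib-+ (λ t → square (+ same a t)) (λ t → square (+ same b t)) ⟩
    sum (λ t → square (+ same a t)) + sum (λ t → square (+ same b t))
      ≡⟨ cong₂ _+_ (∑-square-same a) (∑-square-same b) ⟩
    (+ 2) * 1ℤ ∎
    where
    open ≡-Reasoning
    disjoint : ∀ t → square (+ same a t - + same b t) ≡ square (+ same a t) + square (+ same b t)
    disjoint t with a Fin.≟ t | b Fin.≟ t
    ... | yes p | yes q = contradiction (trans p (sym q)) a≢b
    ... | yes _ | no _  = refl
    ... | no _  | yes _ = refl
    ... | no _  | no _  = refl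

  ∑-norm : sum (λ t → cubeSum (λ x → square (indicator t x))) ≡ N
  ∑-norm = begin
    sum (λ t → cubeSum (λ x → square (indicator t x)))  ≡⟨ cubeSum-sum-comm {m} {k} _ ⟨
    cubeSum (λ x → sum (λ t → square (indicator t x)))  ≡⟨ cubeSum-cong (∑-square-same ∘ f) ⟩
    cubeSum {m} (λ _ → 1ℤ)                              ≡⟨ pos-cubeSum {m} (λ _ → 1) ⟨
    + ℕ-Sum.cubeSum {m} (λ _ → 1)                       ≡⟨ cong +_ (trans (ℕ-Sum.cubeSum-const m 1) (ℕ.*-identityʳ (size m))) ⟩
    N                                                   ∎
    where open ≡-Reasoning

  ∑-energy : sum (λ t → energy (indicator t)) ≡ (+ 2) * + cut
  ∑-energy = begin
    sum (λ t → sum (λ j → cubeSum (λ x → square (indicator t x - indicator t (x ⊕ gs j)))))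
      ≡⟨ ∑-comm {k} {d} (λ t j → cubeSum (λ x → square (indicator t x - indicator t (x ⊕ gs j)))) ⟩
    sum (λ j → sum (λ t → cubeSum (λ x → square (indicator t x - indicator t (x ⊕ gs j)))))
      ≡⟨ sum-cong-≗ {d} per-generator ⟩
    sum (λ j → (+ 2) * + cut-by j)
      ≡⟨ *-distribˡ-sum {d} (+ 2) (λ j → + cut-by j) ⟨
    (+ 2) * sum (λ j → + cut-by j)
      ≡⟨ cong ((+ 2) *_) (pos-sum cut-by) ⟨
    (+ 2) * + cut ∎
    where
    open ≡-Reasoning
    cut-by : Fin d → ℕ
    cut-by j = ℕ-Sum.cubeSum (λ x → diff (f x) (f (x ⊕ gs j)))
    per-generator : ∀ j → sum (λ t → cubeSum (λ x → square (indicator t x - indicator t (x ⊕ gs j)))) ≡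
                    (+ 2) * + cut-by j
    per-generator j = begin
      sum (λ t → cubeSum (λ x → square (indicator t x - indicator t (x ⊕ gs j))))
        ≡⟨ cubeSum-sum-comm {m} {k} _ ⟨
      cubeSum (λ x → sum (λ t → square (indicator t x - indicator t (x ⊕ gs j))))
        ≡⟨ cubeSum-cong (λ x → ∑-square-diff (f x) (f (x ⊕ gs j))) ⟩
      cubeSum (λ x → (+ 2) * + diff (f x) (f (x ⊕ gs j)))
        ≡⟨ *-distribˡ-cubeSum (+ 2) _ ⟨
      (+ 2) * cubeSum (λ x → + diff (f x) (f (x ⊕ gs j)))
        ≡⟨ cong ((+ 2) *_) (pos-cubeSum _) ⟨
      (+ 2) * + cut-by j ∎

  -- The square of the size of a class counts the ordered pairs inside it.
  ∑-mean : sum (λ t → square (cubeSum (indicator t))) ≡ + samePairs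
  ∑-mean = begin
    sum (λ t → square (cubeSum (indicator t)))
      ≡⟨ sum-cong-≗ {k} (λ t → trans (*-distribʳ-cubeSum (cubeSum (indicator t)) (indicator t))
           (cubeSum-cong (λ x → *-distribˡ-cubeSum (indicator t x) (indicator t)))) ⟩
    sum (λ t → cubeSum (λ x → cubeSum (λ y → indicator t x * indicator t y)))
      ≡⟨ cubeSum-sum-comm {m} {k} _ ⟨
    cubeSum (λ x → sum (λ t → cubeSum (λ y → indicator t x * indicator t y)))
      ≡⟨ cubeSum-cong (λ x → sym (cubeSum-sum-comm {m} {k} _)) ⟩
    cubeSum (λ x → cubeSum (λ y → sum (λ t → indicator t x * indicator t y)))
      ≡⟨ cubeSum-cong (λ x → cubeSum-cong (λ y → ∑-same-same (f x) (f y))) ⟩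
    cubeSum (λ x → cubeSum (λ y → + same (f x) (f y)))
      ≡⟨ cubeSum-cong (λ x → sym (pos-cubeSum (λ y → same (f x) (f y)))) ⟩
    cubeSum (λ x → + ℕ-Sum.cubeSum (λ y → same (f x) (f y)))
      ≡⟨ pos-cubeSum _ ⟨
    + samePairs ∎
    where open ≡-Reasoning

  -- The Poincaré inequality is added up over the indicators of all classes, which handles a
  -- partition into any number of classes at once instead of a single cut.
  summed : (+ 4) * + M * (N * N) ≤ N * ((+ 2) * + cut) + (+ 4) * + M * + samePairs
  summed = begin
    c * (N * N)
      ≡⟨ cong (λ a → c * (N * a)) ∑-norm ⟨
    c * (N * sum (λ t → norm t))
      ≡⟨ trans (cong (c *_) (*-distribˡ-sum N norm)) (*-distribˡ-sum c (λ t → N * norm t)) ⟩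
    sum (λ t → c * (N * norm t))
      ≤⟨ sum-mono-≤ {k} (λ t → poincaré (indicator t)) ⟩
    sum (λ t → N * energy (indicator t) + c * square (cubeSum (indicator t)))
      ≡⟨ ∑-distrib-+ {k} (λ t → N * energy (indicator t)) (λ t → c * square (cubeSum (indicator t))) ⟩
    sum (λ t → N * energy (indicator t)) + sum (λ t → c * square (cubeSum (indicator t)))
      ≡⟨ cong₂ _+_ (*-distribˡ-sum N (λ t → energy (indicator t)))
                   (*-distribˡ-sum c (λ t → square (cubeSum (indicator t)))) ⟨
    N * sum (λ t → energy (indicator t)) + c * sum (λ t → square (cubeSum (indicator t)))
      ≡⟨ cong₂ (λ a b → N * a + c * b) ∑-energy ∑-mean ⟩
    N * ((+ 2) * + cut) + c * + samePairs ∎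
    where
    open ℤ.≤-Reasoning
    c = (+ 4) * + M
    norm : Fin k → ℤ
    norm t = cubeSum (λ x → square (indicator t x))

  -- Equivalently, `cut` is at least `2 * M * size m` times the fraction of ordered pairs that are
  -- separated: this is the expansion of the core in the form needed for a 0-extension.
  cut-lower : 2 ℕ.* M ℕ.* (size m ℕ.* size m) ℕ.≤ size m ℕ.* cut ℕ.+ 2 ℕ.* M ℕ.* samePairs
  cut-lower = ℕ.*-cancelˡ-≤ 2 (subst₂ ℕ._≤_ (left M (size m)) (right M (size m) cut samePairs)
    (ℤ.drop‿+≤+ (subst₂ _≤_ lhs rhs summed)))
    where
    left : ∀ M n → 4 ℕ.* M ℕ.* (n ℕ.* n) ≡ 2 ℕ.* (2 ℕ.* M ℕ.* (n ℕ.* n))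
    left = ℕ-Solver.solve-∀
    right : ∀ M n c q → n ℕ.* (2 ℕ.* c) ℕ.+ 4 ℕ.* M ℕ.* q ≡ 2 ℕ.* (n ℕ.* c ℕ.+ 2 ℕ.* M ℕ.* q)
    right = ℕ-Solver.solve-∀
    lhs : (+ 4) * + M * (N * N) ≡ + (4 ℕ.* M ℕ.* (size m ℕ.* size m))
    lhs = sym (trans (ℤ.pos-* (4 ℕ.* M) _) (cong₂ _*_ (ℤ.pos-* 4 M) (ℤ.pos-* (size m) (size m))))
    rhs : N * ((+ 2) * + cut) + (+ 4) * + M * + samePairs ≡
          + (size m ℕ.* (2 ℕ.* cut) ℕ.+ 4 ℕ.* M ℕ.* samePairs)
    rhs = sym (trans (ℤ.pos-+ (size m ℕ.* (2 ℕ.* cut)) _) (cong₂ _+_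
      (trans (ℤ.pos-* (size m) _) (cong (N *_) (ℤ.pos-* 2 cut)))
      (trans (ℤ.pos-* (4 ℕ.* M) samePairs) (cong (_* + samePairs) (ℤ.pos-* 4 M)))))

-- The Cayley metric of the core

-- The least number of generators, each used at most once, with sum x, as long
-- as x is such a sum; far stands for an infinite distance.
distance : ∀ {m d} → ℕ → (Fin d → Cube m) → Cube m → ℕ
distance {d = zero}  far gs x = if does (𝟎 ≟ᵛ x) then 0 else far
distance {d = suc d} far gs x =
  distance far (gs ∘ suc) x ℕ.⊓ suc (distance far (gs ∘ suc) (x ⊕ gs zero))

-- The empty sum always competes, so the distance is capped at `far`. This keeps all distances
-- finite; the capped distance is still subadditive, and a cap above `r` does not change the ball of
-- radius `r`.
module Distance (far : ℕ) where
  open import Data.Nat.Base using (_+_; _*_; _^_; _≤_; _<_; _⊓_; _≤ᵇ_)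
  open ℕ-Sum

  distance-𝟎 : ∀ {m d} (gs : Fin d → Cube m) → distance far gs 𝟎 ≡ 0
  distance-𝟎 {m} {zero}  gs = cong (if_then 0 else far) (dec-true (𝟎 {m} ≟ᵛ 𝟎) refl)
  distance-𝟎 {d = suc d} gs = cong (_⊓ suc (distance far (gs ∘ suc) (𝟎 ⊕ gs zero))) (distance-𝟎 (gs ∘ suc))

  distance-generator : ∀ {m d} (gs : Fin d → Cube m) j → distance far gs (gs j) ≤ 1
  distance-generator gs zero = ℕ.≤-trans (ℕ.m⊓n≤n _ _) (ℕ.s≤s (ℕ.≤-reflexive
    (trans (cong (distance far (gs ∘ suc)) (⊕-self (gs zero))) (distance-𝟎 (gs ∘ suc)))))
  distance-generator gs (suc j) = ℕ.≤-trans (ℕ.m⊓n≤m _ _) (distance-generator (gs ∘ suc) j)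

  -- Representations of `x` and `y` combine to one of `x ⊕ y`. If both use `gs zero`, its two copies
  -- cancel, so no generator is ever used twice. In the base case, if `x ⊕ y` is nonzero then so is
  -- `x` or `y`, and one `far` pays for it.
  distance-⊕ : ∀ {m d} (gs : Fin d → Cube m) x y →
               distance far gs (x ⊕ y) ≤ distance far gs x + distance far gs y
  distance-⊕ {d = zero} gs x y with 𝟎 ≟ᵛ x | 𝟎 ≟ᵛ y | 𝟎 ≟ᵛ (x ⊕ y)
  ... | _        | _        | yes _ = ℕ.z≤n
  ... | yes refl | yes refl | no ≢𝟎 = contradiction (sym (⊕-self 𝟎)) ≢𝟎
  ... | yes refl | no _     | no _  = ℕ.≤-refl
  ... | no _     | _        | no _  = ℕ.m≤m+n far _
  distance-⊕ {m} {suc d} gs x y = pick (ℕ.⊓-sel (D x) (suc (D (x ⊕ g)))) (ℕ.⊓-sel (D y) (suc (D (y ⊕ g))))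
    where
    open ℕ.≤-Reasoning
    g = gs zero
    D : Cube m → ℕ
    D = distance far (gs ∘ suc)
    D′ : Cube m → ℕ
    D′ = distance far gs
    D-⊕ : ∀ x y → D (x ⊕ y) ≤ D x + D y
    D-⊕ = distance-⊕ (gs ∘ suc)
    swapˡ : x ⊕ y ⊕ g ≡ (x ⊕ g) ⊕ y
    swapˡ = trans (⊕-assoc x y g) (trans (cong (x ⊕_) (⊕-comm y g)) (sym (⊕-assoc x g y)))
    both : x ⊕ y ≡ (x ⊕ g) ⊕ (y ⊕ g)
    both = sym (trans (sym (⊕-assoc (x ⊕ g) y g)) (trans (cong (_⊕ g) (sym swapˡ)) (⊕-cancelʳ (x ⊕ y) g)))
    pick : D x ⊓ suc (D (x ⊕ g)) ≡ D x ⊎ D x ⊓ suc (D (x ⊕ g)) ≡ suc (D (x ⊕ g)) →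
           D y ⊓ suc (D (y ⊕ g)) ≡ D y ⊎ D y ⊓ suc (D (y ⊕ g)) ≡ suc (D (y ⊕ g)) →
           D′ (x ⊕ y) ≤ D′ x + D′ y
    pick (inj₁ p) (inj₁ q) = begin
      D′ (x ⊕ y)    ≤⟨ ℕ.m⊓n≤m _ _ ⟩
      D (x ⊕ y)     ≤⟨ D-⊕ x y ⟩
      D x + D y     ≡⟨ cong₂ _+_ p q ⟨
      D′ x + D′ y   ∎
    pick (inj₂ p) (inj₁ q) = begin
      D′ (x ⊕ y)                 ≤⟨ ℕ.m⊓n≤n _ _ ⟩
      suc (D (x ⊕ y ⊕ g))        ≡⟨ cong (suc ∘ D) swapˡ ⟩
      suc (D ((x ⊕ g) ⊕ y))      ≤⟨ ℕ.s≤s (D-⊕ (x ⊕ g) y) ⟩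
      suc (D (x ⊕ g)) + D y      ≡⟨ cong₂ _+_ p q ⟨
      D′ x + D′ y                ∎
    pick (inj₁ p) (inj₂ q) = begin
      D′ (x ⊕ y)                 ≤⟨ ℕ.m⊓n≤n _ _ ⟩
      suc (D (x ⊕ y ⊕ g))        ≡⟨ cong (suc ∘ D) (⊕-assoc x y g) ⟩
      suc (D (x ⊕ (y ⊕ g)))      ≤⟨ ℕ.s≤s (D-⊕ x (y ⊕ g)) ⟩
      suc (D x + D (y ⊕ g))      ≡⟨ ℕ.+-suc (D x) (D (y ⊕ g)) ⟨
      D x + suc (D (y ⊕ g))      ≡⟨ cong₂ _+_ p q ⟨
      D′ x + D′ y                ∎
    pick (inj₂ p) (inj₂ q) = begin
      D′ (x ⊕ y)                           ≤⟨ ℕ.m⊓n≤m _ _ ⟩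
      D (x ⊕ y)                            ≡⟨ cong D both ⟩
      D ((x ⊕ g) ⊕ (y ⊕ g))                ≤⟨ D-⊕ (x ⊕ g) (y ⊕ g) ⟩
      D (x ⊕ g) + D (y ⊕ g)                ≤⟨ ℕ.+-mono-≤ (ℕ.n≤1+n _) (ℕ.n≤1+n _) ⟩
      suc (D (x ⊕ g)) + suc (D (y ⊕ g))    ≡⟨ cong₂ _+_ p q ⟨
      D′ x + D′ y                          ∎

  within : ℕ → ℕ → ℕ
  within r a = if a ≤ᵇ r then 1 else 0

  within-⊓ : ∀ r a b → within (suc r) (a ⊓ suc b) ≤ within (suc r) a + within r b
  within-⊓ r a b with ℕ.⊓-sel a (suc b)
  ... | inj₁ p rewrite p = ℕ.m≤m+n _ _
  within-⊓ r a zero    | inj₂ p rewrite p = ℕ.m≤n+m 1 _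
  within-⊓ r a (suc b) | inj₂ p rewrite p = ℕ.m≤n+m _ _

  within-zero : ∀ a b → within 0 (a ⊓ suc b) ≤ within 0 a
  within-zero zero    b = ℕ.≤-refl
  within-zero (suc a) b = ℕ.z≤n

  ball : ∀ {m d} → ℕ → (Fin d → Cube m) → ℕ
  ball r gs = cubeSum λ x → within r (distance far gs x)

  -- Markov's inequality for the exponential moment ∑ₓ 8 ^ - distance x ≤ (1 + 1/8) ^ d.
  ball-upper : ∀ {m} d (gs : Fin d → Cube m) r → r < far → ball r gs * 8 ^ d ≤ 8 ^ r * 9 ^ d
  ball-upper {m} zero gs r r<far = ℕ.*-monoˡ-≤ 1 (begin
    ball r gs                                                ≤⟨ cubeSum-mono-≤ {m} centre ⟩
    cubeSum {m} (λ x → if does (𝟎 ≟ᵛ x) then 1 else 0)       ≡⟨ cubeSum-select {m} 𝟎 (λ _ → 1) ⟩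
    1                                                        ≤⟨ ℕ.m^n>0 8 r ⟩
    8 ^ r                                                    ∎)
    where
    open ℕ.≤-Reasoning
    centre : ∀ (x : Cube m) → within r (if does (𝟎 ≟ᵛ x) then 0 else far) ≤
                              (if does (𝟎 ≟ᵛ x) then 1 else 0)
    centre x with 𝟎 ≟ᵛ x
    ... | yes _ = ℕ.≤-refl
    ... | no _ with far ≤ᵇ r in eq
    ...   | false = ℕ.z≤n
    ...   | true  = contradiction (ℕ.≤ᵇ⇒≤ far r (subst T (sym eq) _)) (ℕ.<⇒≱ r<far)
  ball-upper {m} (suc d) gs zero 0<far = begin
    ball 0 gs * (8 * 8 ^ d)          ≤⟨ ℕ.*-monoˡ-≤ (8 * 8 ^ d) (cubeSum-mono-≤ {m} (λ x → within-zero (distance far (gs ∘ suc) x) _)) ⟩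
    ball 0 (gs ∘ suc) * (8 * 8 ^ d)  ≡⟨ regroup (ball 0 (gs ∘ suc)) (8 ^ d) ⟩
    8 * (ball 0 (gs ∘ suc) * 8 ^ d)  ≤⟨ ℕ.*-mono-≤ (ℕ.n≤1+n 8) (ball-upper d (gs ∘ suc) 0 0<far) ⟩
    9 * (1 * 9 ^ d)                  ≡⟨ ones (9 ^ d) ⟩
    1 * (9 * 9 ^ d)                  ∎
    where
    open ℕ.≤-Reasoning
    regroup : ∀ b e → b * (8 * e) ≡ 8 * (b * e)
    regroup = ℕ-Solver.solve-∀
    ones : ∀ e → 9 * (1 * e) ≡ 1 * (9 * e)
    ones = ℕ-Solver.solve-∀
  ball-upper {m} (suc d) gs (suc r) r<far = begin
    ball (suc r) gs * (8 * 8 ^ d)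
      ≤⟨ ℕ.*-monoˡ-≤ (8 * 8 ^ d) split ⟩
    (ball (suc r) gs′ + ball r gs′) * (8 * 8 ^ d)
      ≡⟨ regroup (ball (suc r) gs′) (ball r gs′) (8 ^ d) ⟩
    8 * (ball (suc r) gs′ * 8 ^ d) + 8 * (ball r gs′ * 8 ^ d)
      ≤⟨ ℕ.+-mono-≤ (ℕ.*-monoʳ-≤ 8 (ball-upper d gs′ (suc r) r<far))
                    (ℕ.*-monoʳ-≤ 8 (ball-upper d gs′ r (ℕ.<-trans (ℕ.n<1+n r) r<far))) ⟩
    8 * (8 * 8 ^ r * 9 ^ d) + 8 * (8 ^ r * 9 ^ d)
      ≡⟨ collect (8 ^ r) (9 ^ d) ⟩
    8 * 8 ^ r * (9 * 9 ^ d) ∎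
    where
    open ℕ.≤-Reasoning
    gs′ = gs ∘ suc
    regroup : ∀ a b e → (a + b) * (8 * e) ≡ 8 * (a * e) + 8 * (b * e)
    regroup = ℕ-Solver.solve-∀
    collect : ∀ a b → 8 * (8 * a * b) + 8 * (a * b) ≡ 8 * a * (9 * b)
    collect = ℕ-Solver.solve-∀
    -- A representation either avoids the first generator or uses it once; in the second case
    -- removing it translates the point and lowers the radius by one.
    split : ball (suc r) gs ≤ ball (suc r) gs′ + ball r gs′
    split = begin
      ball (suc r) gs
        ≤⟨ cubeSum-mono-≤ {m} (λ x → within-⊓ r (distance far gs′ x) (distance far gs′ (x ⊕ gs zero))) ⟩
      cubeSum (λ x → within (suc r) (distance far gs′ x) + within r (distance far gs′ (x ⊕ gs zero)))
        ≡⟨ cubeSum-∙ _ _ ⟩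
      ball (suc r) gs′ + cubeSum (λ x → within r (distance far gs′ (x ⊕ gs zero)))
        ≡⟨ cong (ball (suc r) gs′ +_) (cubeSum-translate (gs zero) (λ x → within r (distance far gs′ x))) ⟩
      ball (suc r) gs′ + ball r gs′ ∎

module Clusters {m d : ℕ} (far : ℕ) (gs : Fin d → Cube m) (f : Cube m → Fin (size m)) where
  open import Data.Nat.Base using (_+_; _*_; _^_; _≤_; _<_; _⊓_; _≤ᵇ_)
  open ℕ-Sum
  open Distance far
  open Partition gs f

  -- Terminals share their indices with the core vertices at which they hang, so `point (f x)` is
  -- the foot of the terminal to which `x` is sent.
  displacement : ℕ
  displacement = cubeSum λ x → distance far gs (x ⊕ point (f x))

  -- Points with the same image are close to each other, since both are close to it.
  samePairs-upper : ∀ r → r * samePairs ≤ r * (size m * ball r gs) + 2 * (size m * displacement)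
  samePairs-upper r = begin
    r * samePairs
      ≡⟨ trans (*-distribˡ-cubeSum r _) (cubeSum-cong (λ x → *-distribˡ-cubeSum r _)) ⟩
    cubeSum (λ x → cubeSum (λ y → r * same (f x) (f y)))
      ≤⟨ cubeSum-mono-≤ (cubeSum-mono-≤ ∘ pair) ⟩
    cubeSum (λ x → cubeSum (λ y → (r * W x y + s x) + s y))
      ≡⟨ cubeSum-cong (λ x → trans (cubeSum-∙ _ _) (cong (_+ displacement) (cubeSum-∙ _ _))) ⟩
    cubeSum (λ x → (cubeSum (λ y → r * W x y) + cubeSum {m} (λ _ → s x)) + displacement)
      ≡⟨ cubeSum-cong (λ x → cong (_+ displacement) (cong₂ _+_
           (trans (sym (*-distribˡ-cubeSum r _)) (cong (r *_) (around x)))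
           (cubeSum-const m (s x)))) ⟩
    cubeSum (λ x → (r * ball r gs + size m * s x) + displacement)
      ≡⟨ trans (cubeSum-∙ _ _) (cong₂ _+_ (cubeSum-∙ _ _) (cubeSum-const m displacement)) ⟩
    cubeSum {m} (λ _ → r * ball r gs) + cubeSum (λ x → size m * s x) + size m * displacement
      ≡⟨ cong (_+ size m * displacement) (cong₂ _+_ (cubeSum-const m _) (sym (*-distribˡ-cubeSum (size m) s))) ⟩
    size m * (r * ball r gs) + size m * displacement + size m * displacement
      ≡⟨ regroup (size m) r (ball r gs) displacement ⟩
    r * (size m * ball r gs) + 2 * (size m * displacement) ∎
    where
    open ℕ.≤-Reasoning
    D : Cube m → ℕ
    D = distance far gs
    s : Cube m → ℕ
    s x = D (x ⊕ point (f x))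
    W : Cube m → Cube m → ℕ
    W x y = within r (D (x ⊕ y))
    regroup : ∀ n r b t → n * (r * b) + n * t + n * t ≡ r * (n * b) + 2 * (n * t)
    regroup = ℕ-Solver.solve-∀
    around : ∀ x → cubeSum (W x) ≡ ball r gs
    around x = trans (cubeSum-cong (λ y → cong (within r ∘ D) (⊕-comm x y)))
      (cubeSum-translate x (λ y → within r (D y)))
    meet : ∀ x y p → D (x ⊕ y) ≤ D (x ⊕ p) + D (y ⊕ p)
    meet x y p = subst (λ z → D z ≤ D (x ⊕ p) + D (y ⊕ p)) cancel (distance-⊕ gs (x ⊕ p) (y ⊕ p))
      where
      cancel : (x ⊕ p) ⊕ (y ⊕ p) ≡ x ⊕ y
      cancel = trans (cong ((x ⊕ p) ⊕_) (⊕-comm y p)) (trans (sym (⊕-assoc (x ⊕ p) p y))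
        (cong (_⊕ y) (⊕-cancelʳ x p)))
    -- A pair within distance `r` is paid for by `W`, any other pair by the displacements of its two
    -- points.
    pair : ∀ x y → r * same (f x) (f y) ≤ (r * W x y + s x) + s y
    pair x y with f x Fin.≟ f y
    ... | no _ = ℕ.≤-trans (ℕ.≤-reflexive (ℕ.*-zeroʳ r)) ℕ.z≤n
    ... | yes fx≡fy with D (x ⊕ y) ≤ᵇ r in eq
    ...   | true  = ℕ.≤-trans (ℕ.m≤m+n (r * 1) _) (ℕ.≤-reflexive (sym (ℕ.+-assoc (r * 1) _ _)))
    ...   | false = begin
      r * 1                                          ≡⟨ ℕ.*-identityʳ r ⟩
      r                                              ≤⟨ ℕ.<⇒≤ far-apart ⟩
      D (x ⊕ y)                                      ≤⟨ meet x y (point (f x)) ⟩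
      s x + D (y ⊕ point (f x))                      ≡⟨ cong (λ t → s x + D (y ⊕ point t)) fx≡fy ⟩
      s x + s y                                      ≤⟨ ℕ.m≤n+m _ (r * 0) ⟩
      r * 0 + (s x + s y)                            ≡⟨ ℕ.+-assoc (r * 0) _ _ ⟨
      r * 0 + s x + s y                              ∎
      where
      far-apart : r < D (x ⊕ y)
      far-apart = ℕ.≰⇒> (λ q → subst T eq (ℕ.≤⇒≤ᵇ q))

-- The core and its parameters

^-distribʳ-* : ∀ a b n → (a ℕ.* b) ℕ.^ n ≡ a ℕ.^ n ℕ.* b ℕ.^ n
^-distribʳ-* a b zero    = refl
^-distribʳ-* a b (suc n) = trans (cong (a ℕ.* b ℕ.*_) (^-distribʳ-* a b n)) (regroup a b (a ℕ.^ n) (b ℕ.^ n))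
  where
  regroup : ∀ a b p q → (a ℕ.* b) ℕ.* (p ℕ.* q) ≡ (a ℕ.* p) ℕ.* (b ℕ.* q)
  regroup = ℕ-Solver.solve-∀

module Core (r : ℕ) .{{_ : ℕ.NonZero r}} where
  open import Data.Nat.Base using (_+_; _*_; _^_; _≤_; _<_)

  -- 36 is large enough for ball-half, and a square, so that √(log₂ (size m)) is
  -- an integer when r is a square.
  m far : ℕ
  m   = 36 * r
  far = suc r

  instance
    m≢0 : ℕ.NonZero m
    m≢0 = ℕ.m*n≢0 36 r

  generators : Fin (5 * m) → Cube m
  generators = proj₁ (Code.good-code m)

  open Distance far

  abstract
    -- Each unit of `r` brings 180 = 5 * 36 generators and a factor `2 ^ 36` of points; 16 = 2 * 8
    -- pays for the `8 ^ r` of `ball-upper` and for the factor 2 of `ball-half`. The next smaller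
    -- square, 25 in place of 36, would fail.
    16·9¹⁸⁰≤2³⁶·8¹⁸⁰ : 16 * 9 ^ 180 ≤ 2 ^ 36 * 8 ^ 180
    16·9¹⁸⁰≤2³⁶·8¹⁸⁰ = ℕ.≤ᵇ⇒≤ _ _ _

    2·8^r≤16^r : 2 * 8 ^ r ≤ 16 ^ r
    2·8^r≤16^r = begin
      2 * 8 ^ r      ≤⟨ ℕ.*-monoˡ-≤ (8 ^ r) (ℕ.^-monoʳ-≤ 2 {1} {r} (ℕ.>-nonZero⁻¹ r)) ⟩
      2 ^ r * 8 ^ r  ≡⟨ ^-distribʳ-* 2 8 r ⟨
      16 ^ r         ∎
      where open ℕ.≤-Reasoning

    -- At least half of all ordered pairs of core vertices are thus more than `r` apart.
    ball-half : 2 * ball r generators ≤ size m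
    ball-half = ℕ.*-cancelʳ-≤ (2 * ball r generators) (size m) (8 ^ d) {{ℕ.m^n≢0 8 d}} (begin
      2 * ball r generators * 8 ^ d    ≡⟨ ℕ.*-assoc 2 (ball r generators) (8 ^ d) ⟩
      2 * (ball r generators * 8 ^ d)  ≤⟨ ℕ.*-monoʳ-≤ 2 (ball-upper d generators r (ℕ.n<1+n r)) ⟩
      2 * (8 ^ r * 9 ^ d)              ≡⟨ ℕ.*-assoc 2 (8 ^ r) (9 ^ d) ⟨
      2 * 8 ^ r * 9 ^ d                ≤⟨ ℕ.*-monoˡ-≤ (9 ^ d) 2·8^r≤16^r ⟩
      16 ^ r * 9 ^ d                   ≡⟨ cong (16 ^ r *_) (power 9) ⟩
      16 ^ r * (9 ^ 180) ^ r           ≡⟨ ^-distribʳ-* 16 (9 ^ 180) r ⟨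
      (16 * 9 ^ 180) ^ r               ≤⟨ ℕ.^-monoˡ-≤ r 16·9¹⁸⁰≤2³⁶·8¹⁸⁰ ⟩
      (2 ^ 36 * 8 ^ 180) ^ r           ≡⟨ ^-distribʳ-* (2 ^ 36) (8 ^ 180) r ⟩
      (2 ^ 36) ^ r * (8 ^ 180) ^ r     ≡⟨ cong₂ _*_ (ℕ.^-*-assoc 2 36 r) (sym (power 8)) ⟩
      2 ^ m * 8 ^ d                    ≡⟨ cong (_* 8 ^ d) (size≡2^ m) ⟨
      size m * 8 ^ d                   ∎)
      where
      open ℕ.≤-Reasoning
      d : ℕ
      d = 5 * m
      power : ∀ a → a ^ d ≡ (a ^ 180) ^ r
      power a = trans (cong (a ^_) (sym (ℕ.*-assoc 5 36 r))) (sym (ℕ.^-*-assoc a 180 r))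

  module _ (f : Cube m → Fin (size m)) where
    open Partition generators f public
    open Clusters far generators f public

    -- The alternative between cutting and clustering is one linear inequality, without a case
    -- distinction: the bound on `samePairs` is inserted into `cut-lower`, and the pairs inside
    -- balls use up half of the left-hand side by `ball-half`. The weight 144 is 4 * 36, one factor
    -- 2 coming from `2 * m` and one from the two displacements charged per pair.
    cut+displacement : 36 * r * size m ≤ cut + 144 * displacement
    cut+displacement = ℕ.*-cancelˡ-≤ (n * r) {{ℕ.m*n≢0 n r {{size≢0}}}} (ℕ.+-cancelʳ-≤ (n * r * (m * n)) _ _ (begin
      n * r * (36 * r * n) + n * r * (m * n)
        ≡⟨ double n r ⟩
      r * (2 * m * (n * n))
        ≤⟨ ℕ.*-monoʳ-≤ r cut-lower ⟩
      r * (n * cut + 2 * m * samePairs)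
        ≡⟨ expand r n cut m samePairs ⟩
      n * r * cut + 2 * m * (r * samePairs)
        ≤⟨ ℕ.+-monoʳ-≤ (n * r * cut) (ℕ.*-monoʳ-≤ (2 * m) (samePairs-upper r)) ⟩
      n * r * cut + 2 * m * (r * (n * b) + 2 * (n * displacement))
        ≡⟨ collect n r cut b displacement ⟩
      n * r * (cut + 144 * displacement) + n * r * (m * (2 * b))
        ≤⟨ ℕ.+-monoʳ-≤ (n * r * (cut + 144 * displacement)) (ℕ.*-monoʳ-≤ (n * r) (ℕ.*-monoʳ-≤ m ball-half)) ⟩
      n * r * (cut + 144 * displacement) + n * r * (m * n) ∎))
      where
      open ℕ.≤-Reasoning
      open PartitionPoincaré generators m (proj₂ (Code.good-code m)) f using (cut-lower)
      n = size m
      b = ball r generators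
      size≢0 : ℕ.NonZero n
      size≢0 = subst ℕ.NonZero (sym (size≡2^ m)) (ℕ.m^n≢0 2 m)
      double : ∀ n r → n * r * (36 * r * n) + n * r * (36 * r * n) ≡ r * (2 * (36 * r) * (n * n))
      double = ℕ-Solver.solve-∀
      expand : ∀ r n c m q → r * (n * c + 2 * m * q) ≡ n * r * c + 2 * m * (r * q)
      expand = ℕ-Solver.solve-∀
      collect : ∀ n r c b t → n * r * c + 2 * (36 * r) * (r * (n * b) + 2 * (n * t)) ≡
                n * r * (c + 144 * t) + n * r * (36 * r * (2 * b))
      collect = ℕ-Solver.solve-∀

open import Defs

-- The reals as an ordered commutative semiring

≈-pointwise : ∀ {x y} → (∀ n → seq x n ≡ seq y n) → x ≈ y
≈-pointwise {x} {y} x≗y = mk≈ λ ε 0<ε → 0 , λ n _ → begin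
  ℚ.∣ seq x n ℚ.- seq y n ∣  ≡⟨ cong (λ a → ℚ.∣ a ℚ.- seq y n ∣) (x≗y n) ⟩
  ℚ.∣ seq y n ℚ.- seq y n ∣  ≡⟨ cong ℚ.∣_∣ (ℚ.+-inverseʳ (seq y n)) ⟩
  0ℚ                         ≤⟨ ℚ.<⇒≤ 0<ε ⟩
  ε                          ∎
  where open ℚ.≤-Reasoning

p≤∣p∣ : ∀ p → p ℚ.≤ ℚ.∣ p ∣
p≤∣p∣ p with ℚ.≤-total 0ℚ p
... | inj₁ 0≤p = ℚ.≤-reflexive (sym (ℚ.0≤p⇒∣p∣≡p 0≤p))
... | inj₂ p≤0 = ℚ.≤-trans p≤0 (ℚ.0≤∣p∣ p)

∣p-q∣≤ε⇒p≤q+ε : ∀ p q ε → ℚ.∣ p ℚ.- q ∣ ℚ.≤ ε → p ℚ.≤ q ℚ.+ ε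
∣p-q∣≤ε⇒p≤q+ε p q ε close = subst (ℚ._≤ q ℚ.+ ε) (cancel p q)
  (ℚ.+-monoʳ-≤ q (ℚ.≤-trans (p≤∣p∣ (p ℚ.- q)) close))
  where
  open ℚ-Solver.+-*-Solver
  cancel : ∀ p q → q ℚ.+ (p ℚ.- q) ≡ p
  cancel = solve 2 (λ p q → q :+ (p :+ :- q) := p) refl

∣p-q∣≡∣q-p∣ : ∀ p q → ℚ.∣ p ℚ.- q ∣ ≡ ℚ.∣ q ℚ.- p ∣
∣p-q∣≡∣q-p∣ p q = trans (sym (ℚ.∣-p∣≡∣p∣ (p ℚ.- q))) (cong ℚ.∣_∣ (negate p q))
  where
  open ℚ-Solver.+-*-Solver
  negate : ∀ p q → ℚ.- (p ℚ.- q) ≡ q ℚ.- p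
  negate = solve 2 (λ p q → :- (p :+ :- q) := q :+ :- p) refl

≈⇒≤ : ∀ {x y} → x ≈ y → x ≤ y
≈⇒≤ x≈y = mk≤ λ ε 0<ε → let N , close = ≈-close x≈y ε 0<ε in
  N , λ n N≤n → ∣p-q∣≤ε⇒p≤q+ε _ _ ε (close n N≤n)

≈-sym : ∀ {x y} → x ≈ y → y ≈ x
≈-sym {x} {y} x≈y = mk≈ λ ε 0<ε → let N , close = ≈-close x≈y ε 0<ε in
  N , λ n N≤n → subst (ℚ._≤ ε) (∣p-q∣≡∣q-p∣ (seq x n) (seq y n)) (close n N≤n)

≤-antisym : ∀ {x y} → x ≤ y → y ≤ x → x ≈ y
≤-antisym {x} {y} x≤y y≤x = mk≈ λ ε 0<ε →
  let M , p = ≤-close x≤y ε 0<ε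
      N , q = ≤-close y≤x ε 0<ε
  in M ℕ.⊔ N , λ n M⊔N≤n → ∣-∣-≤ (seq x n) (seq y n) ε
       (subst (seq x n ℚ.≤_) (ℚ.+-comm (seq y n) ε) (p n (ℕ.m⊔n≤o⇒m≤o M N M⊔N≤n)))
       (subst (seq y n ℚ.≤_) (ℚ.+-comm (seq x n) ε) (q n (ℕ.m⊔n≤o⇒n≤o M N M⊔N≤n)))

≤-pointwise : ∀ {x y} → (∀ n → seq x n ℚ.≤ seq y n) → x ≤ y
≤-pointwise {x} {y} x≤y = mk≤ λ ε 0<ε → 0 , λ n _ →
  subst (ℚ._≤ seq y n ℚ.+ ε) (ℚ.+-identityʳ (seq x n)) (ℚ.+-mono-≤ (x≤y n) (ℚ.<⇒≤ 0<ε))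

≤-trans : ∀ {x y z} → x ≤ y → y ≤ z → x ≤ z
≤-trans {x} {y} {z} x≤y y≤z = mk≤ λ ε 0<ε →
  let M , p = ≤-close x≤y (½ ℚ.* ε) (half>0 0<ε)
      N , q = ≤-close y≤z (½ ℚ.* ε) (half>0 0<ε)
  in M ℕ.⊔ N , λ n M⊔N≤n → begin
    seq x n                                ≤⟨ p n (ℕ.m⊔n≤o⇒m≤o M N M⊔N≤n) ⟩
    seq y n ℚ.+ ½ ℚ.* ε                    ≤⟨ ℚ.+-monoˡ-≤ (½ ℚ.* ε) (q n (ℕ.m⊔n≤o⇒n≤o M N M⊔N≤n)) ⟩
    seq z n ℚ.+ ½ ℚ.* ε ℚ.+ ½ ℚ.* ε        ≡⟨ ℚ.+-assoc (seq z n) _ _ ⟩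
    seq z n ℚ.+ (½ ℚ.* ε ℚ.+ ½ ℚ.* ε)      ≡⟨ cong (seq z n ℚ.+_) (half+half ε) ⟩
    seq z n ℚ.+ ε                          ∎
  where open ℚ.≤-Reasoning

≈-refl : ∀ {x} → x ≈ x
≈-refl {x} = ≈-pointwise {x} {x} λ _ → refl

≈-trans : ∀ {x y z} → x ≈ y → y ≈ z → x ≈ z
≈-trans x≈y y≈z = ≤-antisym (≤-trans (≈⇒≤ x≈y) (≈⇒≤ y≈z))
                            (≤-trans (≈⇒≤ (≈-sym y≈z)) (≈⇒≤ (≈-sym x≈y)))

+-mono-≤ : ∀ {x y u v} → x ≤ y → u ≤ v → x + u ≤ y + v
+-mono-≤ {x} {y} {u} {v} x≤y u≤v = mk≤ λ ε 0<ε →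
  let M , p = ≤-close x≤y (½ ℚ.* ε) (half>0 0<ε)
      N , q = ≤-close u≤v (½ ℚ.* ε) (half>0 0<ε)
  in M ℕ.⊔ N , λ n M⊔N≤n → begin
    seq x n ℚ.+ seq u n
      ≤⟨ ℚ.+-mono-≤ (p n (ℕ.m⊔n≤o⇒m≤o M N M⊔N≤n)) (q n (ℕ.m⊔n≤o⇒n≤o M N M⊔N≤n)) ⟩
    (seq y n ℚ.+ ½ ℚ.* ε) ℚ.+ (seq v n ℚ.+ ½ ℚ.* ε)
      ≡⟨ regroup (seq y n) (seq v n) (½ ℚ.* ε) ⟩
    (seq y n ℚ.+ seq v n) ℚ.+ (½ ℚ.* ε ℚ.+ ½ ℚ.* ε)
      ≡⟨ cong (seq y n ℚ.+ seq v n ℚ.+_) (half+half ε) ⟩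
    seq y n ℚ.+ seq v n ℚ.+ ε ∎
  where
  open ℚ.≤-Reasoning
  open ℚ-Solver.+-*-Solver
  regroup : ∀ a b e → (a ℚ.+ e) ℚ.+ (b ℚ.+ e) ≡ (a ℚ.+ b) ℚ.+ (e ℚ.+ e)
  regroup = solve 3 (λ a b e → (a :+ e) :+ (b :+ e) := (a :+ b) :+ (e :+ e)) refl

+-cancelˡ-≤ : ∀ z {x y} → z + x ≤ z + y → x ≤ y
+-cancelˡ-≤ z {x} {y} z+x≤z+y = mk≤ λ ε 0<ε → let N , p = ≤-close z+x≤z+y ε 0<ε in
  N , λ n N≤n → subst₂ ℚ._≤_ (cancel (seq z n) (seq x n))
    (trans (cong (ℚ.- seq z n ℚ.+_) (ℚ.+-assoc (seq z n) (seq y n) ε)) (cancel (seq z n) (seq y n ℚ.+ ε)))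
    (ℚ.+-monoʳ-≤ (ℚ.- seq z n) (p n N≤n))
  where
  open ℚ-Solver.+-*-Solver
  cancel : ∀ z x → ℚ.- z ℚ.+ (z ℚ.+ x) ≡ x
  cancel = solve 2 (λ z x → :- z :+ (z :+ x) := x) refl

divide : ∀ B → 0ℚ ℚ.< B → ∀ ε → 0ℚ ℚ.< ε → ∃ λ δ → 0ℚ ℚ.< δ × δ ℚ.* B ≡ ε
divide B 0<B ε 0<ε = ε ℚ.* (ℚ.1/ B)
  , subst (ℚ._< ε ℚ.* (ℚ.1/ B)) (ℚ.*-zeroˡ (ℚ.1/ B)) (ℚ.*-monoˡ-<-pos (ℚ.1/ B) {{ℚ.1/pos⇒pos B}} 0<ε)
  , trans (ℚ.*-assoc ε (ℚ.1/ B) B) (trans (cong (ε ℚ.*_) (ℚ.*-inverseˡ B)) (ℚ.*-identityʳ ε))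
  where instance
    B-pos : ℚ.Positive B
    B-pos = ℚ.positive 0<B
    B-nonZero : ℚ.NonZero B
    B-nonZero = ℚ.pos⇒nonZero B

*-congʳ : ∀ {x y} z → x ≈ y → x * z ≈ y * z
*-congʳ {x} {y} z x≈y = mk≈ λ ε 0<ε →
  let B , 0<B , M , bound = bounded z
      δ , 0<δ , δB≡ε      = divide B 0<B ε 0<ε
      N , close           = ≈-close x≈y δ 0<δ
  in M ℕ.⊔ N , λ n M⊔N≤n → begin
    ℚ.∣ seq x n ℚ.* seq z n ℚ.- seq y n ℚ.* seq z n ∣
      ≡⟨ cong ℚ.∣_∣ (factor (seq x n) (seq y n) (seq z n)) ⟩
    ℚ.∣ (seq x n ℚ.- seq y n) ℚ.* seq z n ∣
      ≡⟨ ℚ.∣p*q∣≡∣p∣*∣q∣ (seq x n ℚ.- seq y n) (seq z n) ⟩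
    ℚ.∣ seq x n ℚ.- seq y n ∣ ℚ.* ℚ.∣ seq z n ∣
      ≤⟨ nonNeg* (ℚ.0≤∣p∣ (seq z n)) (ℚ.<⇒≤ 0<δ) (close n (ℕ.m⊔n≤o⇒n≤o M N M⊔N≤n))
           (bound n (ℕ.m⊔n≤o⇒m≤o M N M⊔N≤n)) ⟩
    δ ℚ.* B
      ≡⟨ δB≡ε ⟩
    ε ∎
  where
  open ℚ.≤-Reasoning
  open ℚ-Solver.+-*-Solver
  factor : ∀ x y z → x ℚ.* z ℚ.- y ℚ.* z ≡ (x ℚ.- y) ℚ.* z
  factor = solve 3 (λ x y z → x :* z :+ :- (y :* z) := (x :+ :- y) :* z) refl

*-comm : ∀ x y → x * y ≈ y * x
*-comm x y = ≈-pointwise {x * y} {y * x} λ n → ℚ.*-comm (seq x n) (seq y n)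

ℝ-commutativeSemiring : CommutativeSemiring _ _
ℝ-commutativeSemiring = record
  { Carrier = ℝ ; _≈_ = _≈_ ; _+_ = _+_ ; _*_ = _*_ ; 0# = 0ℝ ; 1# = 1ℝ
  ; isCommutativeSemiring = isCommutativeSemiringˡ record
    { +-isCommutativeMonoid = record
      { isMonoid = record
        { isSemigroup = record
          { isMagma = record
            { isEquivalence = isEquivalence
            ; ∙-cong = λ p q → ≤-antisym (+-mono-≤ (≈⇒≤ p) (≈⇒≤ q))
                                         (+-mono-≤ (≈⇒≤ (≈-sym p)) (≈⇒≤ (≈-sym q))) }
          ; assoc = λ x y z → ≈-pointwise {x + y + z} {x + (y + z)} λ n →
              ℚ.+-assoc (seq x n) (seq y n) (seq z n) }
        ; identity = (λ x → ≈-pointwise {0ℝ + x} {x} λ n → ℚ.+-identityˡ (seq x n))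
                   , (λ x → ≈-pointwise {x + 0ℝ} {x} λ n → ℚ.+-identityʳ (seq x n)) }
      ; comm = λ x y → ≈-pointwise {x + y} {y + x} λ n → ℚ.+-comm (seq x n) (seq y n) }
    ; *-isCommutativeMonoid = record
      { isMonoid = record
        { isSemigroup = record
          { isMagma = record
            { isEquivalence = isEquivalence
            ; ∙-cong = λ {x} {y} {u} {v} p q → ≈-trans (*-congʳ u p)
                (≈-trans (*-comm y u) (≈-trans (*-congʳ y q) (*-comm v y))) }
          ; assoc = λ x y z → ≈-pointwise {x * y * z} {x * (y * z)} λ n →
              ℚ.*-assoc (seq x n) (seq y n) (seq z n) }
        ; identity = (λ x → ≈-pointwise {1ℝ * x} {x} λ n → ℚ.*-identityˡ (seq x n))
                   , (λ x → ≈-pointwise {x * 1ℝ} {x} λ n → ℚ.*-identityʳ (seq x n)) }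
      ; comm = *-comm }
    ; distribʳ = λ z x y → ≈-pointwise {(x + y) * z} {x * z + y * z} λ n →
        ℚ.*-distribʳ-+ (seq z n) (seq x n) (seq y n)
    ; zeroˡ = λ x → ≈-pointwise {0ℝ * x} {0ℝ} λ n → ℚ.*-zeroˡ (seq x n) } }
  where
  isEquivalence : IsEquivalence _≈_
  isEquivalence = record { refl = λ {x} → ≈-refl {x} ; sym = ≈-sym ; trans = ≈-trans }

≤-preorder : Preorder _ _ _
≤-preorder = record
  { Carrier = ℝ ; _≈_ = _≈_ ; _≲_ = _≤_
  ; isPreorder = record
    { isEquivalence = CommutativeSemiring.isEquivalence ℝ-commutativeSemiring
    ; reflexive = ≈⇒≤ ; trans = ≤-trans } }

module ℝ-Ordered where
  open CommutativeSemiring ℝ-commutativeSemiring public using (semiring)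
  open CommutativeSemiring ℝ-commutativeSemiring using (+-cong; +-identityˡ; *-cong; *-identityˡ; distribʳ; zeroˡ; zeroʳ)
  open SemiringMult semiring using (×-homo-+; ×1-homo-*) renaming (_×_ to _·_)
  private
    module ∑ = SemiringSum semiring
    module ∑′ = CubeSum (CommutativeSemiring.+-commutativeMonoid ℝ-commutativeSemiring)

  ≤-refl : ∀ {x} → x ≤ x
  ≤-refl {x} = ≈⇒≤ (≈-refl {x})

  ∑-cong : ∀ {n} {f g : Fin n → ℝ} → (∀ i → f i ≈ g i) → ∑ f ≈ ∑ g
  ∑-cong = ∑.sum-cong-≋

  ∑-+ : ∀ {n} (f g : Fin n → ℝ) → ∑ (λ i → f i + g i) ≈ ∑ f + ∑ g
  ∑-+ = ∑.∑-distrib-+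

  ∑-comm : ∀ {m n} (f : Fin m → Fin n → ℝ) → ∑ (λ i → ∑ (f i)) ≈ ∑ (λ j → ∑ (λ i → f i j))
  ∑-comm = ∑.∑-comm

  *-∑ : ∀ {n} x (f : Fin n → ℝ) → x * ∑ f ≈ ∑ (λ i → x * f i)
  *-∑ = ∑.*-distribˡ-sum

  ∑-* : ∀ {n} x (f : Fin n → ℝ) → ∑ f * x ≈ ∑ (λ i → f i * x)
  ∑-* = ∑.*-distribʳ-sum

  ∑-0 : ∀ n → ∑ {n} (λ _ → 0ℝ) ≈ 0ℝ
  ∑-0 = ∑.sum-replicate-zero

  ∑-select : ∀ {n} (i : Fin n) (f : Fin n → ℝ) → ∑ (λ j → if does (i Fin.≟ j) then f j else 0ℝ) ≈ f i
  ∑-select = ∑′.sum-select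

  ∑-select′ : ∀ {n} (i : Fin n) (f : Fin n → ℝ) → ∑ (λ j → if does (j Fin.≟ i) then f j else 0ℝ) ≈ f i
  ∑-select′ = ∑′.sum-select′

  ∑∑-select : ∀ {m n} (u : Fin m) (v : Fin n) (f : Fin m → Fin n → ℝ) →
    ∑ (λ s → ∑ (λ t → if does (s Fin.≟ u) ∧ does (t Fin.≟ v) then f s t else 0ℝ)) ≈ f u v
  ∑∑-select = ∑′.sum-sum-select

  ∑⁴-comm : ∀ {m n p q} (f : Fin m → Fin n → Fin p → Fin q → ℝ) →
    ∑ (λ a → ∑ (λ b → ∑ (λ c → ∑ (λ d → f a b c d)))) ≈
    ∑ (λ c → ∑ (λ d → ∑ (λ a → ∑ (λ b → f a b c d))))
  ∑⁴-comm = ∑′.sum⁴-comm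

  ∑-mono-≤ : ∀ {n} {f g : Fin n → ℝ} → (∀ i → f i ≤ g i) → ∑ f ≤ ∑ g
  ∑-mono-≤ {zero}  f≤g = ≤-refl
  ∑-mono-≤ {suc n} f≤g = +-mono-≤ (f≤g zero) (∑-mono-≤ (f≤g ∘ suc))

  -- Opaque, so that the natural number can be recovered by unification.
  opaque
    ι : ℕ → ℝ
    ι n = n · 1ℝ

    ι-0 : ι 0 ≈ 0ℝ
    ι-0 = ≈-refl {0ℝ}

    ι-1 : ι 1 ≈ 1ℝ
    ι-1 = ≈-pointwise {1ℝ + 0ℝ} {1ℝ} λ _ → refl

    ι-+ : ∀ m n → ι (m ℕ.+ n) ≈ ι m + ι n
    ι-+ = ×-homo-+ 1ℝ

    ι-* : ∀ m n → ι (m ℕ.* n) ≈ ι m * ι n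
    ι-* = ×1-homo-*

    ι-sum : ∀ {n} (f : Fin n → ℕ) → ι (ℕ-Sum.sum f) ≈ ∑ (ι ∘ f)
    ι-sum {zero}  f = ≈-refl {0ℝ}
    ι-sum {suc n} f = ≈-trans (ι-+ (f zero) _)
      (+-cong (≈-refl {ι (f zero)}) (ι-sum (f ∘ suc)))

    ι-nonneg : ∀ n → 0ℝ ≤ ι n
    ι-nonneg zero    = ≤-refl
    ι-nonneg (suc n) = ≤-trans (≈⇒≤ (≈-sym (+-identityˡ 0ℝ)))
      (+-mono-≤ (≤-pointwise {0ℝ} {1ℝ} λ _ → ℚ.<⇒≤ (ℚ.positive⁻¹ 1ℚ)) (ι-nonneg n))

    -- A multiple by a natural number is a repeated sum. Since distances are natural numbers, this
    -- and `ι-*-mono` replace monotonicity of the real product in the duality argument.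
    ι*-mono : ∀ n {x y} → x ≤ y → ι n * x ≤ ι n * y
    ι*-mono zero    {x} {y} _   = ≈⇒≤ (≈-trans (zeroˡ x) (≈-sym (zeroˡ y)))
    ι*-mono (suc n) {x} {y} x≤y = ≤-trans (≈⇒≤ (distribʳ x 1ℝ (ι n)))
      (≤-trans (+-mono-≤ (≤-trans (≈⇒≤ (*-identityˡ x)) (≤-trans x≤y (≈⇒≤ (≈-sym (*-identityˡ y)))))
                         (ι*-mono n x≤y))
               (≈⇒≤ (≈-sym (distribʳ y 1ℝ (ι n)))))

    seq-ι : ∀ n i → seq (ι n) i ≡ (ℤ.+ n) ℚ./ 1
    seq-ι zero    i = refl
    seq-ι (suc n) i = trans (cong (1ℚ ℚ.+_) (seq-ι n i)) (sym (suc-/ n 0))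

  ι-*-mono : ∀ {a b} x → 0ℝ ≤ x → a ℕ.≤ b → ι a * x ≤ ι b * x
  ι-*-mono {a} {b} x 0≤x a≤b = subst (λ n → ι a * x ≤ ι n * x) (ℕ.m+[n∸m]≡n a≤b) (begin
    ι a * x              ≈⟨ CommutativeSemiring.+-identityʳ ℝ-commutativeSemiring (ι a * x) ⟨
    ι a * x + 0ℝ         ≲⟨ +-mono-≤ ≤-refl (≤-trans (≈⇒≤ (≈-sym (zeroʳ (ι e)))) (ι*-mono e 0≤x)) ⟩
    ι a * x + ι e * x    ≈⟨ distribʳ x (ι a) (ι e) ⟨
    (ι a + ι e) * x      ≈⟨ *-congʳ x (ι-+ a e) ⟨
    ι (a ℕ.+ e) * x      ∎)
    where
    open PreorderReasoning ≤-preorder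
    e = b ℕ.∸ a

  ι-mono : ∀ {a b} → a ℕ.≤ b → ι a ≤ ι b
  ι-mono {a} {b} a≤b = ≤-trans (≈⇒≤ (≈-sym (CommutativeSemiring.*-identityʳ ℝ-commutativeSemiring (ι a))))
    (≤-trans (ι-*-mono 1ℝ (≤-trans (ι-nonneg 1) (≈⇒≤ ι-1)) a≤b)
      (≈⇒≤ (CommutativeSemiring.*-identityʳ ℝ-commutativeSemiring (ι b))))

-- Weak duality between K-flows and metrics

open CommutativeSemiring ℝ-commutativeSemiring
  using (+-cong; +-congˡ; *-congˡ; *-assoc; distribˡ; distribʳ; zeroˡ; zeroʳ; *-identityˡ)
  renaming (+-comm to ℝ-+-comm; +-identityʳ to ℝ-+-identityʳ)
open ℝ-Ordered

≡⇒≈ : ∀ {x y} → x ≡ y → x ≈ y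
≡⇒≈ {x} refl = ≈-refl {x}

module WeakDuality {n k : ℕ} {G : CapGraph n} {τ : Fin k → Fin n} (F : KFlow G τ)
  (δ : Fin n → Fin n → ℕ) (δ-refl : ∀ u → δ u u ≡ 0) (δ-sym : ∀ u v → δ u v ≡ δ v u)
  (δ-triangle : ∀ u v w → δ u w ℕ.≤ δ u v ℕ.+ δ v w) where

  open PreorderReasoning ≤-preorder

  volume : Fin k → Fin k → ℝ
  volume s t = ∑ λ u → ∑ λ v → ι (δ u v) * flow F s t u v

  -- The distance from the source is a feasible dual potential.
  demand≤volume : ∀ s t → ι (δ (τ s) (τ t)) * demand F s t ≤ volume s t
  -- `X` is the potential-weighted outflow. It is added to both sides so that conservation can be
  -- used as it stands, without subtraction; the potential vanishes at the source and the triangle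
  -- inequality bounds its growth along the flow.
  demand≤volume s t = +-cancelˡ-≤ X (begin
    X + p (τ t) * c
      ≈⟨ +-congˡ (at (τ t)) ⟨
    X + ∑ (λ v → p v * (if does (v Fin.≟ τ t) then c else 0ℝ))
      ≈⟨ ∑-+ (λ v → p v * out v) (λ v → p v * (if does (v Fin.≟ τ t) then c else 0ℝ)) ⟨
    ∑ (λ v → p v * out v + p v * (if does (v Fin.≟ τ t) then c else 0ℝ))
      ≈⟨ ∑-cong (λ v → ≈-trans (≈-sym (distribˡ (p v) (out v) _))
           (≈-trans (*-congˡ (conservation F s t v)) (distribˡ (p v) (inn v) _))) ⟩
    ∑ (λ v → p v * inn v + p v * (if does (v Fin.≟ τ s) then c else 0ℝ))
      ≈⟨ ∑-+ (λ v → p v * inn v) (λ v → p v * (if does (v Fin.≟ τ s) then c else 0ℝ)) ⟩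
    ∑ (λ v → p v * inn v) + ∑ (λ v → p v * (if does (v Fin.≟ τ s) then c else 0ℝ))
      ≈⟨ +-congˡ (≈-trans (at (τ s)) source) ⟩
    ∑ (λ v → p v * inn v) + 0ℝ
      ≈⟨ ℝ-+-identityʳ _ ⟩
    ∑ (λ v → p v * inn v)
      ≲⟨ potential-in ⟩
    X + volume s t ∎)
    where
    c = demand F s t
    p : Fin n → ℝ
    p v = ι (δ (τ s) v)
    out inn : Fin n → ℝ
    out v = ∑ λ u → flow F s t v u
    inn v = ∑ λ u → flow F s t u v
    X = ∑ λ v → p v * out v
    at : ∀ i → ∑ (λ v → p v * (if does (v Fin.≟ i) then c else 0ℝ)) ≈ p i * c
    at i = ≈-trans (∑-cong inside) (∑-select′ i (λ v → p v * c))
      where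
      inside : ∀ v → p v * (if does (v Fin.≟ i) then c else 0ℝ) ≈ (if does (v Fin.≟ i) then p v * c else 0ℝ)
      inside v with does (v Fin.≟ i)
      ... | true  = ≈-refl {p v * c}
      ... | false = zeroʳ (p v)
    source : p (τ s) * c ≈ 0ℝ
    source = ≈-trans (*-congʳ c (≈-trans (≡⇒≈ (cong ι (δ-refl (τ s)))) ι-0)) (zeroˡ c)
    potential-in : ∑ (λ v → p v * inn v) ≤ X + volume s t
    potential-in = begin
      ∑ (λ v → p v * inn v)
        ≈⟨ ∑-cong (λ v → *-∑ (p v) (λ u → flow F s t u v)) ⟩
      ∑ (λ v → ∑ (λ u → p v * flow F s t u v))
        ≈⟨ ∑-comm (λ v u → p v * flow F s t u v) ⟩
      ∑ (λ u → ∑ (λ v → p v * flow F s t u v))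
        ≲⟨ ∑-mono-≤ (λ u → ∑-mono-≤ (λ v → step u v)) ⟩
      ∑ (λ u → ∑ (λ v → p u * flow F s t u v + ι (δ u v) * flow F s t u v))
        ≈⟨ ∑-cong (λ u → ∑-+ (λ v → p u * flow F s t u v) (λ v → ι (δ u v) * flow F s t u v)) ⟩
      ∑ (λ u → ∑ (λ v → p u * flow F s t u v) + ∑ (λ v → ι (δ u v) * flow F s t u v))
        ≈⟨ ∑-+ (λ u → ∑ (λ v → p u * flow F s t u v)) (λ u → ∑ (λ v → ι (δ u v) * flow F s t u v)) ⟩
      ∑ (λ u → ∑ (λ v → p u * flow F s t u v)) + volume s t
        ≈⟨ +-cong (∑-cong (λ u → ≈-sym (*-∑ (p u) (flow F s t u)))) (≈-refl {volume s t}) ⟩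
      X + volume s t ∎
      where
      step : ∀ u v → p v * flow F s t u v ≤ p u * flow F s t u v + ι (δ u v) * flow F s t u v
      step u v = begin
        p v * flow F s t u v
          ≲⟨ ι-*-mono (flow F s t u v) (flow-nonneg F s t u v) (δ-triangle (τ s) u v) ⟩
        ι (δ (τ s) u ℕ.+ δ u v) * flow F s t u v
          ≈⟨ *-congʳ (flow F s t u v) (ι-+ (δ (τ s) u) (δ u v)) ⟩
        (p u + ι (δ u v)) * flow F s t u v
          ≈⟨ distribʳ (flow F s t u v) (p u) (ι (δ u v)) ⟩
        p u * flow F s t u v + ι (δ u v) * flow F s t u v ∎

  totalVolume : ℝ
  totalVolume = ∑ λ s → ∑ λ t → volume s t

  -- `load` is symmetric and collects both directions, so the sum over ordered pairs meets every
  -- unit of flow twice.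
  load-volume : ∑ (λ u → ∑ (λ v → ι (δ u v) * load F u v)) ≈ totalVolume + totalVolume
  load-volume = begin-equality
    ∑ (λ u → ∑ (λ v → ι (δ u v) * load F u v))
      ≈⟨ ∑-cong (λ u → ∑-cong (λ v → inside u v)) ⟩
    ∑ (λ u → ∑ (λ v → ∑ (λ s → ∑ (λ t → g u v s t)) + ∑ (λ s → ∑ (λ t → g v u s t))))
      ≈⟨ ≈-trans (∑-cong (λ u → ∑-+ (λ v → ∑ (λ s → ∑ (g u v s))) (λ v → ∑ (λ s → ∑ (g v u s)))))
           (∑-+ (λ u → ∑ (λ v → ∑ (λ s → ∑ (g u v s)))) (λ u → ∑ (λ v → ∑ (λ s → ∑ (g v u s))))) ⟩
    ∑ (λ u → ∑ (λ v → ∑ (λ s → ∑ (g u v s)))) + ∑ (λ u → ∑ (λ v → ∑ (λ s → ∑ (g v u s))))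
      ≈⟨ +-congˡ (∑-comm (λ u v → ∑ (λ s → ∑ (g v u s)))) ⟩
    ∑ (λ u → ∑ (λ v → ∑ (λ s → ∑ (g u v s)))) + ∑ (λ v → ∑ (λ u → ∑ (λ s → ∑ (g v u s))))
      ≈⟨ +-cong (∑⁴-comm g) (∑⁴-comm g) ⟩
    totalVolume + totalVolume ∎
    where
    g : Fin n → Fin n → Fin k → Fin k → ℝ
    g u v s t = ι (δ u v) * flow F s t u v
    inside : ∀ u v → ι (δ u v) * load F u v ≈
             ∑ (λ s → ∑ (λ t → g u v s t)) + ∑ (λ s → ∑ (λ t → g v u s t))
    inside u v = begin-equality
      ι (δ u v) * load F u v
        ≈⟨ ≈-trans (*-∑ (ι (δ u v)) (λ s → ∑ (λ t → flow F s t u v + flow F s t v u)))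
             (∑-cong (λ s → *-∑ (ι (δ u v)) (λ t → flow F s t u v + flow F s t v u))) ⟩
      ∑ (λ s → ∑ (λ t → ι (δ u v) * (flow F s t u v + flow F s t v u)))
        ≈⟨ ∑-cong (λ s → ∑-cong (λ t → ≈-trans (distribˡ (ι (δ u v)) (flow F s t u v) (flow F s t v u))
             (+-congˡ (≡⇒≈ (cong (λ a → ι a * flow F s t v u) (δ-sym u v)))))) ⟩
      ∑ (λ s → ∑ (λ t → g u v s t + g v u s t))
        ≈⟨ ≈-trans (∑-cong (λ s → ∑-+ (g u v s) (g v u s))) (∑-+ (λ s → ∑ (g u v s)) (λ s → ∑ (g v u s))) ⟩
      ∑ (λ s → ∑ (λ t → g u v s t)) + ∑ (λ s → ∑ (λ t → g v u s t)) ∎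

  -- Congestion is only stated on edges; elsewhere both sides are zero, whatever the sign of `ρ`.
  load≤ρ*cap : ∀ {ρ} → HasCongestion F ρ → ∀ u v → load F u v ≤ ρ * cap G u v
  load≤ρ*cap {ρ} congested u v with edge G u v in eq
  ... | true  = congested u v eq
  ... | false = ≈⇒≤ (begin-equality
    load F u v                ≈⟨ ∑-cong (λ s → ∑-cong (λ t → +-cong (flow-nonedge F s t u v eq)
                                   (flow-nonedge F s t v u (trans (edge-sym G v u) eq)))) ⟩
    ∑ {k} (λ s → ∑ {k} (λ t → 0ℝ + 0ℝ))
      ≈⟨ ∑-cong {k} (λ s → ≈-trans (∑-cong {k} (λ t → ℝ-+-identityʳ 0ℝ)) (∑-0 k)) ⟩
    ∑ {k} (λ s → 0ℝ)          ≈⟨ ∑-0 k ⟩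
    0ℝ                        ≈⟨ zeroʳ ρ ⟨
    ρ * 0ℝ                    ≈⟨ *-congˡ (cap-nonedge G u v eq) ⟨
    ρ * cap G u v             ∎)

  -- The demand is doubled on the left because the sum on the right runs over ordered pairs and so
  -- meets each edge twice.
  weak-duality : ∀ {ρ} → HasCongestion F ρ →
    ∑ (λ s → ∑ (λ t → ι (δ (τ s) (τ t)) * (demand F s t + demand F s t))) ≤
    ρ * ∑ (λ u → ∑ (λ v → ι (δ u v) * cap G u v))
  weak-duality {ρ} congested = begin
    ∑ (λ s → ∑ (λ t → ι (δ (τ s) (τ t)) * (demand F s t + demand F s t)))
      ≲⟨ ∑-mono-≤ (λ s → ∑-mono-≤ (λ t → ≤-trans
           (≈⇒≤ (distribˡ (ι (δ (τ s) (τ t))) (demand F s t) (demand F s t)))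
           (+-mono-≤ (demand≤volume s t) (demand≤volume s t)))) ⟩
    ∑ (λ s → ∑ (λ t → volume s t + volume s t))
      ≈⟨ ≈-trans (∑-cong (λ s → ∑-+ (volume s) (volume s))) (∑-+ (λ s → ∑ (volume s)) (λ s → ∑ (volume s))) ⟩
    totalVolume + totalVolume
      ≈⟨ load-volume ⟨
    ∑ (λ u → ∑ (λ v → ι (δ u v) * load F u v))
      ≲⟨ ∑-mono-≤ (λ u → ∑-mono-≤ (λ v → ι*-mono (δ u v) (load≤ρ*cap congested u v))) ⟩
    ∑ (λ u → ∑ (λ v → ι (δ u v) * (ρ * cap G u v)))
      ≈⟨ ∑-cong (λ u → ∑-cong (λ v → ≈-trans (≈-sym (*-assoc (ι (δ u v)) ρ (cap G u v)))
           (≈-trans (*-congʳ (cap G u v) (*-comm (ι (δ u v)) ρ)) (*-assoc ρ (ι (δ u v)) (cap G u v))))) ⟩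
    ∑ (λ u → ∑ (λ v → ρ * (ι (δ u v) * cap G u v)))
      ≈⟨ ≈-trans (∑-cong (λ u → ≈-sym (*-∑ ρ (λ v → ι (δ u v) * cap G u v))))
           (≈-sym (*-∑ ρ (λ u → ∑ (λ v → ι (δ u v) * cap G u v)))) ⟩
    ρ * ∑ (λ u → ∑ (λ v → ι (δ u v) * cap G u v)) ∎

-- The flow that saturates a sparsifier

½ℝ : ℝ
½ℝ = fromℚ ½

½ℝ*-nonneg : ∀ {x} → 0ℝ ≤ x → 0ℝ ≤ ½ℝ * x
½ℝ*-nonneg {x} 0≤x = mk≤ λ ε 0<ε → let N , p = ≤-close 0≤x ε 0<ε in N , λ n N≤n → begin
  0ℚ                           ≡⟨ ℚ.*-zeroʳ ½ ⟨
  ½ ℚ.* 0ℚ                     ≤⟨ ℚ.*-monoˡ-≤-nonNeg ½ (p n N≤n) ⟩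
  ½ ℚ.* (seq x n ℚ.+ ε)        ≡⟨ ℚ.*-distribˡ-+ ½ (seq x n) ε ⟩
  ½ ℚ.* seq x n ℚ.+ ½ ℚ.* ε    ≤⟨ ℚ.+-monoʳ-≤ (½ ℚ.* seq x n) (shrink 0<ε) ⟩
  ½ ℚ.* seq x n ℚ.+ ε          ∎
  where
  open ℚ.≤-Reasoning
  shrink : ∀ {ε} → 0ℚ ℚ.< ε → ½ ℚ.* ε ℚ.≤ ε
  shrink {ε} 0<ε = begin
    ½ ℚ.* ε              ≡⟨ ℚ.+-identityʳ (½ ℚ.* ε) ⟨
    ½ ℚ.* ε ℚ.+ 0ℚ       ≤⟨ ℚ.+-monoʳ-≤ (½ ℚ.* ε) (ℚ.<⇒≤ (half>0 0<ε)) ⟩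
    ½ ℚ.* ε ℚ.+ ½ ℚ.* ε  ≡⟨ half+half ε ⟩
    ε                    ∎

module Saturate {k : ℕ} (H : CapGraph k) where
  private
    amount : Fin k → Fin k → ℝ
    amount s t = ½ℝ * cap H s t

    single : Fin k → Fin k → Fin k → Fin k → ℝ
    single s t u v = if does (s Fin.≟ u) ∧ does (t Fin.≟ v) then amount s t else 0ℝ

    single-nonneg : ∀ s t u v → 0ℝ ≤ single s t u v
    single-nonneg s t u v with does (s Fin.≟ u) ∧ does (t Fin.≟ v)
    ... | true  = ½ℝ*-nonneg (cap-nonneg H s t)
    ... | false = ≤-refl

    single-nonedge : ∀ s t u v → edge H u v ≡ false → single s t u v ≈ 0ℝ
    single-nonedge s t u v nonedge with s Fin.≟ u | t Fin.≟ v
    ... | yes refl | yes refl = ≈-trans (*-congˡ (cap-nonedge H u v nonedge)) (zeroʳ ½ℝ)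
    ... | yes _    | no _     = ≈-refl {0ℝ}
    ... | no _     | _        = ≈-refl {0ℝ}

    at : Fin k → Fin k → ℝ → ℝ
    at u v x = if does (u Fin.≟ v) then x else 0ℝ

    at-sym : ∀ u v x → at u v x ≈ at v u x
    at-sym u v x with u Fin.≟ v | v Fin.≟ u
    ... | yes _ | yes _ = ≈-refl {x}
    ... | no _  | no _  = ≈-refl {0ℝ}
    ... | yes p | no ¬q = contradiction (sym p) ¬q
    ... | no ¬p | yes q = contradiction (sym q) ¬p

    single-out : ∀ s t v → ∑ (λ u → single s t v u) ≈ at s v (amount s t)
    single-out s t v with does (s Fin.≟ v)
    ... | true  = ∑-select t (λ _ → amount s t)
    ... | false = ∑-0 k

    single-in : ∀ s t v → ∑ (λ u → single s t u v) ≈ at t v (amount s t)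
    single-in s t v with does (t Fin.≟ v)
    ... | true  = ≈-trans (∑-cong {k} (λ u → ≡⇒≈ (cong (if_then amount s t else 0ℝ) (Bool.∧-identityʳ (does (s Fin.≟ u))))))
                    (∑-select s (λ _ → amount s t))
    ... | false = ≈-trans (∑-cong {k} (λ u → ≡⇒≈ (cong (if_then amount s t else 0ℝ) (Bool.∧-zeroʳ (does (s Fin.≟ u)))))) (∑-0 k)

  halves : ∀ x → ½ℝ * x + ½ℝ * x ≈ x
  halves x = ≈-pointwise {½ℝ * x + ½ℝ * x} {x} λ n → half+half (seq x n)

  -- Every edge of `H` carries half of its capacity as demand in each direction, routed along the
  -- edge itself. This fills all edges exactly and is therefore the hardest flow for `G` to route,
  -- as far as volume is concerned.
  saturating : KFlow H id
  saturating = record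
    { demand        = amount
    ; demand-nonneg = λ s t → ½ℝ*-nonneg (cap-nonneg H s t)
    ; flow          = single
    ; flow-nonneg   = single-nonneg
    ; flow-nonedge  = single-nonedge
    ; conservation  = λ s t v → ≈-trans (+-cong (single-out s t v) (at-sym v t (amount s t)))
        (≈-trans (ℝ-+-comm (at s v (amount s t)) (at t v (amount s t)))
          (+-cong (≈-sym (single-in s t v)) (at-sym s v (amount s t)))) }

  saturating-feasible : Feasible saturating
  saturating-feasible u v _ = ≈⇒≤ (begin-equality
    ∑ (λ s → ∑ (λ t → single s t u v + single s t v u))
      ≈⟨ ≈-trans (∑-cong (λ s → ∑-+ (λ t → single s t u v) (λ t → single s t v u)))
           (∑-+ (λ s → ∑ (λ t → single s t u v)) (λ s → ∑ (λ t → single s t v u))) ⟩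
    ∑ (λ s → ∑ (λ t → single s t u v)) + ∑ (λ s → ∑ (λ t → single s t v u))
      ≈⟨ +-cong (∑∑-select u v amount) (∑∑-select v u amount) ⟩
    amount u v + amount v u
      ≈⟨ +-congˡ (*-congˡ (cap-sym H v u)) ⟩
    amount u v + amount u v
      ≈⟨ halves (cap H u v) ⟩
    cap H u v ∎)
    where open PreorderReasoning ≤-preorder

module _ {n k : ℕ} (G : CapGraph n) (K : Fin k ↣ Fin n) (H : CapGraph k)
  (δ : Fin n → Fin n → ℕ) (δ-refl : ∀ u → δ u u ≡ 0) (δ-sym : ∀ u v → δ u v ≡ δ v u)
  (δ-triangle : ∀ u v w → δ u w ℕ.≤ δ u v ℕ.+ δ v w) where
  private
    τ : Fin k → Fin n
    τ = Injection.to K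

  -- The two halves of the saturating demand add up to the capacity, which is exactly the doubled
  -- demand of `weak-duality`.
  routable⇒volume≤ : ∀ {ρ} → RoutableBack G K H ρ →
    ∑ (λ s → ∑ (λ t → ι (δ (τ s) (τ t)) * cap H s t)) ≤
    ρ * ∑ (λ u → ∑ (λ v → ι (δ u v) * cap G u v))
  routable⇒volume≤ {ρ} routable =
    let open Saturate H
        F , same-demands , congested = routable saturating saturating-feasible
    in ≤-trans
      (≈⇒≤ (∑-cong (λ s → ∑-cong (λ t → *-congˡ
        (≈-trans (≈-sym (halves (cap H s t))) (+-cong (same-demands s t) (same-demands s t)))))))
      (WeakDuality.weak-duality F δ δ-refl δ-sym δ-triangle congested)

-- Graphs with natural capacities and their 0-extensions

naturalGraph : ∀ {n} (c : Fin n → Fin n → ℕ) → (∀ u v → c u v ≡ c v u) → (∀ u → c u u ≡ 0) → CapGraph n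
naturalGraph c c-sym c-diag = record
  { edge        = λ u v → not (c u v ℕ.≡ᵇ 0)
  ; edge-sym    = λ u v → cong (λ a → not (a ℕ.≡ᵇ 0)) (c-sym u v)
  ; edge-irrefl = λ u → cong (λ a → not (a ℕ.≡ᵇ 0)) (c-diag u)
  ; cap         = λ u v → ι (c u v)
  ; cap-sym     = λ u v → ≡⇒≈ (cong ι (c-sym u v))
  ; cap-nonneg  = λ u v → ι-nonneg (c u v)
  ; cap-nonedge = λ u v nonedge → ≈-trans (≡⇒≈ (cong ι (nonedge⇒0 (c u v) nonedge))) ι-0 }
  where
  nonedge⇒0 : ∀ a → not (a ℕ.≡ᵇ 0) ≡ false → a ≡ 0
  nonedge⇒0 zero _ = refl

module ZeroExtension {n k : ℕ} (c : Fin n → Fin n → ℕ)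
  (c-sym : ∀ u v → c u v ≡ c v u) (c-diag : ∀ u → c u u ≡ 0)
  (δ : Fin k → Fin k → ℕ) (δ-refl : ∀ s → δ s s ≡ 0) (δ-sym : ∀ s t → δ s t ≡ δ t s)
  (f : Fin n → Fin k) where

  open import Data.Nat.Base using () renaming (_+_ to _ℕ+_; _*_ to _ℕ*_; _≤_ to _ℕ≤_)
  open ℕ-Sum

  G : CapGraph n
  G = naturalGraph c c-sym c-diag

  extension-cap : Fin k → Fin k → ℕ
  extension-cap s t = sum λ u → sum λ v → if does (u Fin.<? v) ∧ edge G u v
    then (if does (SamePair? (f u) (f v) s t) then c u v else 0) else 0

  ι-if : ∀ b {m x} → ι m ≈ x → ι (if b then m else 0) ≈ (if b then x else 0ℝ)
  ι-if true  m≈x = m≈x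
  ι-if false _   = ι-0

  ι-extension-cap : ∀ s t → 0-extension-cap G f s t ≈ ι (extension-cap s t)
  ι-extension-cap s t = ≈-sym (≈-trans (ι-sum {n} _) (∑-cong λ u → ≈-trans (ι-sum {n} _) (∑-cong λ v →
    ι-if (does (u Fin.<? v) ∧ edge G u v) (ι-if (does (SamePair? (f u) (f v) s t)) (≈-refl {ι (c u v)})))))

  cost volume : ℕ
  cost = sum λ u → sum λ v → c u v ℕ* δ (f u) (f v)
  volume = sum λ s → sum λ t → δ s t ℕ* extension-cap s t

  private
    -- Both orders of the pair {a , b} are counted unless a ≡ b, when δ vanishes.
    pair-term : ∀ c a b s t →
      (if does (s Fin.≟ a) ∧ does (t Fin.≟ b) then c ℕ* δ s t else 0) ℕ+
      (if does (s Fin.≟ b) ∧ does (t Fin.≟ a) then c ℕ* δ s t else 0) ℕ≤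
      δ s t ℕ* (if does (SamePair? a b s t) then c else 0)
    pair-term c a b s t = go (s Fin.≟ a ×-dec t Fin.≟ b) (s Fin.≟ b ×-dec t Fin.≟ a)
      where
      pair : (a ≡ s × b ≡ t) ⊎ (a ≡ t × b ≡ s) → δ s t ℕ* c ≡ δ s t ℕ* (if does (SamePair? a b s t) then c else 0)
      pair e = cong (λ z → δ s t ℕ* (if z then c else 0)) (sym (dec-true (SamePair? a b s t) e))
      go : (p : Dec (s ≡ a × t ≡ b)) (q : Dec (s ≡ b × t ≡ a)) →
           (if does p then c ℕ* δ s t else 0) ℕ+ (if does q then c ℕ* δ s t else 0) ℕ≤
           δ s t ℕ* (if does (SamePair? a b s t) then c else 0)
      go (yes (refl , refl)) (yes (_ , t≡s)) = ℕ.≤-trans (ℕ.≤-reflexive (cong₂ _ℕ+_ vanish vanish)) ℕ.z≤n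
        where
        vanish : c ℕ* δ s t ≡ 0
        vanish = trans (cong (λ z → c ℕ* δ s z) t≡s) (trans (cong (c ℕ*_) (δ-refl s)) (ℕ.*-zeroʳ c))
      go (yes (s≡a , t≡b)) (no _) = ℕ.≤-reflexive (trans (ℕ.+-identityʳ _)
        (trans (ℕ.*-comm c (δ s t)) (pair (inj₁ (sym s≡a , sym t≡b)))))
      go (no _) (yes (s≡b , t≡a)) = ℕ.≤-reflexive
        (trans (ℕ.*-comm c (δ s t)) (pair (inj₂ (sym t≡a , sym s≡b))))
      go (no _) (no _) = ℕ.z≤n

    edge-term : ∀ c a b → c ℕ* δ a b ℕ+ c ℕ* δ b a ℕ≤
      sum (λ s → sum (λ t → δ s t ℕ* (if does (SamePair? a b s t) then c else 0)))
    edge-term c a b = begin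
      c ℕ* δ a b ℕ+ c ℕ* δ b a
        ≡⟨ cong₂ _ℕ+_ (sum-sum-select a b (λ s t → c ℕ* δ s t)) (sum-sum-select b a (λ s t → c ℕ* δ s t)) ⟨
      sum (λ s → sum (P s)) ℕ+ sum (λ s → sum (Q s))
        ≡⟨ ∑-distrib-+ (λ s → sum (P s)) (λ s → sum (Q s)) ⟨
      sum (λ s → sum (P s) ℕ+ sum (Q s))
        ≡⟨ sum-cong-≗ {k} (λ s → ∑-distrib-+ (P s) (Q s)) ⟨
      sum (λ s → sum (λ t → P s t ℕ+ Q s t))
        ≤⟨ sum-mono-≤ {k} (λ s → sum-mono-≤ {k} (λ t → pair-term c a b s t)) ⟩
      sum (λ s → sum (λ t → δ s t ℕ* (if does (SamePair? a b s t) then c else 0))) ∎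
      where
      open ℕ.≤-Reasoning
      P Q : Fin k → Fin k → ℕ
      P s t = if does (s Fin.≟ a) ∧ does (t Fin.≟ b) then c ℕ* δ s t else 0
      Q s t = if does (s Fin.≟ b) ∧ does (t Fin.≟ a) then c ℕ* δ s t else 0

    g : Fin n → Fin n → ℕ
    g u v = c u v ℕ* δ (f u) (f v)

    before : Fin n → Fin n → ℕ → ℕ
    before u v a = if does (u Fin.<? v) then a else 0

    ordered-term : ∀ u v → before u v (g u v) ℕ+ before u v (g v u) ℕ≤
      sum (λ s → sum (λ t → δ s t ℕ* (if does (u Fin.<? v) ∧ edge G u v
        then (if does (SamePair? (f u) (f v) s t) then c u v else 0) else 0)))
    ordered-term u v with does (u Fin.<? v)
    ... | false = ℕ.z≤n
    ... | true with c u v in eq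
    ...   | zero  = ℕ.≤-trans (ℕ.≤-reflexive (cong (_ℕ* δ (f v) (f u)) (trans (c-sym v u) eq))) ℕ.z≤n
    ...   | suc a = ℕ.≤-trans (ℕ.≤-reflexive (cong (λ z → suc a ℕ* δ (f u) (f v) ℕ+ z ℕ* δ (f v) (f u))
        (trans (c-sym v u) eq))) (edge-term (suc a) (f u) (f v))

    split-term : ∀ u v → g u v ℕ≤ before u v (g u v) ℕ+ before v u (g u v)
    split-term u v = go (u Fin.<? v) (v Fin.<? u)
      where
      go : (p : Dec (toℕ u ℕ.< toℕ v)) (q : Dec (toℕ v ℕ.< toℕ u)) →
           g u v ℕ≤ (if does p then g u v else 0) ℕ+ (if does q then g u v else 0)
      go (yes _) _       = ℕ.m≤m+n (g u v) _
      go (no _)  (yes _) = ℕ.≤-refl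
      go (no ≮)  (no ≯)  = ℕ.≤-reflexive (cong (_ℕ* δ (f u) (f v))
        (trans (cong (c u) (sym (Fin.toℕ-injective (ℕ.≤-antisym (ℕ.≮⇒≥ ≯) (ℕ.≮⇒≥ ≮))))) (c-diag u)))

  -- `cost` meets an edge as `(u , v)` and as `(v , u)`, whereas `extension-cap` uses it once, with
  -- `u` before `v`, but enters at both orders of the pair of images. Hence both orders are first
  -- moved to the one with `u` before `v` and then matched with the two orders of `(s , t)`.
  cost≤volume : cost ℕ≤ volume
  cost≤volume = begin
    cost
      ≤⟨ sum-mono-≤ {n} (λ u → sum-mono-≤ {n} (split-term u)) ⟩
    sum (λ u → sum (λ v → before u v (g u v) ℕ+ before v u (g u v)))
      ≡⟨ double-+ (λ u v → before u v (g u v)) (λ u v → before v u (g u v)) ⟩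
    sum (λ u → sum (λ v → before u v (g u v))) ℕ+ sum (λ u → sum (λ v → before v u (g u v)))
      ≡⟨ cong (sum (λ u → sum (λ v → before u v (g u v))) ℕ+_) (ℕ-Sum.∑-comm {n} {n} (λ u v → before v u (g u v))) ⟩
    sum (λ u → sum (λ v → before u v (g u v))) ℕ+ sum (λ v → sum (λ u → before v u (g u v)))
      ≡⟨ double-+ (λ u v → before u v (g u v)) (λ u v → before u v (g v u)) ⟨
    sum (λ u → sum (λ v → before u v (g u v) ℕ+ before u v (g v u)))
      ≤⟨ sum-mono-≤ {n} (λ u → sum-mono-≤ {n} (ordered-term u)) ⟩
    sum (λ u → sum (λ v → sum (λ s → sum (λ t → δ s t ℕ* E s t u v))))
      ≡⟨ sum⁴-comm {n} {n} {k} {k} (λ u v s t → δ s t ℕ* E s t u v) ⟩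
    sum (λ s → sum (λ t → sum (λ u → sum (λ v → δ s t ℕ* E s t u v))))
      ≡⟨ sum-cong-≗ {k} (λ s → sum-cong-≗ {k} (λ t →
           trans (*-distribˡ-sum (δ s t) (λ u → sum (E s t u)))
                 (sum-cong-≗ {n} (λ u → *-distribˡ-sum (δ s t) (E s t u))))) ⟨
    volume ∎
    where
    open ℕ.≤-Reasoning
    E : Fin k → Fin k → Fin n → Fin n → ℕ
    E s t u v = if does (u Fin.<? v) ∧ edge G u v
      then (if does (SamePair? (f u) (f v) s t) then c u v else 0) else 0
    double-+ : ∀ (p q : Fin n → Fin n → ℕ) → sum (λ u → sum (λ v → p u v ℕ+ q u v)) ≡
               sum (λ u → sum (p u)) ℕ+ sum (λ u → sum (q u))
    double-+ p q = trans (sum-cong-≗ {n} (λ u → ∑-distrib-+ (p u) (q u)))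
      (∑-distrib-+ (λ u → sum (p u)) (λ u → sum (q u)))

module _ {n k : ℕ} (c : Fin n → Fin n → ℕ)
  (c-sym : ∀ u v → c u v ≡ c v u) (c-diag : ∀ u → c u u ≡ 0) (K : Fin k ↣ Fin n)
  (δ : Fin n → Fin n → ℕ) (δ-refl : ∀ u → δ u u ≡ 0) (δ-sym : ∀ u v → δ u v ≡ δ v u)
  (δ-triangle : ∀ u v w → δ u w ℕ.≤ δ u v ℕ.+ δ v w) where
  private
    τ : Fin k → Fin n
    τ = Injection.to K

    G : CapGraph n
    G = naturalGraph c c-sym c-diag

    δK : Fin k → Fin k → ℕ
    δK s t = δ (τ s) (τ t)

    module Extension = ZeroExtension c c-sym c-diag δK (δ-refl ∘ τ) (λ s t → δ-sym (τ s) (τ t))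

  -- Volume is linear in the capacities and the coefficients sum to 1, so a bound for every single
  -- 0-extension passes to all convex combinations.
  combination-volume : ∀ B → (∀ f → FixesTerminals K f → B ℕ.≤ Extension.cost f) →
    ∀ H → IsConvexCombinationOf0-Extensions G K H →
    ι B ≤ ∑ (λ s → ∑ (λ t → ι (δK s t) * cap H s t))
  combination-volume B costly H convex = begin
    ι B
      ≈⟨ *-identityˡ (ι B) ⟨
    1ℝ * ι B
      ≈⟨ *-congʳ (ι B) coeff-sum ⟨
    ∑ coeff * ι B
      ≈⟨ ∑-* (ι B) coeff ⟩
    ∑ (λ i → coeff i * ι B)
      ≲⟨ ∑-mono-≤ per-extension ⟩
    ∑ (λ i → ∑ (λ s → ∑ (λ t → term i s t)))
      ≈⟨ ∑-comm (λ i s → ∑ (term i s)) ⟩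
    ∑ (λ s → ∑ (λ i → ∑ (λ t → term i s t)))
      ≈⟨ ∑-cong (λ s → ∑-comm (λ i t → term i s t)) ⟩
    ∑ (λ s → ∑ (λ t → ∑ (λ i → term i s t)))
      ≈⟨ ∑-cong (λ s → ∑-cong (λ t → ≈-sym (*-∑ (ι (δK s t)) (λ i → coeff i * 0-extension-cap G (ext i) s t)))) ⟩
    ∑ (λ s → ∑ (λ t → ι (δK s t) * ∑ (λ i → coeff i * 0-extension-cap G (ext i) s t)))
      ≈⟨ ∑-cong (λ s → ∑-cong (λ t → ≈-sym (on-pair s t))) ⟩
    ∑ (λ s → ∑ (λ t → ι (δK s t) * cap H s t)) ∎
    where
    open PreorderReasoning ≤-preorder
    open IsConvexCombinationOf0-Extensions convex
    term : Fin count → Fin k → Fin k → ℝ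
    term i s t = ι (δK s t) * (coeff i * 0-extension-cap G (ext i) s t)
    on-pair : ∀ s t → ι (δK s t) * cap H s t ≈
              ι (δK s t) * ∑ (λ i → coeff i * 0-extension-cap G (ext i) s t)
    on-pair s t with s Fin.≟ t
    ... | no s≢t   = *-congˡ (cap-combo s t s≢t)
    -- `cap-combo` is silent on the diagonal, where the distance 0 makes both sides vanish.
    ... | yes refl = ≈-trans (vanish (cap H s s)) (≈-sym (vanish _))
      where
      vanish : ∀ x → ι (δK s s) * x ≈ 0ℝ
      vanish x = ≈-trans (*-congʳ x (≈-trans (≡⇒≈ (cong ι (δ-refl (τ s)))) ι-0)) (zeroˡ x)
    swap : ∀ x y z → x * (y * z) ≈ y * (x * z)
    swap x y z = ≈-trans (≈-sym (*-assoc x y z)) (≈-trans (*-congʳ z (*-comm x y)) (*-assoc y x z))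
    term-natural : ∀ i s t → term i s t ≈ coeff i * ι (δK s t ℕ.* Extension.extension-cap (ext i) s t)
    term-natural i s t = ≈-trans (swap (ι (δK s t)) (coeff i) _) (*-congˡ
      (≈-trans (*-congˡ (Extension.ι-extension-cap (ext i) s t)) (≈-sym (ι-* (δK s t) _))))
    per-extension : ∀ i → coeff i * ι B ≤ ∑ (λ s → ∑ (λ t → term i s t))
    per-extension i = begin
      coeff i * ι B
        ≈⟨ *-comm (coeff i) (ι B) ⟩
      ι B * coeff i
        ≲⟨ ι-*-mono (coeff i) (coeff-nonneg i)
             (ℕ.≤-trans (costly (ext i) (ext-fixes i)) (Extension.cost≤volume (ext i))) ⟩
      ι (Extension.volume (ext i)) * coeff i
        ≈⟨ *-comm _ (coeff i) ⟩
      coeff i * ι (Extension.volume (ext i))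
        ≈⟨ *-congˡ (≈-trans (ι-sum {k} _) (∑-cong {k} (λ s → ι-sum (entry s)))) ⟩
      coeff i * ∑ (λ s → ∑ (λ t → ι (entry s t)))
        ≈⟨ ≈-trans (*-∑ (coeff i) (λ s → ∑ (ι ∘ entry s))) (∑-cong {k} (λ s → *-∑ (coeff i) (ι ∘ entry s))) ⟩
      ∑ (λ s → ∑ (λ t → coeff i * ι (entry s t)))
        ≈⟨ ∑-cong (λ s → ∑-cong (λ t → ≈-sym (term-natural i s t))) ⟩
      ∑ (λ s → ∑ (λ t → term i s t)) ∎
      where
      entry : Fin k → Fin k → ℕ
      entry s t = δK s t ℕ.* Extension.extension-cap (ext i) s t

  ι-volume : ∑ (λ u → ∑ (λ v → ι (δ u v) * cap G u v)) ≈
             ι (ℕ-Sum.sum (λ u → ℕ-Sum.sum (λ v → δ u v ℕ.* c u v)))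
  ι-volume = ≈-sym (≈-trans (ι-sum {n} _) (∑-cong λ u → ≈-trans (ι-sum {n} _)
    (∑-cong λ v → ι-* (δ u v) (c u v))))

  quality-bound : ∀ B → (∀ f → FixesTerminals K f → B ℕ.≤ Extension.cost f) →
    ∀ H → IsConvexCombinationOf0-Extensions G K H → ∀ ρ → RoutableBack G K H ρ →
    ι B ≤ ρ * ι (ℕ-Sum.sum (λ u → ℕ-Sum.sum (λ v → δ u v ℕ.* c u v)))
  quality-bound B costly H convex ρ routable = ≤-trans (combination-volume B costly H convex)
    (≤-trans (routable⇒volume≤ G K H δ δ-refl δ-sym δ-triangle routable) (≈⇒≤ (*-congˡ ι-volume)))

-- The core with a pendant terminal at each of its vertices

module Gap (ℓ : ℕ) .{{_ : ℕ.NonZero ℓ}} where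
  open import Data.Nat.Base using () renaming (_+_ to _ℕ+_; _*_ to _ℕ*_; _≤_ to _ℕ≤_)
  open ℕ-Sum

  private instance
    ℓ²≢0 : ℕ.NonZero (ℓ ℕ* ℓ)
    ℓ²≢0 = ℕ.m*n≢0 ℓ ℓ

  open Core (ℓ ℕ* ℓ)
  open Distance far

  -- Vertices are points of Cube (suc m), whose head is false for a core vertex
  -- and true for the terminal pendant at it.
  k n : ℕ
  k = size m
  n = size (suc m)

  -- Balances the two terms of cut+displacement.
  pendantCap : ℕ
  pendantCap = 144 ℕ* ℓ

  -- Generators of the code may coincide, and then their capacities add up. A zero generator would
  -- give a loop, which `offDiagonal` removes.
  capacity : Cube (suc m) → Cube (suc m) → ℕ
  capacity (false ∷ x) (false ∷ y) = sum λ j → if does (x ⊕ generators j ≟ᵛ y) then 1 else 0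
  capacity (false ∷ x) (true ∷ y)  = if does (x ≟ᵛ y) then pendantCap else 0
  capacity (true ∷ x)  (false ∷ y) = if does (x ≟ᵛ y) then pendantCap else 0
  capacity (true ∷ x)  (true ∷ y)  = 0

  height : Bool → ℕ
  height false = 0
  height true  = ℓ

  D : Cube m → ℕ
  D = distance far generators

  -- The length of a walk through the feet of the two points. From a terminal to itself it is
  -- `2 * ℓ` instead of 0, which is why `δ` is its `offDiagonal`.
  gauge : Cube (suc m) → Cube (suc m) → ℕ
  gauge (b ∷ x) (b′ ∷ y) = height b ℕ+ height b′ ℕ+ D (x ⊕ y)

  offDiagonal : (Cube (suc m) → Cube (suc m) → ℕ) → Fin n → Fin n → ℕ
  offDiagonal F u v = if does (u Fin.≟ v) then 0 else F (point u) (point v)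

  offDiagonal-refl : ∀ F u → offDiagonal F u u ≡ 0
  offDiagonal-refl F u = cong (if_then 0 else F (point u) (point u)) (dec-true (u Fin.≟ u) refl)

  offDiagonal-≢ : ∀ F {u v} → u ≢ v → offDiagonal F u v ≡ F (point u) (point v)
  offDiagonal-≢ F {u} {v} u≢v = cong (if_then 0 else F (point u) (point v)) (dec-false (u Fin.≟ v) u≢v)

  offDiagonal-≤ : ∀ F u v → offDiagonal F u v ℕ≤ F (point u) (point v)
  offDiagonal-≤ F u v with does (u Fin.≟ v)
  ... | true  = ℕ.z≤n
  ... | false = ℕ.≤-refl

  offDiagonal-sym : ∀ F → (∀ p q → F p q ≡ F q p) → ∀ u v → offDiagonal F u v ≡ offDiagonal F v u
  offDiagonal-sym F F-sym u v with u Fin.≟ v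
  ... | yes refl = sym (offDiagonal-refl F u)
  ... | no u≢v   = trans (F-sym (point u) (point v)) (sym (offDiagonal-≢ F (u≢v ∘ sym)))

  c δ : Fin n → Fin n → ℕ
  c = offDiagonal capacity
  δ = offDiagonal gauge

  capacity-sym : ∀ p q → capacity p q ≡ capacity q p
  capacity-sym (false ∷ x) (false ∷ y) = sum-cong-≗ {5 ℕ* m} λ j → ≟-swap (generators j)
    where
    move : ∀ {x y} g → x ⊕ g ≡ y → y ⊕ g ≡ x
    move {x} g e = trans (cong (_⊕ g) (sym e)) (⊕-cancelʳ x g)
    ≟-swap : ∀ g → (if does (x ⊕ g ≟ᵛ y) then 1 else 0) ≡ (if does (y ⊕ g ≟ᵛ x) then 1 else 0)
    ≟-swap g with x ⊕ g ≟ᵛ y | y ⊕ g ≟ᵛ x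
    ... | yes _ | yes _ = refl
    ... | no _  | no _  = refl
    ... | yes p | no ¬q = contradiction (move g p) ¬q
    ... | no ¬p | yes q = contradiction (move g q) ¬p
  capacity-sym (false ∷ x) (true ∷ y) with x ≟ᵛ y | y ≟ᵛ x
  ... | yes _ | yes _ = refl
  ... | no _  | no _  = refl
  ... | yes p | no ¬q = contradiction (sym p) ¬q
  ... | no ¬p | yes q = contradiction (sym q) ¬p
  capacity-sym (true ∷ x) (false ∷ y) = sym (capacity-sym (false ∷ y) (true ∷ x))
  capacity-sym (true ∷ x) (true ∷ y)  = refl

  gauge-sym : ∀ p q → gauge p q ≡ gauge q p
  gauge-sym (b ∷ x) (b′ ∷ y) = cong₂ _ℕ+_ (ℕ.+-comm (height b) (height b′)) (cong D (⊕-comm x y))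

  D-triangle : ∀ x y z → D (x ⊕ z) ℕ≤ D (x ⊕ y) ℕ+ D (y ⊕ z)
  D-triangle x y z = subst (λ w → D w ℕ≤ D (x ⊕ y) ℕ+ D (y ⊕ z)) cancel (distance-⊕ generators (x ⊕ y) (y ⊕ z))
    where
    cancel : (x ⊕ y) ⊕ (y ⊕ z) ≡ x ⊕ z
    cancel = trans (⊕-assoc x y (y ⊕ z)) (cong (x ⊕_) (⊕-cancelˡ y z))

  gauge-triangle : ∀ p q r → gauge p r ℕ≤ gauge p q ℕ+ gauge q r
  gauge-triangle (b ∷ x) (b′ ∷ y) (b″ ∷ z) = begin
    height b ℕ+ height b″ ℕ+ D (x ⊕ z)
      ≤⟨ ℕ.+-monoʳ-≤ (height b ℕ+ height b″) (D-triangle x y z) ⟩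
    height b ℕ+ height b″ ℕ+ (D (x ⊕ y) ℕ+ D (y ⊕ z))
      ≤⟨ ℕ.m≤m+n _ (height b′ ℕ+ height b′) ⟩
    height b ℕ+ height b″ ℕ+ (D (x ⊕ y) ℕ+ D (y ⊕ z)) ℕ+ (height b′ ℕ+ height b′)
      ≡⟨ regroup (height b) (height b″) (D (x ⊕ y)) (D (y ⊕ z)) (height b′) ⟩
    (height b ℕ+ height b′ ℕ+ D (x ⊕ y)) ℕ+ (height b′ ℕ+ height b″ ℕ+ D (y ⊕ z)) ∎
    where
    open ℕ.≤-Reasoning
    regroup : ∀ a c p q e → a ℕ+ c ℕ+ (p ℕ+ q) ℕ+ (e ℕ+ e) ≡ (a ℕ+ e ℕ+ p) ℕ+ (e ℕ+ c ℕ+ q)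
    regroup = ℕ-Solver.solve-∀

  δ-triangle : ∀ u v w → δ u w ℕ≤ δ u v ℕ+ δ v w
  δ-triangle u v w = go (u Fin.≟ v) (v Fin.≟ w)
    where
    go : Dec (u ≡ v) → Dec (v ≡ w) → δ u w ℕ≤ δ u v ℕ+ δ v w
    go (yes refl) _          = ℕ.m≤n+m (δ u w) (δ u u)
    go (no _)     (yes refl) = ℕ.m≤m+n (δ u v) (δ v v)
    go (no u≢v)   (no v≢w)   = ℕ.≤-trans (offDiagonal-≤ gauge u w)
      (ℕ.≤-trans (gauge-triangle (point u) (point v) (point w))
        (ℕ.≤-reflexive (sym (cong₂ _ℕ+_ (offDiagonal-≢ gauge u≢v) (offDiagonal-≢ gauge v≢w)))))

  -- In the enumeration by `point`, the second half of the vertices is the half with head `true`, so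
  -- `τ i` is the terminal hanging at `point i`.
  τ : Fin k → Fin n
  τ i = k ↑ʳ i

  terminals : Fin k ↣ Fin n
  terminals = mk↣ {to = τ} (Fin.↑ʳ-injective k _ _)

  G : CapGraph n
  G = naturalGraph c (offDiagonal-sym capacity capacity-sym) (offDiagonal-refl capacity)

  cubeSum² : (Cube (suc m) → Cube (suc m) → ℕ) → ℕ
  cubeSum² F = cubeSum λ p → cubeSum λ q → F p q

  sum²-point : ∀ F → sum (λ u → sum (λ v → F (point {suc m} u) (point {suc m} v))) ≡ cubeSum² F
  sum²-point F = trans (sum-cong-≗ {n} (λ u → cubeSum-point (F (point {suc m} u))))
    (cubeSum-point (λ p → cubeSum (F p)))

  cubeSum²-∷ : ∀ F → cubeSum² F ≡
    cubeSum (λ x → cubeSum (λ y → F (false ∷ x) (false ∷ y))) ℕ+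
    cubeSum (λ x → cubeSum (λ y → F (false ∷ x) (true ∷ y))) ℕ+
    (cubeSum (λ x → cubeSum (λ y → F (true ∷ x) (false ∷ y))) ℕ+
     cubeSum (λ x → cubeSum (λ y → F (true ∷ x) (true ∷ y))))
  cubeSum²-∷ F = trans (cubeSum-∷ (λ p → cubeSum (F p))) (cong₂ _ℕ+_ (half false) (half true))
    where
    half : ∀ b → cubeSum (λ x → cubeSum (F (b ∷ x))) ≡
      cubeSum (λ x → cubeSum (λ y → F (b ∷ x) (false ∷ y))) ℕ+ cubeSum (λ x → cubeSum (λ y → F (b ∷ x) (true ∷ y)))
    half b = trans (cubeSum-cong (λ x → cubeSum-∷ (F (b ∷ x)))) (cubeSum-∙ _ _)

  if-* : ∀ b a e → (if b then a else 0) ℕ* e ≡ (if b then a ℕ* e else 0)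
  if-* true  a e = refl
  if-* false a e = refl

  core-sum : ∀ (F : Cube m → Cube m → ℕ) →
    cubeSum (λ x → cubeSum (λ y → capacity (false ∷ x) (false ∷ y) ℕ* F x y)) ≡
    sum (λ j → cubeSum (λ x → F x (x ⊕ generators j)))
  core-sum F = begin
    cubeSum (λ x → cubeSum (λ y → capacity (false ∷ x) (false ∷ y) ℕ* F x y))
      ≡⟨ cubeSum-cong (λ x → cubeSum-cong (λ y →
           trans (*-distribʳ-sum {5 ℕ* m} (F x y) (λ j → if does (x ⊕ generators j ≟ᵛ y) then 1 else 0))
             (sum-cong-≗ {5 ℕ* m} (λ j → trans (if-* (does (x ⊕ generators j ≟ᵛ y)) 1 (F x y))
               (cong (if does (x ⊕ generators j ≟ᵛ y) then_else 0) (ℕ.*-identityˡ (F x y))))))) ⟩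
    cubeSum (λ x → cubeSum (λ y → sum (λ j → if does (x ⊕ generators j ≟ᵛ y) then F x y else 0)))
      ≡⟨ cubeSum-cong (λ x → trans (cubeSum-sum-comm {m} {5 ℕ* m} _)
           (sum-cong-≗ {5 ℕ* m} (λ j → cubeSum-select (x ⊕ generators j) (F x)))) ⟩
    cubeSum (λ x → sum (λ j → F x (x ⊕ generators j)))
      ≡⟨ cubeSum-sum-comm {m} {5 ℕ* m} _ ⟩
    sum (λ j → cubeSum (λ x → F x (x ⊕ generators j))) ∎
    where open ≡-Reasoning

  pendant-sum : ∀ (F : Cube m → Cube m → ℕ) →
    cubeSum (λ x → cubeSum (λ y → (if does (x ≟ᵛ y) then pendantCap else 0) ℕ* F x y)) ≡
    pendantCap ℕ* cubeSum (λ x → F x x)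
  pendant-sum F = trans
    (cubeSum-cong (λ x → trans (cubeSum-cong (λ y → if-* (does (x ≟ᵛ y)) pendantCap (F x y)))
      (cubeSum-select x (λ y → pendantCap ℕ* F x y))))
    (sym (*-distribˡ-cubeSum pendantCap (λ x → F x x)))

  -- `lower` is `2 * ℓ` times the bound of `cut+displacement`. In `upper`, 468 = 5 * 36 + 2 * 144:
  -- core edges have length at most 1, and pendant edges have capacity `144 * ℓ` and length `ℓ` and
  -- are met in both orders. The quotient of the two is of order ℓ.
  lower upper : ℕ
  lower = 2 ℕ* ℓ ℕ* (36 ℕ* (ℓ ℕ* ℓ) ℕ* k)
  upper = 468 ℕ* (ℓ ℕ* ℓ) ℕ* k

  volume : ℕ
  volume = sum λ u → sum λ v → δ u v ℕ* c u v

  volume≤upper : volume ℕ≤ upper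
  volume≤upper = begin
    volume
      ≤⟨ sum-mono-≤ {n} (λ u → sum-mono-≤ {n} (λ v → ℕ.*-mono-≤ (offDiagonal-≤ gauge u v) (offDiagonal-≤ capacity u v))) ⟩
    sum (λ u → sum (λ v → gauge (point {suc m} u) (point {suc m} v) ℕ* capacity (point {suc m} u) (point {suc m} v)))
      ≡⟨ sum²-point (λ p q → gauge p q ℕ* capacity p q) ⟩
    cubeSum² (λ p q → gauge p q ℕ* capacity p q)
      ≡⟨ trans (cubeSum-cong (λ p → cubeSum-cong (λ q → ℕ.*-comm (gauge p q) (capacity p q))))
           (cubeSum²-∷ (λ p q → capacity p q ℕ* gauge p q)) ⟩
    _ ≡⟨ cong₂ _ℕ+_ (cong₂ _ℕ+_ (core-sum (λ x y → D (x ⊕ y))) (pendant-sum (λ x y → ℓ ℕ+ D (x ⊕ y))))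
           (cong₂ _ℕ+_ (pendant-sum (λ x y → ℓ ℕ+ 0 ℕ+ D (x ⊕ y))) no-edges) ⟩
    sum (λ j → cubeSum (λ x → D (x ⊕ (x ⊕ generators j)))) ℕ+
    pendantCap ℕ* cubeSum (λ x → ℓ ℕ+ D (x ⊕ x)) ℕ+
    (pendantCap ℕ* cubeSum (λ x → ℓ ℕ+ 0 ℕ+ D (x ⊕ x)) ℕ+ 0)
      ≤⟨ ℕ.+-mono-≤ (ℕ.+-mono-≤ core≤ (ℕ.≤-reflexive (cong (pendantCap ℕ*_) (pendant ℓ))))
           (ℕ.≤-reflexive (cong (λ a → pendantCap ℕ* a ℕ+ 0) (pendant (ℓ ℕ+ 0)))) ⟩
    5 ℕ* m ℕ* k ℕ+ pendantCap ℕ* (k ℕ* ℓ) ℕ+ (pendantCap ℕ* (k ℕ* (ℓ ℕ+ 0)) ℕ+ 0)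
      ≡⟨ total ℓ k ⟩
    upper ∎
    where
    open ℕ.≤-Reasoning
    total : ∀ ℓ k → 5 ℕ* (36 ℕ* (ℓ ℕ* ℓ)) ℕ* k ℕ+ 144 ℕ* ℓ ℕ* (k ℕ* ℓ) ℕ+ (144 ℕ* ℓ ℕ* (k ℕ* (ℓ ℕ+ 0)) ℕ+ 0) ≡
            468 ℕ* (ℓ ℕ* ℓ) ℕ* k
    total = ℕ-Solver.solve-∀
    no-edges : cubeSum {m} (λ x → cubeSum {m} (λ y → 0)) ≡ 0
    no-edges = trans (cubeSum-cong {m} (λ x → trans (cubeSum-const m 0) (ℕ.*-zeroʳ (size m))))
      (trans (cubeSum-const m 0) (ℕ.*-zeroʳ (size m)))
    pendant : ∀ a → cubeSum (λ x → a ℕ+ D (x ⊕ x)) ≡ k ℕ* a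
    pendant a = trans (cubeSum-cong {m} (λ x → trans (cong (a ℕ+_) (trans (cong D (⊕-self x)) (distance-𝟎 generators)))
      (ℕ.+-identityʳ a))) (cubeSum-const m a)
    core≤ : sum (λ j → cubeSum (λ x → D (x ⊕ (x ⊕ generators j)))) ℕ≤ 5 ℕ* m ℕ* k
    core≤ = begin
      sum (λ j → cubeSum (λ x → D (x ⊕ (x ⊕ generators j))))
        ≤⟨ sum-mono-≤ {5 ℕ* m} (λ j → cubeSum-mono-≤ (λ x → ℕ.≤-trans
             (ℕ.≤-reflexive (cong D (⊕-cancelˡ x (generators j)))) (distance-generator generators j))) ⟩
      sum {5 ℕ* m} (λ j → cubeSum {m} (λ x → 1))
        ≡⟨ sum-cong-≗ {5 ℕ* m} (λ j → trans (cubeSum-const m 1) (ℕ.*-identityʳ k)) ⟩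
      sum {5 ℕ* m} (λ j → k)
        ≡⟨ sum-const (5 ℕ* m) k ⟩
      5 ℕ* m ℕ* k ∎

  δ-terminals : ∀ a b → a ≢ b → δ (τ a) (τ b) ≡ ℓ ℕ+ ℓ ℕ+ D (point {m} a ⊕ point b)
  δ-terminals a b a≢b = trans (offDiagonal-≢ gauge (a≢b ∘ Fin.↑ʳ-injective k a b))
    (cong₂ gauge (point-↑ʳ {m} a) (point-↑ʳ {m} b))

  cut-cost : ∀ a b → 2 ℕ* ℓ ℕ* diff a b ℕ≤ δ (τ a) (τ b)
  cut-cost a b = go (a Fin.≟ b)
    where
    go : (p : Dec (a ≡ b)) → 2 ℕ* ℓ ℕ* (if does p then 0 else 1) ℕ≤ δ (τ a) (τ b)
    go (yes _)  = ℕ.≤-trans (ℕ.≤-reflexive (ℕ.*-zeroʳ (2 ℕ* ℓ))) ℕ.z≤n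
    go (no a≢b) = ℕ.≤-trans (ℕ.≤-reflexive (twice ℓ))
      (ℕ.≤-trans (ℕ.m≤m+n (ℓ ℕ+ ℓ) _) (ℕ.≤-reflexive (sym (δ-terminals a b a≢b))))
      where
      twice : ∀ ℓ → 2 ℕ* ℓ ℕ* 1 ≡ ℓ ℕ+ ℓ
      twice = ℕ-Solver.solve-∀

  D≤δ : ∀ a b → D (point a ⊕ point b) ℕ≤ δ (τ a) (τ b)
  D≤δ a b = go (a Fin.≟ b)
    where
    go : Dec (a ≡ b) → D (point a ⊕ point b) ℕ≤ δ (τ a) (τ b)
    go (yes refl) = ℕ.≤-trans (ℕ.≤-reflexive (trans (cong D (⊕-self (point {m} a))) (distance-𝟎 generators))) ℕ.z≤n
    go (no a≢b)   = ℕ.≤-trans (ℕ.m≤n+m _ (ℓ ℕ+ ℓ)) (ℕ.≤-reflexive (sym (δ-terminals a b a≢b)))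

  -- A cut core edge is stretched to at least `2 * ℓ`, since a path between distinct terminals uses
  -- two pendant edges. The pendant edge at `x` is stretched to at least the displacement of `x`,
  -- since `f` fixes its terminal. Meeting pendant edges in both orders gives them weight
  -- `2 * pendantCap`, which is `2 * ℓ * 144` as required.
  lower≤cost : ∀ (f : Fin n → Fin k) → FixesTerminals terminals f →
    lower ℕ≤ sum (λ u → sum (λ v → c u v ℕ* δ (τ (f u)) (τ (f v))))
  lower≤cost f fixes = begin
    2 ℕ* ℓ ℕ* (36 ℕ* (ℓ ℕ* ℓ) ℕ* k)
      ≤⟨ ℕ.*-monoʳ-≤ (2 ℕ* ℓ) (cut+displacement φ) ⟩
    2 ℕ* ℓ ℕ* (cut φ ℕ+ 144 ℕ* displacement φ)
      ≡⟨ split ℓ (cut φ) (displacement φ) ⟩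
    2 ℕ* ℓ ℕ* cut φ ℕ+ pendantCap ℕ* displacement φ ℕ+ (pendantCap ℕ* displacement φ ℕ+ 0)
      ≤⟨ ℕ.+-mono-≤ (ℕ.+-mono-≤ core≥ (ℕ.*-monoʳ-≤ pendantCap (cubeSum-mono-≤ out)))
           (ℕ.+-mono-≤ (ℕ.*-monoʳ-≤ pendantCap (cubeSum-mono-≤ back)) ℕ.z≤n) ⟩
    sum (λ j → cubeSum (λ x → Δ (false ∷ x) (false ∷ (x ⊕ generators j)))) ℕ+
    pendantCap ℕ* cubeSum (λ x → Δ (false ∷ x) (true ∷ x)) ℕ+
    (pendantCap ℕ* cubeSum (λ x → Δ (true ∷ x) (false ∷ x)) ℕ+
     cubeSum (λ x → cubeSum (λ y → capacity (true ∷ x) (true ∷ y) ℕ* Δ (true ∷ x) (true ∷ y))))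
      ≡⟨ cong₂ _ℕ+_ (cong₂ _ℕ+_ (core-sum (λ x y → Δ (false ∷ x) (false ∷ y)))
                                (pendant-sum (λ x y → Δ (false ∷ x) (true ∷ y))))
           (cong (_ℕ+ cubeSum (λ x → cubeSum (λ y → capacity (true ∷ x) (true ∷ y) ℕ* Δ (true ∷ x) (true ∷ y))))
             (pendant-sum (λ x y → Δ (true ∷ x) (false ∷ y)))) ⟨
    _ ≡⟨ cubeSum²-∷ (λ p q → capacity p q ℕ* Δ p q) ⟨
    cubeSum² (λ p q → capacity p q ℕ* Δ p q)
      ≡⟨ sum²-point (λ p q → capacity p q ℕ* Δ p q) ⟨
    sum (λ u → sum (λ v → capacity (point {suc m} u) (point {suc m} v) ℕ* Δ (point {suc m} u) (point {suc m} v)))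
      ≡⟨ sum-cong-≗ {n} (λ u → sum-cong-≗ {n} (λ v → sym (unpoint u v))) ⟩
    sum (λ u → sum (λ v → c u v ℕ* δ (τ (f u)) (τ (f v)))) ∎
    where
    open ℕ.≤-Reasoning
    Δ : Cube (suc m) → Cube (suc m) → ℕ
    Δ p q = δ (τ (f (index p))) (τ (f (index q)))
    φ : Cube m → Fin k
    φ x = f (index (false ∷ x))
    split : ∀ ℓ a b → 2 ℕ* ℓ ℕ* (a ℕ+ 144 ℕ* b) ≡
            2 ℕ* ℓ ℕ* a ℕ+ 144 ℕ* ℓ ℕ* b ℕ+ (144 ℕ* ℓ ℕ* b ℕ+ 0)
    split = ℕ-Solver.solve-∀
    core≥ : 2 ℕ* ℓ ℕ* cut φ ℕ≤ sum (λ j → cubeSum (λ x → Δ (false ∷ x) (false ∷ (x ⊕ generators j))))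
    core≥ = ℕ.≤-trans
      (ℕ.≤-reflexive (trans (*-distribˡ-sum {5 ℕ* m} (2 ℕ* ℓ) (λ j → cubeSum (λ x → diff (φ x) (φ (x ⊕ generators j)))))
        (sum-cong-≗ {5 ℕ* m} (λ j → *-distribˡ-cubeSum (2 ℕ* ℓ) (λ x → diff (φ x) (φ (x ⊕ generators j)))))))
      (sum-mono-≤ {5 ℕ* m} (λ j → cubeSum-mono-≤ (λ x → cut-cost (φ x) (φ (x ⊕ generators j)))))
    terminal : ∀ x → f (index (true ∷ x)) ≡ index x
    terminal x = fixes (index x)
    out : ∀ x → D (x ⊕ point (φ x)) ℕ≤ Δ (false ∷ x) (true ∷ x)
    out x = ℕ.≤-trans (ℕ.≤-reflexive (cong D (trans (⊕-comm x (point (φ x)))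
        (cong (point (φ x) ⊕_) (sym (point-index x))))))
      (subst (λ a → D (point (φ x) ⊕ point (index x)) ℕ≤ δ (τ (φ x)) (τ a)) (sym (terminal x)) (D≤δ (φ x) (index x)))
    back : ∀ x → D (x ⊕ point (φ x)) ℕ≤ Δ (true ∷ x) (false ∷ x)
    back x = ℕ.≤-trans (out x) (ℕ.≤-reflexive (offDiagonal-sym gauge gauge-sym (τ (φ x)) _))
    unpoint : ∀ u v → c u v ℕ* δ (τ (f u)) (τ (f v)) ≡
              capacity (point {suc m} u) (point {suc m} v) ℕ* Δ (point {suc m} u) (point {suc m} v)
    unpoint u v = trans (off (u Fin.≟ v)) (cong₂ (λ a b → capacity (point {suc m} u) (point {suc m} v) ℕ* δ (τ (f a)) (τ (f b)))
        (sym (index-point {suc m} u)) (sym (index-point {suc m} v)))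
      where
      -- Removing loops from the capacities loses nothing, since their images are at distance 0.
      off : Dec (u ≡ v) → c u v ℕ* δ (τ (f u)) (τ (f v)) ≡
            capacity (point {suc m} u) (point {suc m} v) ℕ* δ (τ (f u)) (τ (f v))
      off (no u≢v)   = cong (_ℕ* δ (τ (f u)) (τ (f v))) (offDiagonal-≢ capacity u≢v)
      off (yes refl) = trans (cong (c u u ℕ*_) (offDiagonal-refl gauge (τ (f u))))
        (trans (ℕ.*-zeroʳ (c u u)) (sym (trans (cong (capacity (point {suc m} u) (point {suc m} u) ℕ*_) (offDiagonal-refl gauge (τ (f u))))
          (ℕ.*-zeroʳ (capacity (point {suc m} u) (point {suc m} u))))))

  quality : ∀ H → IsConvexCombinationOf0-Extensions G terminals H → ∀ ρ → RoutableBack G terminals H ρ →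
            ι lower ≤ ρ * ι volume
  quality = quality-bound c (offDiagonal-sym capacity capacity-sym) (offDiagonal-refl capacity) terminals
    δ (offDiagonal-refl gauge) (offDiagonal-sym gauge gauge-sym) δ-triangle lower lower≤cost

-- The comparison with √log₂ k and the theorem

⌊√log₂⌋-upper : ∀ N a k → k ℕ.≤ 2 ℕ.^ (a ℕ.* a) → ⌊ N √log₂ k ⌋ ℕ.≤ a ℕ.* N
⌊√log₂⌋-upper N a k k≤2^a² = ℕ.≮⇒≥ λ aN<s → ℕ.<⇒≱ (ℕ.*-mono-< aN<s aN<s) (begin
  s ℕ.* s                                   ≤⟨ proj₁ (isqrt-spec ⌊log₂ (k ℕ.^ (N ℕ.* N)) ⌋) ⟩
  ⌊log₂ (k ℕ.^ (N ℕ.* N)) ⌋                 ≤⟨ ⌊log₂⌋-mono-≤ (ℕ.^-monoˡ-≤ (N ℕ.* N) k≤2^a²) ⟩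
  ⌊log₂ ((2 ℕ.^ (a ℕ.* a)) ℕ.^ (N ℕ.* N)) ⌋ ≡⟨ cong ⌊log₂_⌋ (ℕ.^-*-assoc 2 (a ℕ.* a) (N ℕ.* N)) ⟩
  ⌊log₂ (2 ℕ.^ ((a ℕ.* a) ℕ.* (N ℕ.* N))) ⌋ ≡⟨ ⌊log₂[2^n]⌋≡n ((a ℕ.* a) ℕ.* (N ℕ.* N)) ⟩
  (a ℕ.* a) ℕ.* (N ℕ.* N)                   ≡⟨ *-swap² a N ⟨
  (a ℕ.* N) ℕ.* (a ℕ.* N)                   ∎)
  where
  open ℕ.≤-Reasoning
  s = ⌊ N √log₂ k ⌋

-- At `2 ^ (a * a)` the logarithm and the square root inside the approximations are exact, so every
-- term of the defining sequence is already at most `a`.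
√log₂-upper : ∀ a k → k ℕ.≤ 2 ℕ.^ (a ℕ.* a) → √log₂ k ≤ ι a
√log₂-upper a zero    _ = ι-nonneg a
√log₂-upper a (suc k) p = ≤-pointwise {√log₂ (suc k)} {ι a} λ i →
  subst (√log₂-approx (suc k) i ℚ.≤_) (sym (seq-ι a i))
    (/-mono-≤ ⌊ suc i √log₂ suc k ⌋ a i 0
      (subst (ℕ._≤ a ℕ.* suc i) (sym (ℕ.*-identityʳ _)) (⌊√log₂⌋-upper (suc i) a (suc k) p)))

<⇒+ε≤ : ∀ {x y} → x < y → ∃ λ ε → 0ℚ ℚ.< ε × x + fromℚ ε ≤ y
<⇒+ε≤ {x} {y} (mk< (ε , 0<ε , N , p)) = ε , 0<ε , mk≤ λ η 0<η → N , λ n N≤n →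
  ℚ.≤-trans (p n N≤n) (subst (ℚ._≤ seq y n ℚ.+ η) (ℚ.+-identityʳ (seq y n))
    (ℚ.+-monoʳ-≤ (seq y n) (ℚ.<⇒≤ 0<η)))

fromℚ-pos : ∀ {ε} → 0ℚ ℚ.< ε → ¬ (fromℚ ε ≤ 0ℝ)
fromℚ-pos {ε} 0<ε ε≤0 = let N , p = ≤-close ε≤0 (½ ℚ.* ε) (half>0 0<ε) in
  ℚ.<-irrefl refl (ℚ.<-≤-trans (begin-strict
    0ℚ ℚ.+ ½ ℚ.* ε       <⟨ ℚ.+-monoˡ-< (½ ℚ.* ε) (half>0 0<ε) ⟩
    ½ ℚ.* ε ℚ.+ ½ ℚ.* ε  ≡⟨ half+half ε ⟩
    ε                    ∎) (p N ℕ.≤-refl))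
  where open ℚ.≤-Reasoning

fromℚ-nonneg : ∀ {ε} → 0ℚ ℚ.≤ ε → 0ℝ ≤ fromℚ ε
fromℚ-nonneg {ε} 0≤ε = ≤-pointwise {0ℝ} {fromℚ ε} λ _ → 0≤ε

m≤size : ∀ m → m ℕ.≤ size m
m≤size zero    = ℕ.z≤n
m≤size (suc m) = ℕ.+-mono-≤ (size>0 m) (m≤size m)
  where
  size>0 : ∀ m → 1 ℕ.≤ size m
  size>0 m = subst (1 ℕ.≤_) (sym (size≡2^ m)) (ℕ.m^n>0 2 m)

-- √(log₂ k) = 6 ℓ and upper * 6 ℓ = 39 * lower in the gap instances below.
κ : ℝ
κ = fromℚ ((ℤ.+ 1) ℚ./ 39)

0<κ : 0ℝ < κ
0<κ = mk< ((ℤ.+ 1) ℚ./ 39 , ℚ.positive⁻¹ _ , 0 , λ _ _ → ℚ.≤-reflexive (ℚ.+-identityˡ _))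

κ*39 : κ * ι 39 ≈ 1ℝ
κ*39 = ≈-pointwise {κ * ι 39} {1ℝ} λ i → cong ((ℤ.+ 1) ℚ./ 39 ℚ.*_) (seq-ι 39 i)

module _ (ℓ : ℕ) .{{_ : ℕ.NonZero ℓ}} where
  open Gap ℓ

  private
    a : ℕ
    a = 6 ℕ.* ℓ

    a² : a ℕ.* a ≡ 36 ℕ.* (ℓ ℕ.* ℓ)
    a² = square ℓ
      where
      square : ∀ ℓ → 6 ℕ.* ℓ ℕ.* (6 ℕ.* ℓ) ≡ 36 ℕ.* (ℓ ℕ.* ℓ)
      square = ℕ-Solver.solve-∀

    upper*a : upper ℕ.* a ≡ 39 ℕ.* lower
    upper*a = numbers ℓ k
      where
      numbers : ∀ ℓ k → 468 ℕ.* (ℓ ℕ.* ℓ) ℕ.* k ℕ.* (6 ℕ.* ℓ) ≡ 39 ℕ.* (2 ℕ.* ℓ ℕ.* (36 ℕ.* (ℓ ℕ.* ℓ) ℕ.* k))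
      numbers = ℕ-Solver.solve-∀

    lower>0 : 1 ℕ.≤ lower
    lower>0 = ℕ.>-nonZero⁻¹ lower
      where
      instance
        k≢0 : ℕ.NonZero k
        k≢0 = subst ℕ.NonZero (sym (size≡2^ (36 ℕ.* (ℓ ℕ.* ℓ)))) (ℕ.m^n≢0 2 (36 ℕ.* (ℓ ℕ.* ℓ)))
        ℓ²≢0 : ℕ.NonZero (ℓ ℕ.* ℓ)
        ℓ²≢0 = ℕ.m*n≢0 ℓ ℓ
        36ℓ²≢0 : ℕ.NonZero (36 ℕ.* (ℓ ℕ.* ℓ))
        36ℓ²≢0 = ℕ.m*n≢0 36 (ℓ ℕ.* ℓ)
        36ℓ²k≢0 : ℕ.NonZero (36 ℕ.* (ℓ ℕ.* ℓ) ℕ.* k)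
        36ℓ²k≢0 = ℕ.m*n≢0 (36 ℕ.* (ℓ ℕ.* ℓ)) k
        2ℓ≢0 : ℕ.NonZero (2 ℕ.* ℓ)
        2ℓ≢0 = ℕ.m*n≢0 2 ℓ
        lower≢0 : ℕ.NonZero lower
        lower≢0 = ℕ.m*n≢0 (2 ℕ.* ℓ) (36 ℕ.* (ℓ ℕ.* ℓ) ℕ.* k)

    √log₂k≤a : √log₂ k ≤ ι a
    √log₂k≤a = √log₂-upper a k (ℕ.≤-reflexive (trans (size≡2^ (36 ℕ.* (ℓ ℕ.* ℓ))) (cong (2 ℕ.^_) (sym a²))))

    κ*-mono : ∀ {x y} → x ≤ y → κ * x ≤ κ * y
    κ*-mono {x} {y} x≤y = mk≤ λ ε 0<ε → let N , p = ≤-close x≤y ε 0<ε in N , λ i N≤i → begin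
      q ℚ.* seq x i                  ≤⟨ ℚ.*-monoˡ-≤-nonNeg q (p i N≤i) ⟩
      q ℚ.* (seq y i ℚ.+ ε)          ≡⟨ ℚ.*-distribˡ-+ q (seq y i) ε ⟩
      q ℚ.* seq y i ℚ.+ q ℚ.* ε      ≤⟨ ℚ.+-monoʳ-≤ (q ℚ.* seq y i) (ℚ.*-monoʳ-≤-nonNeg ε {{ℚ.nonNegative (ℚ.<⇒≤ 0<ε)}} q≤1) ⟩
      q ℚ.* seq y i ℚ.+ 1ℚ ℚ.* ε     ≡⟨ cong (q ℚ.* seq y i ℚ.+_) (ℚ.*-identityˡ ε) ⟩
      q ℚ.* seq y i ℚ.+ ε            ∎
      where
      open ℚ.≤-Reasoning
      q = (ℤ.+ 1) ℚ./ 39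
      q≤1 : q ℚ.≤ 1ℚ
      q≤1 = ℚ.≤ᵇ⇒≤ _

    upper*κ*a : ι upper * (κ * ι a) ≈ ι lower
    upper*κ*a = begin-equality
      ι upper * (κ * ι a)      ≈⟨ *-congˡ (*-comm κ (ι a)) ⟩
      ι upper * (ι a * κ)      ≈⟨ *-assoc (ι upper) (ι a) κ ⟨
      ι upper * ι a * κ        ≈⟨ *-congʳ κ (ι-* upper a) ⟨
      ι (upper ℕ.* a) * κ      ≈⟨ *-congʳ κ (≡⇒≈ (cong ι upper*a)) ⟩
      ι (39 ℕ.* lower) * κ     ≈⟨ *-congʳ κ (ι-* 39 lower) ⟩
      ι 39 * ι lower * κ       ≈⟨ *-comm (ι 39 * ι lower) κ ⟩
      κ * (ι 39 * ι lower)     ≈⟨ *-assoc κ (ι 39) (ι lower) ⟨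
      κ * ι 39 * ι lower       ≈⟨ *-congʳ (ι lower) κ*39 ⟩
      1ℝ * ι lower             ≈⟨ *-identityˡ (ι lower) ⟩
      ι lower                  ∎
      where open PreorderReasoning ≤-preorder

  -- The gap `ε` between `ρ` and the claimed quality survives multiplication by `volume`, while
  -- duality bounds `lower` by `ρ * ι volume`; together they force `ι volume * fromℚ ε` to be at
  -- most 0. Positive volume contradicts this directly, and zero volume contradicts `lower>0`.
  gap : ∀ H → IsConvexCombinationOf0-Extensions G terminals H → QualityAtLeast G terminals H (κ * √log₂ k)
  gap H convex ρ ρ<κ√log₂k routable = excess (volume ℕ.≟ 0)
    where
    open PreorderReasoning ≤-preorder
    ε = proj₁ (<⇒+ε≤ ρ<κ√log₂k)
    0<ε = proj₁ (proj₂ (<⇒+ε≤ ρ<κ√log₂k))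
    ρ+ε≤κ√log₂k = proj₂ (proj₂ (<⇒+ε≤ ρ<κ√log₂k))
    0≤κ*a : 0ℝ ≤ κ * ι a
    0≤κ*a = ≤-trans (≈⇒≤ (≈-sym (zeroʳ κ))) (κ*-mono (ι-nonneg a))
    volume*ε≤0 : ι volume * fromℚ ε ≤ 0ℝ
    volume*ε≤0 = +-cancelˡ-≤ (ι volume * ρ) (begin
      ι volume * ρ + ι volume * fromℚ ε  ≈⟨ distribˡ (ι volume) ρ (fromℚ ε) ⟨
      ι volume * (ρ + fromℚ ε)           ≲⟨ ι*-mono volume (≤-trans ρ+ε≤κ√log₂k (κ*-mono √log₂k≤a)) ⟩
      -- The sign of `ρ` is unknown, so `volume≤upper` is applied only here, where the other factor
      -- `κ * ι a` is nonnegative.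
      ι volume * (κ * ι a)               ≲⟨ ι-*-mono (κ * ι a) 0≤κ*a volume≤upper ⟩
      ι upper * (κ * ι a)                ≈⟨ upper*κ*a ⟩
      ι lower                            ≲⟨ quality H convex ρ routable ⟩
      ρ * ι volume                       ≈⟨ *-comm ρ (ι volume) ⟩
      ι volume * ρ                       ≈⟨ ℝ-+-identityʳ _ ⟨
      ι volume * ρ + 0ℝ                  ∎)
    excess : ¬ Dec (volume ≡ 0)
    excess (yes volume≡0) = fromℚ-pos (ℚ.positive⁻¹ 1ℚ) (begin
      1ℝ               ≈⟨ ι-1 ⟨
      ι 1              ≲⟨ ι-mono lower>0 ⟩
      ι lower          ≲⟨ quality H convex ρ routable ⟩
      ρ * ι volume     ≈⟨ *-congˡ (≈-trans (≡⇒≈ (cong ι volume≡0)) ι-0) ⟩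
      ρ * 0ℝ           ≈⟨ zeroʳ ρ ⟩
      0ℝ               ∎)
    excess (no volume≢0) = fromℚ-pos 0<ε (begin
      fromℚ ε              ≈⟨ *-identityˡ (fromℚ ε) ⟨
      1ℝ * fromℚ ε         ≈⟨ *-congʳ (fromℚ ε) ι-1 ⟨
      ι 1 * fromℚ ε        ≲⟨ ι-*-mono (fromℚ ε) (fromℚ-nonneg (ℚ.<⇒≤ 0<ε)) (ℕ.n≢0⇒n>0 volume≢0) ⟩
      ι volume * fromℚ ε   ≲⟨ volume*ε≤0 ⟩
      0ℝ                   ∎)

theorem5p1 : ∃ λ (C : ℝ) → 0ℝ < C ×
    (∀ (k₀ : ℕ) → ∃ λ (k : ℕ) → k₀ ℕ.≤ k ×
    (∃ λ (n : ℕ) → Σ (CapGraph n) λ G → Σ (Fin k ↣ Fin n) λ K →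
    (H : CapGraph k) → IsFlowSparsifier G K H →
    IsConvexCombinationOf0-Extensions G K H →
    QualityAtLeast G K H (C * √log₂ k)))
theorem5p1 = κ , 0<κ , λ k₀ →
  -- The successor makes `ℓ` nonzero, and `k` is at least its own logarithm `36 * (ℓ * ℓ)`, hence at
  -- least `k₀`.
  let ℓ = suc k₀
      open Gap ℓ
      k₀≤k = ℕ.≤-trans (ℕ.≤-trans (ℕ.n≤1+n k₀) (ℕ.≤-trans (ℕ.m≤m*n ℓ ℓ) (ℕ.m≤n*m (ℓ ℕ.* ℓ) 36)))
                       (m≤size (36 ℕ.* (ℓ ℕ.* ℓ)))
  in k , k₀≤k , n , G , terminals , λ H _ convex → gap ℓ H convex
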